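{- Let $\pi:\widetilde{\Gamma}\to\Gamma$ be a dilated double cover of metric graphs, with $\Gamma$ connected. Let $h=g(\widetilde{\Gamma})-g(\Gamma)$, which is the dimension of the tropical Prym variety $\mathrm{Prym}(\widetilde{\Gamma}/\Gamma)$, and let $d(\widetilde{\Gamma}/\Gamma)$ be the number of connected components of the dilation subgraph $\Gamma_{\mathrm{dil}}\subset\Gamma$. Then \[ \mathrm{Vol}^2(\mathrm{Prym}(\widetilde{\Gamma}/\Gamma))=2^{1-d(\widetilde{\Gamma}/\Gamma)}\sum_{F\subset E(\Gamma)}4^{r(F)-1}\prod_{e\in F}\ell(e), \] where the sum is taken over all ($h$-element) ogods $F\subset E(\Gamma)$ and $r(F)$ denotes the rank of the ogod $F$.
   Context: **Graphs.** A graph $G$ has a finite non-empty vertex set $V(G)$, a finite set $H(G)$ of half-edges with a root map $r:H(G)\to V(G)$ and a fixed-point-free involution on $H(G)$ whose orbits $e=\{h,h'\}$ are the edges; $E(G)$ is the set of edges. Loops and multiple edges are allowed. The genus of a connected graph is $g(G)=b_1(G)=\#E(G)-\#V(G)+1$ (there are no vertex weights). A metric graph $\Gamma$ is a graph together with a positive length $\ell(e)$ for each edge $e$; a choice of underlying graph (model) is always fixed, and we write $V(\Gamma),E(\Gamma)$, etc. **Double covers.** A double cover $\pi:\widetilde{\Gamma}\to\Gamma$ consists of maps $V(\widetilde{\Gamma})\to V(\Gamma)$ and $H(\widetilde{\Gamma})\to H(\Gamma)$ commuting with the root maps and the edge involutions, and a degree function $d_\pi:V(\widetilde{\Gamma})\cup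 E(\widetilde{\Gamma})\to\mathbb{Z}_{>0}$ (the degree of a half-edge is that of its edge) such that: (i) for every $\widetilde{v}\in V(\widetilde{\Gamma})$ and every half-edge $h$ rooted at $\pi(\widetilde{v})$, $d_\pi(\widetilde{v})$ is the sum of $d_\pi(\widetilde{h})$ over the half-edges $\widetilde{h}$ rooted at $\widetilde{v}$ with $\pi(\widetilde{h})=h$; (ii) the degrees of the preimages of each vertex and each half-edge of $\Gamma$ sum to $2$; (iii) $\ell(\pi(\widetilde{e}))=d_\pi(\widetilde{e})\,\ell(\widetilde{e})$ for all $\widetilde{e}\in E(\widetilde{\Gamma})$. A vertex or edge of $\Gamma$ is dilated if it has a single preimage (of degree $2$), and undilated if it has two preimages (each of degree $1$). The dilated vertices and edges form the dilation subgraph $\Gamma_{\mathrm{dil}}\subset\Gamma$. The cover is dilated if $\Gamma_{\mathrm{dil}}\neq\emptyset$; when $\Gamma$ is connected, $\widetilde{\Gamma}$ is then connected too. **Ogods.** Let $h=g(\widetilde{\Gamma})-g(\Gamma)$. A set $F\subset E(\Gamma)$ of exactly $h$ edges is an ogod if no edge in $F$ is dilated and each connected component of $\Gamma\backslash F$ (the interiors of the edges in $F$ are removed, all vertices are kept) has connected preimage in $\widetilde{\Gamma}$. Its rank $r(F)$ is the number of connected components of $\Gamma\backslash F$. **Homology and the Prym variety.** Fix orientations compatible with $\pi$. $H_1(\Gamma,\mathbb{Z})\subset\mathbb{Z}^{E(\Gamma)}$ is the simplicial homology, with edge length pairing $\left[\sum a_e e,\sum b_e e\right]_\Gamma=\sum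 a_e b_e\ell(e)$; similarly for $\widetilde{\Gamma}$. The maps $\pi_*:H_1(\widetilde{\Gamma},\mathbb{Z})\to H_1(\Gamma,\mathbb{Z})$ and $\pi^*:H_1(\Gamma,\mathbb{Z})\to H_1(\widetilde{\Gamma},\mathbb{Z})$ are induced by $\pi_*(\widetilde{e})=\pi(\widetilde{e})$, and by $\pi^*(e)=2\widetilde{e}$ if $e$ is dilated with preimage $\widetilde{e}$, $\pi^*(e)=\widetilde{e}^++\widetilde{e}^-$ if $e$ is undilated with preimages $\widetilde{e}^\pm$. Let $K'=\ker\pi_*$, and let $K$ be the quotient of $\mathrm{coker}\,\pi^*$ by its torsion subgroup; both are free abelian of rank $h$. The pairing $[\cdot,\cdot]_{\widetilde{\Gamma}}$ induces a well-defined non-degenerate pairing $[\cdot,\cdot]_P:K\times K'\to\mathbb{R}$. The tropical Prym variety $\mathrm{Prym}(\widetilde{\Gamma}/\Gamma)$ is the real torus $\mathrm{Hom}(K,\mathbb{R})/K'$ with this integral structure and with a principal polarization, i.e. an isomorphism $\zeta:K'\to K$ such that $(\lambda,\mu)_P=[\zeta(\lambda),\mu]_P$ is symmetric and positive definite on $K'$. Its volume is defined by $\mathrm{Vol}^2=\det\big((\lambda_i,\lambda_j)_P\big)$ for any basis $\lambda_1,\ldots,\lambda_h$ of $K'$. Since $\zeta$ is an isomorphism of lattices, this number does not depend on $\zeta$ and equals \[ \mathrm{Vol}^2(\mathrm{Prym}(\widetilde{\Gamma}/\Gamma))=\left|\det\big([\kappa_i,\lambda_j]_P\big)_{1\le i,j\le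 h}\right| \] for any bases $\kappa_1,\ldots,\kappa_h$ of $K$ and $\lambda_1,\ldots,\lambda_h$ of $K'$; this formula is to be taken as the definition of $\mathrm{Vol}^2(\mathrm{Prym}(\widetilde{\Gamma}/\Gamma))$ (it equals $1$ if $h=0$). -}

module Defs where

open import Level using (Level; 0ℓ; _⊔_) renaming (suc to lsuc)
open import Algebra.Bundles using (RawMonoid; Semiring; CommutativeRing)
import Algebra.Definitions.RawMonoid as RawMonoidDefs
import Algebra.Definitions.RawSemiring as RawSemiringDefs
open import Data.Bool.Base using (if_then_else_)
open import Data.Fin.Base using (Fin; zero; suc; toℕ; punchIn)
open import Data.Fin.Properties using (_≟_; any?; all?)
open import Data.Fin.Subset using (Subset; inside; outside; _∈_; _∉_; ∣_∣)
open import Data.Fin.Subset.Properties using (_∈?_)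
open import Data.Integer.Base as ℤ using (ℤ; +_; -[1+_])
import Data.Integer.Properties as ℤ
open import Data.List.Base as List using (List; []; _∷_)
open import Data.List.Membership.Propositional using () renaming (_∈_ to _∈ₗ_)
open import Data.List.Membership.Propositional.Properties
  using (∈-map⁺; ∈-map⁻; ∈-filter⁺; ∈-filter⁻; ∈-allFin)
open import Data.List.Relation.Unary.Any using (here; there)
open import Data.Nat.Base as ℕ using (ℕ; zero; suc; NonZero)
open import Data.Product using (∃; ∃!; _×_; _,_; proj₁; proj₂)
open import Data.Sum.Base using (_⊎_; inj₁; inj₂)
open import Data.Vec.Base using ([]; _∷_)
open import Data.Vec.Functional using (Vector)
open import Function.Base using (_∘_; case_of_)
open import Function.Bundles using (_⇔_; Equivalence)
open import Relation.Binary.Construct.Closure.ReflexiveTransitive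
  using (Star; ε; _◅_; _◅◅_; gmap)
open import Relation.Binary.Core using (Rel)
open import Relation.Binary.Definitions using (tri<; tri≈; tri>)
  renaming (Decidable to Decidable₂)
open import Relation.Binary.PropositionalEquality.Core
  using (_≡_; _≢_; refl; sym; trans; cong; subst)
open import Relation.Binary.Structures using (IsStrictTotalOrder)
open import Relation.Nullary.Decidable.Core
  using (Dec; yes; no; does; map′; _×-dec_; _⊎-dec_; _→-dec_; ¬?)
open import Relation.Nullary.Negation.Core using (¬_; contradiction)
open import Relation.Unary using (Pred; Decidable; U)
open import Relation.Unary.Properties using (U?)

module BigOperator {a ℓ} (M : RawMonoid a ℓ) where
  open RawMonoid M using (Carrier) renaming (ε to unit)

  fold-over : ∀ {n p} {P : Pred (Fin n) p} → Decidable P → Vector Carrier n → Carrier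
  fold-over P? f = RawMonoidDefs.sum M λ i → if does (P? i) then f i else unit

open BigOperator ℕ.+-0-rawMonoid using () renaming (fold-over to ∑ᴺ)
open BigOperator ℤ.+-0-rawMonoid using () renaming (fold-over to ∑ᶻ)

subsets : ∀ n → List (Subset n)
subsets zero    = [] ∷ []
subsets (suc n) =
  List.map (outside ∷_) (subsets n) List.++ List.map (inside ∷_) (subsets n)

-- The standard library has no real numbers; lengths and volumes take
-- values in an arbitrary ordered field.  As usual for a total inversion,
-- 0# ⁻¹ is unspecified.

record OrderedField c ℓ₁ ℓ₂ : Set (lsuc (c ⊔ ℓ₁ ⊔ ℓ₂)) where
  field
    commutativeRing : CommutativeRing c ℓ₁

  open CommutativeRing commutativeRing public hiding (refl; sym; trans; zero)

  infix 4 _<_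
  infix 9 _⁻¹
  field
    _<_                : Rel Carrier ℓ₂
    isStrictTotalOrder : IsStrictTotalOrder _≈_ _<_
    0<1                : 0# < 1#
    +-monoʳ-<          : ∀ z {x y} → x < y → z + x < z + y
    *-positive         : ∀ {x y} → 0# < x → 0# < y → 0# < x * y
    _⁻¹                : Carrier → Carrier
    ⁻¹-cong            : ∀ {x y} → x ≈ y → x ⁻¹ ≈ y ⁻¹
    *-inverseʳ         : ∀ {x} → ¬ (x ≈ 0#) → x * x ⁻¹ ≈ 1#

  open RawSemiringDefs (Semiring.rawSemiring semiring) public
    using (sum; _^_) renaming (_×_ to _·_)
  open BigOperator (Semiring.*-rawMonoid semiring) public
    using () renaming (fold-over to ∏)

  abs : Carrier → Carrier
  abs x with IsStrictTotalOrder.compare isStrictTotalOrder x 0#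
  ... | tri< _ _ _ = - x
  ... | tri≈ _ _ _ = x
  ... | tri> _ _ _ = x

  fromℤ : ℤ → Carrier
  fromℤ (+ n)    = n · 1#
  fromℤ -[1+ n ] = - (suc n · 1#)

  infixr 8 _^ℤ_
  _^ℤ_ : Carrier → ℤ → Carrier
  x ^ℤ (+ n)    = x ^ n
  x ^ℤ -[1+ n ] = (x ^ suc n) ⁻¹

  ∑ₗ : ∀ {a} {A : Set a} → List A → (A → Carrier) → Carrier
  ∑ₗ xs f = List.foldr _+_ 0# (List.map f xs)

  -- Laplace expansion along the first row; the empty determinant is 1.
  det : ∀ {n} → (Fin n → Fin n → Carrier) → Carrier
  det {zero}  M = 1#
  det {suc n} M = sum λ j →
    (- 1#) ^ toℕ j * (M zero j * det (λ i k → M (suc i) (punchIn j k)))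

-- The vertex, half-edge and edge sets are enumerated by Fin.  The edge
-- set is presented as the quotient of the half-edges by the orbits of ι.

record Graph : Set where
  field
    #V #H #E : ℕ
    {{nonEmpty}} : NonZero #V

  V : Set
  V = Fin #V

  H : Set
  H = Fin #H

  E : Set
  E = Fin #E

  field
    r               : H → V
    ι               : H → H
    ι-involutive    : ∀ h → ι (ι h) ≡ h
    ι-fixpoint-free : ∀ h → ι h ≢ h
    edge            : H → E
    edge-surjective : ∀ e → ∃ λ h → edge h ≡ e
    edge-orbit      : ∀ h h′ → edge h ≡ edge h′ ⇔ (h ≡ h′ ⊎ h ≡ ι h′)

  edge-ι : ∀ h → edge (ι h) ≡ edge h
  edge-ι h = Equivalence.from (edge-orbit (ι h) h) (inj₂ refl)

-- #E - #V + 1, which is the genus b₁ when G is connected.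
genus : Graph → ℤ
genus G = + #E ℤ.- + #V ℤ.+ + 1
  where open Graph G

record Subgraph (G : Graph) : Set₁ where
  open Graph G
  field
    V∈     : Pred V 0ℓ
    E∈     : Pred E 0ℓ
    V∈?    : Decidable V∈
    E∈?    : Decidable E∈
    closed : ∀ h → E∈ (edge h) → V∈ (r h)

open Subgraph public

-- A walk through the arrow (a , b) splits at its first and last use of
-- it, so decidability follows by induction on the list of arrows.
module _ {n : ℕ} where

  Along : List (Fin n × Fin n) → Rel (Fin n) 0ℓ
  Along as = Star λ u v → (u , v) ∈ₗ as

  private
    weaken : ∀ {a as u v} → Along as u v → Along (a ∷ as) u v
    weaken = gmap (λ u → u) there

    split : ∀ {a b as u v} → Along ((a , b) ∷ as) u v →
            Along as u v ⊎ (Along as u a × Along as b v)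
    split ε = inj₁ ε
    split (here refl ◅ p) with split p
    ... | inj₁ q       = inj₂ (ε , q)
    ... | inj₂ (_ , q) = inj₂ (ε , q)
    split (there x ◅ p) with split p
    ... | inj₁ q        = inj₁ (x ◅ q)
    ... | inj₂ (q , q′) = inj₂ (x ◅ q , q′)

    join : ∀ {a b as u v} → Along as u v ⊎ (Along as u a × Along as b v) →
           Along ((a , b) ∷ as) u v
    join (inj₁ q)        = weaken q
    join (inj₂ (q , q′)) = weaken q ◅◅ (here refl ◅ weaken q′)

  along? : ∀ as → Decidable₂ (Along as)
  along? []            u v = map′ (λ { refl → ε }) (λ { ε → refl ; (() ◅ _) }) (u ≟ v)
  along? ((a , b) ∷ as) u v =
    map′ join split (along? as u v ⊎-dec (along? as u a ×-dec along? as b v))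

module _ {G : Graph} where
  open Graph G

  Adjacent : Subgraph G → Rel V 0ℓ
  Adjacent S u v = ∃ λ h → E∈ S (edge h) × r h ≡ u × r (ι h) ≡ v

  Linked : Subgraph G → Rel V 0ℓ
  Linked S = Star (Adjacent S)

  linked? : ∀ S → Decidable₂ (Linked S)
  linked? S u v = map′ (gmap (λ w → w) from) (gmap (λ w → w) to) (along? arrows u v)
    where
    hs     = List.filter (λ h → E∈? S (edge h)) (List.allFin #H)
    ends   = λ h → r h , r (ι h)
    arrows = List.map ends hs

    from : ∀ {u v} → (u , v) ∈ₗ arrows → Adjacent S u v
    from m with ∈-map⁻ ends m
    ... | h , h∈ , refl =
      h , proj₂ (∈-filter⁻ (λ h → E∈? S (edge h)) {xs = List.allFin #H} h∈) , refl , refl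

    to : ∀ {u v} → Adjacent S u v → (u , v) ∈ₗ arrows
    to (h , h∈ , refl , refl) =
      ∈-map⁺ ends (∈-filter⁺ (λ h → E∈? S (edge h)) (∈-allFin h) h∈)

  Connected : Subgraph G → Set
  Connected S = ∀ u v → V∈ S u → V∈ S v → Linked S u v

  connected? : ∀ S → Dec (Connected S)
  connected? S =
    all? λ u → all? λ v → V∈? S u →-dec (V∈? S v →-dec linked? S u v)

  -- Deduplication keeps one vertex from each component.
  #components : Subgraph G → ℕ
  #components S =
    List.length (List.deduplicate (linked? S) (List.filter (V∈? S) (List.allFin #V)))

  component : Subgraph G → V → Subgraph G
  component S v = record
    { V∈     = λ u → V∈ S u × Linked S v u
    ; E∈     = λ e → E∈ S e × ∃ λ h → edge h ≡ e × Linked S v (r h)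
    ; V∈?    = λ u → V∈? S u ×-dec linked? S v u
    ; E∈?    = λ e → E∈? S e ×-dec any? λ h → (edge h ≟ e) ×-dec linked? S v (r h)
    ; closed = clo
    }
    where
    clo : ∀ h → E∈ S (edge h) × (∃ λ h′ → edge h′ ≡ edge h × Linked S v (r h′)) →
          V∈ S (r h) × Linked S v (r h)
    clo h (e∈ , h′ , eq , l) with Equivalence.to (edge-orbit h′ h) eq
    ... | inj₁ refl = closed S h e∈ , l
    ... | inj₂ refl = closed S h e∈ ,
      l ◅◅ ((ι h , subst (E∈ S) (sym eq) e∈ , refl , cong r (ι-involutive h)) ◅ ε)

_∖_ : (G : Graph) → Subset (Graph.#E G) → Subgraph G
G ∖ F = record
  { V∈     = U
  ; E∈     = _∉ F
  ; V∈?    = U?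
  ; E∈?    = λ e → ¬? (e ∈? F)
  ; closed = _
  }


whole : (G : Graph) → Subgraph G
whole G = record { V∈ = U ; E∈ = U ; V∈? = U? ; E∈? = U? ; closed = _ }

record MetricGraph {c ℓ₁ ℓ₂} (𝔽 : OrderedField c ℓ₁ ℓ₂) : Set (c ⊔ ℓ₂) where
  open OrderedField 𝔽
  field
    graph : Graph

  open Graph graph public

  field
    len          : E → Carrier
    len-positive : ∀ e → 0# < len e

record DoubleCover {c ℓ₁ ℓ₂} {𝔽 : OrderedField c ℓ₁ ℓ₂} (Γ̃ Γ : MetricGraph 𝔽)
  : Set (c ⊔ ℓ₁) where
  open OrderedField 𝔽
  private
    module T = MetricGraph Γ̃
    module B = MetricGraph Γ
  field
    πV   : T.V → B.V
    πH   : T.H → B.H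
    πH-r : ∀ h̃ → B.r (πH h̃) ≡ πV (T.r h̃)
    πH-ι : ∀ h̃ → πH (T.ι h̃) ≡ B.ι (πH h̃)

  πE : T.E → B.E
  πE ẽ = B.edge (πH (proj₁ (T.edge-surjective ẽ)))

  field
    degV : T.V → ℕ
    degE : T.E → ℕ
    {{degV-nonZero}} : ∀ {ṽ} → NonZero (degV ṽ)
    {{degE-nonZero}} : ∀ {ẽ} → NonZero (degE ẽ)

    harmonic : ∀ ṽ h → B.r h ≡ πV ṽ →
      degV ṽ ≡ ∑ᴺ (λ h̃ → (T.r h̃ ≟ ṽ) ×-dec (πH h̃ ≟ h)) (degE ∘ T.edge)
    degree-V : ∀ v → ∑ᴺ (λ ṽ → πV ṽ ≟ v) degV ≡ 2
    degree-H : ∀ h → ∑ᴺ (λ h̃ → πH h̃ ≟ h) (degE ∘ T.edge) ≡ 2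

    len-πE : ∀ ẽ → B.len (πE ẽ) ≈ degE ẽ · T.len ẽ

  πE-edge : ∀ h̃ → πE (T.edge h̃) ≡ B.edge (πH h̃)
  πE-edge h̃ with T.edge-surjective (T.edge h̃)
  ... | h′ , eq with Equivalence.to (T.edge-orbit h′ h̃) eq
  ...   | inj₁ refl = refl
  ...   | inj₂ refl = trans (cong B.edge (πH-ι h̃)) (B.edge-ι (πH h̃))

private
  ∑ᴺ-witness : ∀ {n} {P : Pred (Fin n) 0ℓ} (P? : Decidable P) {f} →
               ∑ᴺ P? f ≢ 0 → ∃ P
  ∑ᴺ-witness {zero}  P? s≢0 = contradiction refl s≢0
  ∑ᴺ-witness {suc n} P? s≢0 with P? zero
  ... | yes p = zero , p
  ... | no  _ with ∑ᴺ-witness (P? ∘ suc) s≢0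
  ...   | i , p = suc i , p

module _ {c ℓ₁ ℓ₂} {𝔽 : OrderedField c ℓ₁ ℓ₂} {Γ̃ Γ : MetricGraph 𝔽}
         (π : DoubleCover Γ̃ Γ) where
  open DoubleCover π
  private
    module T = MetricGraph Γ̃
    module B = MetricGraph Γ

  DilatedV : Pred B.V 0ℓ
  DilatedV v = ∃! _≡_ λ ṽ → πV ṽ ≡ v

  DilatedE : Pred B.E 0ℓ
  DilatedE e = ∃! _≡_ λ ẽ → πE ẽ ≡ e

  private
    ∃!? : ∀ {m n} (f : Fin m → Fin n) j → Dec (∃! _≡_ λ i → f i ≡ j)
    ∃!? f j = map′ (λ (i , p , u) → i , p , λ {k} → u k) (λ (i , p , u) → i , p , λ k → u {k})
      (any? λ i → (f i ≟ j) ×-dec all? λ k → (f k ≟ j) →-dec (i ≟ k))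

  dilatedV? : Decidable DilatedV
  dilatedV? = ∃!? πV

  dilatedE? : Decidable DilatedE
  dilatedE? = ∃!? πE

  dilationSubgraph : Subgraph B.graph
  dilationSubgraph = record
    { V∈ = DilatedV ; E∈ = DilatedE ; V∈? = dilatedV? ; E∈? = dilatedE? ; closed = clo }
    where
    lift : ∀ ṽ h → B.r h ≡ πV ṽ → ∃ λ h̃ → T.r h̃ ≡ ṽ × πH h̃ ≡ h
    lift ṽ h eq = ∑ᴺ-witness (λ h̃ → (T.r h̃ ≟ ṽ) ×-dec (πH h̃ ≟ h))
      λ s≡0 → ℕ.≢-nonZero⁻¹ (degV ṽ) (trans (harmonic ṽ h eq) s≡0)

    clo : ∀ h → DilatedE (B.edge h) → DilatedV (B.r h)
    clo h (ẽ , _ , only) with ∑ᴺ-witness (λ ṽ → πV ṽ ≟ B.r h) {degV}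
      (λ s≡0 → case trans (sym s≡0) (degree-V (B.r h)) of λ ())
    ... | ṽ , πṽ = ṽ , πṽ , λ {w̃} πw̃ → unique w̃ πw̃
      where
      unique : ∀ w̃ → πV w̃ ≡ B.r h → ṽ ≡ w̃
      unique w̃ πw̃ with lift ṽ h (sym πṽ) | lift w̃ h (sym πw̃)
      ... | h₁ , r₁ , π₁ | h₂ , r₂ , π₂
        with Equivalence.to (T.edge-orbit h₁ h₂)
               (trans (sym (only (trans (πE-edge h₁) (cong B.edge π₁))))
                      (only (trans (πE-edge h₂) (cong B.edge π₂))))
      ... | inj₁ refl = trans (sym r₁) r₂
      ... | inj₂ refl = contradiction
        (trans (cong B.ι (sym π₂)) (trans (sym (πH-ι h₂)) π₁)) (B.ι-fixpoint-free h)

  Dilated : Set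
  Dilated = ∃ (V∈ dilationSubgraph)

  relGenus : ℤ
  relGenus = genus T.graph ℤ.- genus B.graph

  preimage : Subgraph B.graph → Subgraph T.graph
  preimage S = record
    { V∈     = V∈ S ∘ πV
    ; E∈     = E∈ S ∘ πE
    ; V∈?    = V∈? S ∘ πV
    ; E∈?    = E∈? S ∘ πE
    ; closed = λ h̃ e∈ →
        subst (V∈ S) (πH-r h̃) (closed S (πH h̃) (subst (E∈ S) (πE-edge h̃) e∈))
    }

  Ogod : Pred (Subset B.#E) 0ℓ
  Ogod F = + ∣ F ∣ ≡ relGenus
         × (∀ e → e ∈ F → ¬ DilatedE e)
         × (∀ v → Connected (preimage (component (B.graph ∖ F) v)))

  ogod? : Decidable Ogod
  ogod? F = (+ ∣ F ∣ ℤ.≟ relGenus)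
    ×-dec (all? λ e → (e ∈? F) →-dec ¬? (dilatedE? e))
    ×-dec (all? λ v → connected? (preimage (component (B.graph ∖ F) v)))

  rank : Subset B.#E → ℕ
  rank F = #components (B.graph ∖ F)

  ogods : List (Subset B.#E)
  ogods = List.filter ogod? (subsets B.#E)

-- An orientation selects the initial half-edge of every edge.
record Orientation (G : Graph) : Set where
  open Graph G
  field
    out      : E → H
    edge-out : ∀ e → edge (out e) ≡ e

record CompatibleOrientations {c ℓ₁ ℓ₂} {𝔽 : OrderedField c ℓ₁ ℓ₂}
  {Γ̃ Γ : MetricGraph 𝔽} (π : DoubleCover Γ̃ Γ) : Set where
  open DoubleCover π
  field
    upper : Orientation (MetricGraph.graph Γ̃)
    lower : Orientation (MetricGraph.graph Γ)
    compatible : ∀ ẽ → πH (Orientation.out upper ẽ) ≡ Orientation.out lower (πE ẽ)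

Chain : Graph → Set
Chain G = Vector ℤ (Graph.#E G)

∂ : ∀ {G} → Orientation G → Chain G → Vector ℤ (Graph.#V G)
∂ {G} o a v = ∑ᶻ (λ e → r (ι (out e)) ≟ v) a ℤ.- ∑ᶻ (λ e → r (out e) ≟ v) a
  where open Graph G; open Orientation o

H₁ : ∀ {G} → Orientation G → Pred (Chain G) 0ℓ
H₁ o a = ∀ v → ∂ o a v ≡ + 0

combination : ∀ {n k} → Vector ℤ k → Vector (Vector ℤ n) k → Vector ℤ n
combination a b j = RawMonoidDefs.sum ℤ.+-0-rawMonoid λ i → a i ℤ.* b i j

-- b represents a ℤ-basis of the quotient of the lattice L by the
-- congruence _∼_.
record IsBasis {n k} (L : Pred (Vector ℤ n) 0ℓ) (_∼_ : Rel (Vector ℤ n) 0ℓ)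
               (b : Vector (Vector ℤ n) k) : Set where
  field
    members     : ∀ i → L (b i)
    spanning    : ∀ x → L x → ∃ λ a → x ∼ combination a b
    independent : ∀ a → combination a b ∼ (λ _ → + 0) → ∀ i → a i ≡ + 0

module _ {c ℓ₁ ℓ₂} {𝔽 : OrderedField c ℓ₁ ℓ₂} {Γ̃ Γ : MetricGraph 𝔽}
         (π : DoubleCover Γ̃ Γ) where
  open OrderedField 𝔽 using (Carrier; _*_; sum; fromℤ; abs; det)
  open DoubleCover π
  private
    module T = MetricGraph Γ̃
    module B = MetricGraph Γ

  push : Chain T.graph → Chain B.graph
  push a e = ∑ᶻ (λ ẽ → πE ẽ ≟ e) a

  -- π^*(e) is the sum of the preimages of e weighted by their degrees.
  pull : Chain B.graph → Chain T.graph
  pull a ẽ = + degE ẽ ℤ.* a (πE ẽ)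

  module _ (o : CompatibleOrientations π) where
    open CompatibleOrientations o

    K′ : Pred (Chain T.graph) 0ℓ
    K′ a = H₁ upper a × (∀ e → push a e ≡ + 0)

    -- Equality in coker π^* modulo torsion, on representatives in H₁(Γ̃).
    _≈K_ : Rel (Chain T.graph) 0ℓ
    a ≈K b = ∃ λ m → m ≢ + 0 × ∃ λ z →
      H₁ lower z × (∀ ẽ → m ℤ.* (a ẽ ℤ.- b ẽ) ≡ pull z ẽ)

    record BasisK (h : ℕ) : Set where
      field
        basis   : Vector (Chain T.graph) h
        isBasis : IsBasis (H₁ upper) _≈K_ basis

    record BasisK′ (h : ℕ) : Set where
      field
        basis   : Vector (Chain T.graph) h
        isBasis : IsBasis K′ (λ a b → ∀ ẽ → a ẽ ≡ b ẽ) basis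

  pairing : Chain T.graph → Chain T.graph → Carrier
  pairing a b = sum λ ẽ → fromℤ (a ẽ ℤ.* b ẽ) * T.len ẽ

  -- The pairing of K with K′ is evaluated on representatives of the
  -- classes in K.
  Vol² : ∀ {o h} → BasisK o h → BasisK′ o h → Carrier
  Vol² κ μ = abs (det λ i j → pairing (BasisK.basis κ i) (BasisK′.basis μ j))

-- Let σ exchange the lifts of every vertex and edge.  K′ consists of the
-- cycles a with σ a = - a, and 1 - σ embeds K into K′; its image has index
-- 2^(d-1), because a ∈ K′ lies in it exactly if the boundary of half of a has
-- even mass on each of the d dilated components, and these masses add up to
-- an even number.  The pairing is the edge length form of K′ composed with
-- this embedding, so Vol² = 2^(d-1) det G for the Gram matrix G of K′.
--
-- One lift per undilated edge and vertex turns K′ into the kernel of the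
-- incidence matrix B of a signed graph, in which edge ends at dilated
-- vertices are dropped.  B is surjective over ℤ since the cover is connected,
-- whence det G = ∏ ℓ · det (B L⁻¹ Bᵀ).  Deletion and contraction of the
-- edges expand this into a sum over edge sets F: each contracted edge e ∉ F
-- either merges two components of the base, or joins a pair of components of
-- the cover exchanged by σ and contributes a factor 4, or makes the term
-- vanish.  The surviving F are the ogods, with 4^(r(F)-d) as coefficient.

module Submission where

open import Defs
open import Level using (Level; 0ℓ; _⊔_)
open import Algebra.Bundles using (CommutativeMonoid; CommutativeRing; Semiring)
import Algebra.Definitions.RawSemiring
import Algebra.Properties.CommutativeMonoid.Sum
import Algebra.Properties.CommutativeSemigroup
import Algebra.Properties.CommutativeSemiring.Exp
import Algebra.Properties.Ring
import Algebra.Properties.Semiring.Exp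
import Algebra.Properties.Semiring.Mult
import Algebra.Properties.Semiring.Sum
open import Data.Bool.Base using (Bool; true; false; if_then_else_; not)
open import Data.Fin.Base using (Fin; zero; suc; toℕ; punchIn; punchOut; splitAt; _↑ˡ_; _↑ʳ_)
import Data.Fin.Permutation as Permutation
open import Data.Fin.Properties
  using (_≟_; suc-injective; injective⇒≤; punchInᵢ≢i; punchIn-injective; punchIn-punchOut;
         punchOut-punchIn; punchOut-cong; splitAt-↑ˡ; splitAt-↑ʳ; splitAt⁻¹-↑ˡ; splitAt⁻¹-↑ʳ)
open import Data.Fin.Subset using (Subset; inside; outside; _∈_; _∉_; ∣_∣)
open import Data.Fin.Subset.Properties using (_∈?_; drop-there)
open import Data.Integer.Base as ℤ using (ℤ; +_; -[1+_])
import Data.Integer.Properties as ℤ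
import Data.Integer.Tactic.RingSolver as ℤ-Solver
open import Data.List.Base as List using (List)
open import Data.List.Membership.Propositional.Properties
  using (∈-allFin; ∈-filter⁺; ∈-filter⁻; ∈-deduplicate⁻; ∈-lookup)
open import Data.List.Relation.Unary.All as All using ()
open import Data.List.Relation.Unary.AllPairs as AllPairs using (AllPairs)
open import Data.List.Relation.Unary.Any as Any using (Any)
import Data.List.Relation.Unary.Any.Properties as Any
open import Data.List.Relation.Unary.Unique.DecSetoid.Properties using (deduplicate-!)
open import Data.Maybe.Base as Maybe using (Maybe; just; nothing)
open import Data.Nat.Base as ℕ using (ℕ; zero; suc; z≤n; s≤s)
import Data.Nat.Properties as ℕ
open import Data.Product using (∃; ∃₂; _×_; _,_; proj₁; proj₂)
open import Data.Sum.Base using (_⊎_; inj₁; inj₂)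
open import Data.Unit.Base using (⊤; tt)
open import Data.Vec.Base as Vec using ()
open import Data.Vec.Functional using (Vector; _∷_; _++_; insertAt; removeAt)
open import Data.Vec.Functional.Properties
  using (insertAt-lookup; insertAt-punchIn; lookup-++ˡ; lookup-++ʳ)
open import Function.Base using (_∘_; id; case_of_)
open import Function.Bundles using (Equivalence)
open import Relation.Binary.Bundles using (DecSetoid)
open import Relation.Binary.Construct.Closure.ReflexiveTransitive
  using (ε; _◅_; _◅◅_; gmap)
open import Relation.Binary.Core using (Rel)
open import Relation.Binary.Definitions using (tri<; tri≈; tri>)
import Relation.Binary.PropositionalEquality as ≡
open ≡ using (_≡_; _≢_)
import Relation.Binary.Reasoning.Setoid
open import Relation.Binary.Structures using (IsStrictTotalOrder)
open import Relation.Nullary.Decidable.Core using (Dec; yes; no; does; _×-dec_; _⊎-dec_)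
open import Relation.Nullary.Negation.Core using (¬_; contradiction)
open import Relation.Unary as Unary using (Pred; Decidable)
open import Relation.Unary.Properties using (U?)

-- After a contraction the signed graph is no longer the quotient of a cover. What persists is a
-- labelling of the vertices of the cover by 0 and ± unit vectors, odd under σ: every row of the
-- incidence matrix is a difference of two labels and remains one after each contraction. Its pivot
-- entry is ±1 or ±2, whence the factors 1 and 4.
--
-- The exponent counts components. Initially there are n labels, one for each undilated vertex, and
-- d + n components of the base along the dilated edges. A pivot ±1 removes a label and a component,
-- a pivot ±2 only a label. If s of the n pivots are of the second kind, d + s components remain, so
-- r(F) = d + s, and 2^(d-1) 4^(r-d) = 2^(1-d) 4^(r-1).
--
-- Choices of lifts and bases do not matter: the matrices that complete a basis of K′ to a basis of
-- the edge lattice are inverse over ℤ, their determinant ±1 enters squared, and the remaining sign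
-- is settled by the nonnegativity of the sum. That the completion is integral rests on a vertex
-- fixed by σ from which every vertex of the cover is reached; this is where dilatedness enters,
-- besides giving d ≥ 1.

Consecutive : ∀ {n} → Fin n → Fin n → Set
Consecutive i j = toℕ j ≡ suc (toℕ i)

-- Since `punchIn p` is increasing and omits only `p`, two neighbours other than `p` stay neighbours
-- after its removal. The induction in `cdet-alt` runs on this.
removal-adjacent : ∀ {n} p {i j : Fin (suc n)} → Consecutive i j →
  p ≡ i ⊎ p ≡ j ⊎ ∃₂ λ i′ j′ → Consecutive i′ j′ × punchIn p i′ ≡ i × punchIn p j′ ≡ j
removal-adjacent zero    {zero}         adj = inj₁ ≡.refl
removal-adjacent zero    {suc i} {suc j} adj =
  inj₂ (inj₂ (i , j , ℕ.suc-injective adj , ≡.refl , ≡.refl))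
removal-adjacent {suc n} (suc zero)    {zero} {suc zero} adj = inj₂ (inj₁ ≡.refl)
removal-adjacent {suc (suc n)} (suc (suc p)) {zero} {suc zero} adj =
  inj₂ (inj₂ (zero , suc zero , ≡.refl , ≡.refl , ≡.refl))
removal-adjacent {suc n} (suc p) {suc i} {suc j} adj
  with removal-adjacent p {i} {j} (ℕ.suc-injective adj)
... | inj₁ ≡.refl        = inj₁ ≡.refl
... | inj₂ (inj₁ ≡.refl) = inj₂ (inj₁ ≡.refl)
... | inj₂ (inj₂ (i′ , j′ , adj′ , ≡.refl , ≡.refl)) =
  inj₂ (inj₂ (suc i′ , suc j′ , ≡.cong suc adj′ , ≡.refl , ≡.refl))

punchIn-↑ˡ : ∀ {m} n (i : Fin (suc m)) j → punchIn (i ↑ˡ n) (j ↑ˡ n) ≡ punchIn i j ↑ˡ n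
punchIn-↑ˡ n zero    j       = ≡.refl
punchIn-↑ˡ n (suc i) zero    = ≡.refl
punchIn-↑ˡ n (suc i) (suc j) = ≡.cong suc (punchIn-↑ˡ n i j)

punchIn-↑ʳ : ∀ m {n} (i : Fin (suc m)) (j : Fin n) →
             punchIn (i ↑ˡ n) (m ↑ʳ j) ≡ suc m ↑ʳ j
punchIn-↑ʳ m       zero    j = ≡.refl
punchIn-↑ʳ (suc m) (suc i) j = ≡.cong suc (punchIn-↑ʳ m i j)

-- Determinants

module FiniteSums {c ℓ} (M : CommutativeMonoid c ℓ) where
  open CommutativeMonoid M
    renaming (_∙_ to _+_; ε to 0#; ∙-cong to +-cong; ∙-congˡ to +-congˡ; ∙-congʳ to +-congʳ;
              identityˡ to +-identityˡ; identityʳ to +-identityʳ; assoc to +-assoc)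
  open Algebra.Properties.CommutativeMonoid.Sum M
  open Relation.Binary.Reasoning.Setoid setoid

  sum-zero : ∀ {n} {f : Vector Carrier n} → (∀ i → f i ≈ 0#) → sum f ≈ 0#
  sum-zero {n} f≈0 = trans (sum-cong-≋ f≈0) (sum-replicate-zero n)

  sum-only : ∀ {n} (i : Fin n) {f : Vector Carrier n} → (∀ j → j ≢ i → f j ≈ 0#) → sum f ≈ f i
  sum-only {suc n} i {f} rest = begin
    sum f                      ≈⟨ sum-remove {i = i} f ⟩
    f i + sum (removeAt f i)   ≈⟨ +-congˡ (sum-zero λ j → rest (punchIn i j) (punchInᵢ≢i i j)) ⟩
    f i + 0#                   ≈⟨ +-identityʳ _ ⟩
    f i                        ∎

  sum-pair : ∀ {n} {i j : Fin n} → i ≢ j → {f : Vector Carrier n} →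
             (∀ k → k ≡ i ⊎ k ≡ j ⊎ f k ≈ 0#) → sum f ≈ f i + f j
  sum-pair {suc n} {i} {j} i≢j {f} rest = begin
    sum f                    ≈⟨ sum-remove {i = i} f ⟩
    f i + sum (removeAt f i) ≈⟨ +-congˡ (sum-only j′ others) ⟩
    f i + f (punchIn i j′)   ≡⟨ ≡.cong (λ k → f i + f k) (punchIn-punchOut i≢j) ⟩
    f i + f j                ∎
    where
    j′ = punchOut i≢j
    others : ∀ k → k ≢ j′ → f (punchIn i k) ≈ 0#
    others k k≢ with rest (punchIn i k)
    ... | inj₁ eq        = contradiction eq (punchInᵢ≢i i k)
    ... | inj₂ (inj₁ eq) = contradiction
      (punchIn-injective i k j′ (≡.trans eq (≡.sym (punchIn-punchOut i≢j)))) k≢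
    ... | inj₂ (inj₂ z)  = z

module Determinant {c ℓ} (R : CommutativeRing c ℓ) where
  open CommutativeRing R hiding (zero)
  open Algebra.Definitions.RawSemiring (Semiring.rawSemiring semiring) using (_^_)
  open Algebra.Properties.Ring ring using (-‿distribˡ-*; -‿distribʳ-*; -1*x≈-x; +-inverseʳ-unique; -‿involutive)
  open Algebra.Properties.CommutativeSemigroup *-commutativeSemigroup
    using (x∙yz≈y∙xz)
  open Algebra.Properties.Semiring.Sum semiring
  open FiniteSums +-commutativeMonoid public
  open Relation.Binary.Reasoning.Setoid setoid

  Matrix : ℕ → ℕ → Set c
  Matrix m n = Vector (Vector Carrier n) m

  infix 4 _≋_
  _≋_ : ∀ {m n} → Matrix m n → Matrix m n → Set ℓ
  M ≋ N = ∀ i j → M i j ≈ N i j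

  sign : ∀ {n} → Fin n → Carrier
  sign i = (- 1#) ^ toℕ i

  δ : ∀ {n} → Fin n → Fin n → Carrier
  δ i j = if does (i ≟ j) then 1# else 0#

  sign² : ∀ {n} (i : Fin n) → sign i * sign i ≈ 1#
  sign² zero    = *-identityˡ _
  sign² (suc i) = begin
    (- 1# * sign i) * (- 1# * sign i) ≈⟨ *-cong (-1*x≈-x _) (-1*x≈-x _) ⟩
    - sign i * - sign i               ≈⟨ -‿distribˡ-* _ _ ⟨
    - (sign i * - sign i)             ≈⟨ -‿cong (-‿distribʳ-* _ _) ⟨
    - - (sign i * sign i)             ≈⟨ -‿involutive _ ⟩
    sign i * sign i                   ≈⟨ sign² i ⟩
    1#                                ∎

  minor : ∀ {m n} → Fin (suc m) → Fin (suc n) → Matrix (suc m) (suc n) → Matrix m n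
  minor i j M k l = M (punchIn i k) (punchIn j l)

  -- In `det` the first row plays a special part. In `cdet` all rows enter alike, so linearity and
  -- alternation in the rows follow by induction on the minors; the two are identified afterwards by
  -- `cdet≈det`.
  det cdet : ∀ {n} → Matrix n n → Carrier
  det {zero}  M = 1#
  det {suc n} M = sum λ j → sign j * (M zero j * det (minor zero j M))
  cdet {zero}  M = 1#
  cdet {suc n} M = sum λ i → sign i * (M i zero * cdet (minor i zero M))

  δ-refl : ∀ {n} (i : Fin n) → δ i i ≡ 1#
  δ-refl i with i ≟ i
  ... | yes _  = ≡.refl
  ... | no i≢i = contradiction ≡.refl i≢i

  δ-≢ : ∀ {n} {i j : Fin n} → i ≢ j → δ i j ≡ 0#
  δ-≢ {i = i} {j} i≢j with i ≟ j
  ... | yes i≡j = contradiction i≡j i≢j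
  ... | no _    = ≡.refl

  δ-sym : ∀ {n} (i j : Fin n) → δ i j ≡ δ j i
  δ-sym i j with i ≟ j
  ... | yes ≡.refl = ≡.sym (δ-refl i)
  ... | no i≢j     = ≡.sym (δ-≢ (i≢j ∘ ≡.sym))

  δ-injective : ∀ {m n} (f : Fin m → Fin n) → (∀ {i j} → f i ≡ f j → i ≡ j) →
                ∀ i j → δ (f i) (f j) ≡ δ i j
  δ-injective f inj i j with i ≟ j
  ... | yes ≡.refl = δ-refl (f i)
  ... | no i≢j     = δ-≢ (i≢j ∘ inj)

  sum-δˡ : ∀ {n} (i : Fin n) (f : Vector Carrier n) → sum (λ j → δ i j * f j) ≈ f i
  sum-δˡ i f = begin
    sum (λ j → δ i j * f j) ≈⟨ sum-only i (λ j j≢i → trans (*-congʳ (reflexive (δ-≢ (j≢i ∘ ≡.sym)))) (zeroˡ _)) ⟩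
    δ i i * f i             ≡⟨ ≡.cong (_* f i) (δ-refl i) ⟩
    1# * f i                ≈⟨ *-identityˡ _ ⟩
    f i                     ∎

  sum-δʳ : ∀ {n} (i : Fin n) (f : Vector Carrier n) → sum (λ j → f j * δ j i) ≈ f i
  sum-δʳ i f = begin
    sum (λ j → f j * δ j i) ≈⟨ sum-only i (λ j j≢i → trans (*-congˡ (reflexive (δ-≢ j≢i))) (zeroʳ _)) ⟩
    f i * δ i i             ≡⟨ ≡.cong (f i *_) (δ-refl i) ⟩
    f i * 1#                ≈⟨ *-identityʳ _ ⟩
    f i                     ∎

  -- The number `w` of columns is independent of the number of rows, so that freezing a row and
  -- padding a column stay within the notion. Alternation is asked of consecutive rows only; `swap`
  -- and `move` reach the others.
  record Alternating {n w} (D : Matrix n w → Carrier) : Set (c ⊔ ℓ) where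
    field
      cong   : ∀ {M N} → M ≋ N → D M ≈ D N
      linear : ∀ i a b {P M N} →
               (∀ k → k ≢ i → ∀ j → P k j ≈ M k j) →
               (∀ k → k ≢ i → ∀ j → P k j ≈ N k j) →
               (∀ j → P i j ≈ a * M i j + b * N i j) →
               D P ≈ a * D M + b * D N
      alt    : ∀ i j → Consecutive i j → ∀ {M} → (∀ k → M i k ≈ M j k) → D M ≈ 0#

  open Alternating

  cdet-cong : ∀ {n} {M N : Matrix n n} → M ≋ N → cdet M ≈ cdet N
  cdet-cong {zero}  M≋N = refl
  cdet-cong {suc n} M≋N = sum-cong-≋ λ i →
    *-congˡ {x = sign i} (*-cong (M≋N i zero) (cdet-cong λ k l → M≋N (punchIn i k) (suc l)))

  det-cong : ∀ {n} {M N : Matrix n n} → M ≋ N → det M ≈ det N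
  det-cong {zero}  M≋N = refl
  det-cong {suc n} M≋N = sum-cong-≋ λ j →
    *-congˡ {x = sign j} (*-cong (M≋N zero j) (det-cong λ k l → M≋N (suc k) (punchIn j l)))

  private
    combine : ∀ s a b x y u v → s * (a * (x * u) + b * (y * v)) ≈ a * (s * (x * u)) + b * (s * (y * v))
    combine s a b x y u v = trans (distribˡ s _ _) (+-cong (x∙yz≈y∙xz s a _) (x∙yz≈y∙xz s b _))

  cdet-linear : ∀ {n} i a b {P M N : Matrix n n} →
                (∀ k → k ≢ i → ∀ j → P k j ≈ M k j) →
                (∀ k → k ≢ i → ∀ j → P k j ≈ N k j) →
                (∀ j → P i j ≈ a * M i j + b * N i j) →
                cdet P ≈ a * cdet M + b * cdet N
  cdet-linear {suc n} i a b {P} {M} {N} P≈M P≈N Pᵢ = begin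
    sum (λ k → term P k)                         ≈⟨ sum-cong-≋ step ⟩
    sum (λ k → a * term M k + b * term N k) ≈⟨ ∑-distrib-+ (λ k → a * term M k) (λ k → b * term N k) ⟩
    sum (λ k → a * term M k) + sum (λ k → b * term N k)
      ≈⟨ +-cong (*-distribˡ-sum a (term M)) (*-distribˡ-sum b (term N)) ⟨
    a * cdet M + b * cdet N                      ∎
    where
    term : Matrix (suc n) (suc n) → Vector Carrier (suc n)
    term X k = sign k * (X k zero * cdet (minor k zero X))
    step : ∀ k → term P k ≈ a * term M k + b * term N k
    step k with k ≟ i
    ... | yes ≡.refl = begin
      sign i * (P i zero * cdet (minor i zero P))
        ≈⟨ *-congˡ (*-congʳ (Pᵢ zero)) ⟩
      sign i * ((a * M i zero + b * N i zero) * cdet (minor i zero P))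
        ≈⟨ *-congˡ (trans (distribʳ _ _ _) (+-cong (*-assoc _ _ _) (*-assoc _ _ _))) ⟩
      sign i * (a * (M i zero * cdet (minor i zero P)) + b * (N i zero * cdet (minor i zero P)))
        ≈⟨ *-congˡ (+-cong
             (*-congˡ (*-congˡ (cdet-cong λ k l → P≈M (punchIn i k) (punchInᵢ≢i i k) (suc l))))
             (*-congˡ (*-congˡ (cdet-cong λ k l → P≈N (punchIn i k) (punchInᵢ≢i i k) (suc l))))) ⟩
      sign i * (a * (M i zero * cdet (minor i zero M)) + b * (N i zero * cdet (minor i zero N)))
        ≈⟨ combine _ _ _ _ _ _ _ ⟩
      a * term M i + b * term N i ∎
    ... | no k≢i = begin
      sign k * (P k zero * cdet (minor k zero P))
        ≈⟨ *-congˡ (*-congˡ (cdet-linear i′ a b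
             (λ l l≢ j → P≈M (punchIn k l) (off l l≢) (suc j))
             (λ l l≢ j → P≈N (punchIn k l) (off l l≢) (suc j))
             (λ j → ≡.subst (λ r → P r (suc j) ≈ a * M r (suc j) + b * N r (suc j)) (≡.sym eq) (Pᵢ (suc j))))) ⟩
      sign k * (P k zero * (a * cdet (minor k zero M) + b * cdet (minor k zero N)))
        ≈⟨ *-congˡ (trans (distribˡ _ _ _) (+-cong (x∙yz≈y∙xz _ _ _) (x∙yz≈y∙xz _ _ _))) ⟩
      sign k * (a * (P k zero * cdet (minor k zero M)) + b * (P k zero * cdet (minor k zero N)))
        ≈⟨ *-congˡ (+-cong (*-congˡ (*-congʳ (P≈M k k≢i zero))) (*-congˡ (*-congʳ (P≈N k k≢i zero)))) ⟩
      sign k * (a * (M k zero * cdet (minor k zero M)) + b * (N k zero * cdet (minor k zero N)))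
        ≈⟨ combine _ _ _ _ _ _ _ ⟩
      a * term M k + b * term N k ∎
      where
      i′ = punchOut k≢i
      eq : punchIn k i′ ≡ i
      eq = punchIn-punchOut k≢i
      off : ∀ l → l ≢ i′ → punchIn k l ≢ i
      off l l≢ p = l≢ (punchIn-injective k l i′ (≡.trans p (≡.sym eq)))

  -- Away from rows i and j the minors still have two equal adjacent rows;
  -- the two remaining minors coincide and carry opposite signs.
  cdet-alt : ∀ {n} i j → Consecutive i j → ∀ {M : Matrix n n} →
             (∀ k → M i k ≈ M j k) → cdet M ≈ 0#
  cdet-alt {suc n} i j adj {M} Mᵢ≈Mⱼ = begin
    sum term                    ≈⟨ sum-pair i≢j vanish ⟩
    term i + term j ≈⟨ +-congˡ (*-cong sign-j (*-cong (sym (Mᵢ≈Mⱼ zero)) (cdet-cong (minors adj)))) ⟩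
    term i + - sign i * (M i zero * cdet (minor i zero M)) ≈⟨ +-congˡ (-‿distribˡ-* _ _) ⟨
    term i + - term i           ≈⟨ -‿inverseʳ _ ⟩
    0#                          ∎
    where
    i≢j : i ≢ j
    i≢j ≡.refl = ℕ.1+n≢n (≡.sym adj)
    term : Vector Carrier (suc n)
    term k = sign k * (M k zero * cdet (minor k zero M))
    sign-j : sign j ≈ - sign i
    sign-j = trans (reflexive (≡.cong ((- 1#) ^_) adj)) (-1*x≈-x _)
    vanish : ∀ k → k ≡ i ⊎ k ≡ j ⊎ term k ≈ 0#
    vanish k with removal-adjacent k {i} {j} adj
    ... | inj₁ eq        = inj₁ eq
    ... | inj₂ (inj₁ eq) = inj₂ (inj₁ eq)
    ... | inj₂ (inj₂ (i′ , j′ , adj′ , pi , pj)) = inj₂ (inj₂ (trans (*-congˡ (trans (*-congˡ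
      (cdet-alt i′ j′ adj′ λ l → trans (reflexive (≡.cong (λ r → M r (suc l)) pi))
        (trans (Mᵢ≈Mⱼ (suc l)) (reflexive (≡.cong (λ r → M r (suc l)) (≡.sym pj)))))) (zeroʳ _))) (zeroʳ _)))
    -- Omitting `i` and omitting its successor `j` number the remaining rows alike, except for one
    -- place, which is taken by `j` in the first case and by `i` in the second.
    cases : ∀ {n} {i j : Fin (suc n)} → Consecutive i j → ∀ k →
            punchIn j k ≡ punchIn i k ⊎ punchIn j k ≡ i × punchIn i k ≡ j
    cases {i = zero}  {suc zero} adj zero    = inj₂ (≡.refl , ≡.refl)
    cases {i = zero}  {suc zero} adj (suc k) = inj₁ ≡.refl
    cases {i = suc i} {suc j}    adj zero    = inj₁ ≡.refl
    cases {suc n} {i = suc i} {suc j} adj (suc k) with cases {i = i} {j} (ℕ.suc-injective adj) k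
    ... | inj₁ eq      = inj₁ (≡.cong suc eq)
    ... | inj₂ (p , q) = inj₂ (≡.cong suc p , ≡.cong suc q)
    minors : Consecutive i j → minor j zero M ≋ minor i zero M
    minors adj k l with cases {i = i} {j} adj k
    ... | inj₁ eq      = reflexive (≡.cong (λ r → M r (suc l)) eq)
    ... | inj₂ (p , q) = trans (reflexive (≡.cong (λ r → M r (suc l)) p))
      (trans (Mᵢ≈Mⱼ (suc l)) (reflexive (≡.cong (λ r → M r (suc l)) (≡.sym q))))

  cdet-alternating : ∀ {n} → Alternating {n} {n} cdet
  cdet-alternating = record { cong = cdet-cong ; linear = cdet-linear ; alt = cdet-alt }

  fix-head : ∀ {n w} {D : Matrix (suc n) w → Carrier} → Alternating D →
             ∀ x → Alternating λ T → D (x ∷ T)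
  fix-head AD x = record
    { cong   = λ M≋N → cong AD λ { zero j → refl ; (suc i) j → M≋N i j }
    ; linear = λ i a b P≈M P≈N Pᵢ → linear AD (suc i) a b
        (λ { zero _ j → refl ; (suc k) k≢ j → P≈M k (k≢ ∘ ≡.cong suc) j })
        (λ { zero _ j → refl ; (suc k) k≢ j → P≈N k (k≢ ∘ ≡.cong suc) j })
        Pᵢ
    ; alt    = λ i j adj eq → alt AD (suc i) (suc j) (≡.cong suc adj) eq
    }

  record Linear {v w} (φ : Vector Carrier v → Vector Carrier w) : Set (c ⊔ ℓ) where
    field
      φ-cong   : ∀ {x y} → (∀ j → x j ≈ y j) → ∀ j → φ x j ≈ φ y j
      φ-linear : ∀ a b {p x y} → (∀ j → p j ≈ a * x j + b * y j) →
                 ∀ j → φ p j ≈ a * φ x j + b * φ y j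

  open Linear

  pull-back : ∀ {n v w} {D : Matrix n w → Carrier} {φ : Vector Carrier v → Vector Carrier w} →
              Linear φ → Alternating D → Alternating λ M → D (φ ∘ M)
  pull-back lin AD = record
    { cong   = λ M≋N → cong AD λ i → φ-cong lin (M≋N i)
    ; linear = λ i a b P≈M P≈N Pᵢ → linear AD i a b
        (λ k k≢i → φ-cong lin (P≈M k k≢i)) (λ k k≢i → φ-cong lin (P≈N k k≢i)) (φ-linear lin a b Pᵢ)
    ; alt    = λ i j adj eq → alt AD i j adj (φ-cong lin eq)
    }

  head-linear : ∀ {n w} {D : Matrix (suc n) w → Carrier} → Alternating D → ∀ a b {p x y T} →
                (∀ j → p j ≈ a * x j + b * y j) → D (p ∷ T) ≈ a * D (x ∷ T) + b * D (y ∷ T)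
  head-linear AD a b = linear AD zero a b
    (λ { zero z → contradiction ≡.refl z ; (suc _) _ _ → refl })
    (λ { zero z → contradiction ≡.refl z ; (suc _) _ _ → refl })

  head-+ : ∀ {n w} {D : Matrix (suc n) w → Carrier} → Alternating D → ∀ {p x y T} →
           (∀ j → p j ≈ x j + y j) → D (p ∷ T) ≈ D (x ∷ T) + D (y ∷ T)
  head-+ AD eq = trans
    (head-linear AD 1# 1# (λ j → trans (eq j) (+-cong (sym (*-identityˡ _)) (sym (*-identityˡ _)))))
    (+-cong (*-identityˡ _) (*-identityˡ _))

  head-sum : ∀ {n w k} {D : Matrix (suc n) w → Carrier} → Alternating D →
             (a : Vector Carrier k) (r : Matrix k w) {p : Vector Carrier w} {T : Matrix n w} →
             (∀ j → p j ≈ sum (λ i → a i * r i j)) →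
             D (p ∷ T) ≈ sum (λ i → a i * D (r i ∷ T))
  head-sum {k = zero} {D} AD a r {p} {T} eq = begin
    -- The empty sum is the zero row, which two-term linearity sees as 0 p + 0 p.
    D (p ∷ T)                           ≈⟨ head-linear AD 0# 0# {x = p} {p} (λ j → trans (eq j)
                                             (sym (trans (+-cong (zeroˡ _) (zeroˡ _)) (+-identityˡ _)))) ⟩
    0# * D (p ∷ T) + 0# * D (p ∷ T)     ≈⟨ trans (+-cong (zeroˡ _) (zeroˡ _)) (+-identityˡ _) ⟩
    0#                                  ∎
  head-sum {k = suc k} {D} AD a r {p} {T} eq = begin
    D (p ∷ T) ≈⟨ head-linear AD (a zero) 1# (λ j → trans (eq j) (+-congˡ (sym (*-identityˡ _)))) ⟩
    a zero * D (r zero ∷ T) + 1# * D ((λ j → sum (λ i → a (suc i) * r (suc i) j)) ∷ T) ≈⟨ +-congˡ (*-identityˡ _) ⟩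
    a zero * D (r zero ∷ T) + D ((λ j → sum (λ i → a (suc i) * r (suc i) j)) ∷ T)
      ≈⟨ +-congˡ (head-sum AD (a ∘ suc) (r ∘ suc) (λ j → refl)) ⟩
    sum (λ i → a i * D (r i ∷ T))                          ∎

  head-alt : ∀ {n w} {D : Matrix (suc (suc n)) w → Carrier} → Alternating D → ∀ x T → D (x ∷ x ∷ T) ≈ 0#
  head-alt AD x T = alt AD zero (suc zero) ≡.refl λ k → refl

  swap : ∀ {n w} {D : Matrix (suc (suc n)) w → Carrier} → Alternating D → ∀ x y T →
         D (x ∷ y ∷ T) ≈ - D (y ∷ x ∷ T)
  swap {D = D} AD x y T = +-inverseʳ-unique _ _ (sym (begin
    0#                                ≈⟨ head-alt AD s T ⟨
    D (s ∷ s ∷ T)                     ≈⟨ head-+ AD {x = x} {y} (λ j → refl) ⟩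
    D (x ∷ s ∷ T) + D (y ∷ s ∷ T)
      ≈⟨ +-cong (head-+ (fix-head AD x) {x = x} {y} (λ j → refl)) (head-+ (fix-head AD y) {x = x} {y} (λ j → refl)) ⟩
    (D (x ∷ x ∷ T) + D (x ∷ y ∷ T)) + (D (y ∷ x ∷ T) + D (y ∷ y ∷ T))
      ≈⟨ +-cong (trans (+-congʳ (head-alt AD x T)) (+-identityˡ _)) (trans (+-congˡ (head-alt AD y T)) (+-identityʳ _)) ⟩
    D (x ∷ y ∷ T) + D (y ∷ x ∷ T)     ≈⟨ +-comm _ _ ⟩
    D (y ∷ x ∷ T) + D (x ∷ y ∷ T)     ∎))
    where s = λ j → x j + y j

  move : ∀ {n w} {D : Matrix (suc n) w → Carrier} → Alternating D → ∀ i x T →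
         D (insertAt T i x) ≈ sign i * D (x ∷ T)
  move {n} {D = D} AD zero x T = trans
    (cong AD λ { zero j → refl ; (suc i) j → refl }) (sym (*-identityˡ _))
  move {suc n} {D = D} AD (suc i) x T = begin
    D (insertAt T (suc i) x) ≈⟨ cong AD (λ { zero j → refl ; (suc i) j → refl }) ⟩
    D (T zero ∷ insertAt (T ∘ suc) i x)          ≈⟨ move (fix-head AD (T zero)) i x (T ∘ suc) ⟩
    sign i * D (T zero ∷ x ∷ T ∘ suc)            ≈⟨ *-congˡ (swap AD _ _ _) ⟩
    sign i * - D (x ∷ T zero ∷ T ∘ suc)          ≈⟨ -‿distribʳ-* _ _ ⟨
    - (sign i * D (x ∷ T zero ∷ T ∘ suc))        ≈⟨ -‿distribˡ-* _ _ ⟩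
    - sign i * D (x ∷ T zero ∷ T ∘ suc) ≈⟨ *-cong (sym (-1*x≈-x _)) (cong AD λ { zero j → refl ; (suc zero) j → refl ; (suc (suc k)) j → refl }) ⟩
    sign (suc i) * D (x ∷ T)                     ∎

  ≋-insertAt-removeAt : ∀ {n w} (T : Matrix (suc n) w) i x → (∀ j → T i j ≈ x j) →
                       T ≋ insertAt (removeAt T i) i x
  ≋-insertAt-removeAt T i x eq k j with i ≟ k
  ... | yes ≡.refl = trans (eq j) (reflexive (≡.cong (λ r → r j) (≡.sym (insertAt-lookup (removeAt T i) i x))))
  ... | no i≢k = reflexive (≡.trans (≡.cong (λ r → T r j) (≡.sym p))
      (≡.trans (≡.cong (λ r → r j) (≡.sym (insertAt-punchIn (removeAt T i) i x (punchOut i≢k))))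
               (≡.cong (λ r → insertAt (removeAt T i) i x r j) p)))
    where p = punchIn-punchOut i≢k

  alt-head : ∀ {n w} {D : Matrix (suc n) w → Carrier} → Alternating D → ∀ x T i →
             (∀ j → T i j ≈ x j) → D (x ∷ T) ≈ 0#
  alt-head {suc n} {D = D} AD x T i eq = begin
    D (x ∷ T) ≈⟨ cong (fix-head AD x) (≋-insertAt-removeAt T i x eq) ⟩
    D (x ∷ insertAt (removeAt T i) i x)      ≈⟨ move (fix-head AD x) i x (removeAt T i) ⟩
    sign i * D (x ∷ x ∷ removeAt T i)        ≈⟨ *-congˡ (head-alt AD x _) ⟩
    sign i * 0#                              ≈⟨ zeroʳ _ ⟩
    0#                                       ∎

  -- Row by row: by linearity the added multiple of `x` contributes a matrix with a row `x`, on
  -- which `D` vanishes. That vanishing is asked of every position, so it survives when the rows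
  -- already treated are frozen.
  absorb : ∀ {n w} {D : Matrix n w → Carrier} → Alternating D → (x : Vector Carrier w) →
           (∀ T i → (∀ j → T i j ≈ x j) → D T ≈ 0#) →
           (a : Vector Carrier n) {M N : Matrix n w} →
           (∀ i j → M i j ≈ N i j + a i * x j) → D M ≈ D N
  absorb {zero}  AD x vanish a eq = cong AD λ ()
  absorb {suc n} {D = D} AD x vanish a {M} {N} eq = begin
    D M                                       ≈⟨ cong AD (λ { zero j → refl ; (suc i) j → refl }) ⟩
    D (M zero ∷ M ∘ suc) ≈⟨ head-linear AD 1# (a zero) (λ j → trans (eq zero j) (+-congʳ (sym (*-identityˡ _)))) ⟩
    1# * D (N zero ∷ M ∘ suc) + a zero * D (x ∷ M ∘ suc)
      ≈⟨ +-cong (*-identityˡ _) (trans (*-congˡ (vanish _ zero λ j → refl)) (zeroʳ _)) ⟩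
    D (N zero ∷ M ∘ suc) + 0#                 ≈⟨ +-identityʳ _ ⟩
    D (N zero ∷ M ∘ suc) ≈⟨ absorb (fix-head AD (N zero)) x (λ T i e → vanish (N zero ∷ T) (suc i) e)
                                                   (a ∘ suc) (λ i → eq (suc i)) ⟩
    D (N zero ∷ N ∘ suc)                      ≈⟨ cong AD (λ { zero j → refl ; (suc i) j → refl }) ⟩
    D N                                       ∎

  insert-zero : ∀ {w} → Fin (suc w) → Vector Carrier w → Vector Carrier (suc w)
  insert-zero j x = insertAt x j 0#

  insertAt-elim : ∀ {n} {p} (P : Fin (suc n) → Set p) j → P j → (∀ k → P (punchIn j k)) → ∀ k → P k
  insertAt-elim P j pj pk k with j ≟ k
  ... | yes ≡.refl = pj
  ... | no j≢k     = ≡.subst P (punchIn-punchOut j≢k) (pk (punchOut j≢k))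

  insert-zero-linear : ∀ {w} (j : Fin (suc w)) → Linear (insert-zero j)
  insert-zero-linear j = record
    { φ-cong   = λ {x} {y} eq → insertAt-elim _ j
        (reflexive (≡.trans (insertAt-lookup x j 0#) (≡.sym (insertAt-lookup y j 0#))))
        λ k → trans (reflexive (insertAt-punchIn x j 0# k)) (trans (eq k) (reflexive (≡.sym (insertAt-punchIn y j 0# k))))
    ; φ-linear = λ a b {p} {x} {y} eq → insertAt-elim _ j
        (begin
          insertAt p j 0# j                               ≡⟨ insertAt-lookup p j 0# ⟩
          0# ≈⟨ trans (+-cong (zeroʳ a) (zeroʳ b)) (+-identityʳ 0#) ⟨
          a * 0# + b * 0# ≡⟨ ≡.cong₂ (λ u v → a * u + b * v) (insertAt-lookup x j 0#) (insertAt-lookup y j 0#) ⟨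
          a * insertAt x j 0# j + b * insertAt y j 0# j   ∎)
        λ k → begin
          insertAt p j 0# (punchIn j k)    ≡⟨ insertAt-punchIn p j 0# k ⟩
          p k                              ≈⟨ eq k ⟩
          a * x k + b * y k ≡⟨ ≡.cong₂ (λ u v → a * u + b * v) (insertAt-punchIn x j 0# k) (insertAt-punchIn y j 0# k) ⟨
          a * insertAt x j 0# (punchIn j k) + b * insertAt y j 0# (punchIn j k) ∎
    }

  -- Expanding the first row in the standard basis and clearing the column of
  -- its unit entry turns the value of any alternating form into the Laplace
  -- expansion along the first row.
  alternating-unique : ∀ {n} {D : Matrix n n → Carrier} → Alternating D → ∀ M → D M ≈ det M * D δ
  alternating-unique {zero}  AD M = trans (cong AD λ ()) (sym (*-identityˡ _))
  alternating-unique {suc n} {D} AD M = begin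
    D M ≈⟨ cong AD (λ { zero j → refl ; (suc i) j → refl }) ⟩
    D (M zero ∷ M ∘ suc) ≈⟨ head-sum AD (M zero) δ (λ j → sym (sum-δʳ j (M zero))) ⟩
    sum (λ j → M zero j * D (δ j ∷ M ∘ suc)) ≈⟨ sum-cong-≋ (λ j → *-congˡ {x = M zero j} (entry j)) ⟩
    sum (λ j → M zero j * (det (minor zero j M) * (sign j * D δ)))
      ≈⟨ sum-cong-≋ (λ j → rearrange (M zero j) (det (minor zero j M)) (sign j) (D δ)) ⟩
    sum (λ j → (sign j * (M zero j * det (minor zero j M))) * D δ)
      ≈⟨ *-distribʳ-sum (D δ) (λ j → sign j * (M zero j * det (minor zero j M))) ⟨
    det M * D δ                                    ∎
    where
    rearrange : ∀ x d s e → x * (d * (s * e)) ≈ (s * (x * d)) * e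
    rearrange x d s e = trans (sym (*-assoc x d _)) (trans (sym (*-assoc _ s e)) (*-congʳ (*-comm _ s)))
    -- With the unit row `δ j` in front and column `j` cleared, `D` becomes an alternating form on
    -- matrices of size `n`, to which the induction hypothesis applies.
    cleared : ∀ j → Matrix n n → Carrier
    cleared j N = D (δ j ∷ insert-zero j ∘ N)
    -- Moving the front row `δ j` back to place `j` costs `sign j`; `sign²` carries that sign to the
    -- other side.
    cleared-δ : ∀ j → cleared j δ ≈ sign j * D δ
    cleared-δ j = begin
      cleared j δ                              ≈⟨ cong (fix-head AD (δ j)) (λ k → insertAt-elim _ j
         (trans (reflexive (insertAt-lookup (δ k) j 0#)) (reflexive (≡.sym (δ-≢ (punchInᵢ≢i j k)))))
         (λ l → trans (reflexive (insertAt-punchIn (δ k) j 0# l))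
                  (reflexive (≡.sym (δ-injective (punchIn j) (punchIn-injective j _ _) k l))))) ⟩
      D (δ j ∷ δ ∘ punchIn j)                  ≈⟨ *-identityˡ _ ⟨
      1# * D (δ j ∷ δ ∘ punchIn j)             ≈⟨ *-congʳ (sign² j) ⟨
      (sign j * sign j) * D (δ j ∷ δ ∘ punchIn j) ≈⟨ *-assoc _ _ _ ⟩
      sign j * (sign j * D (δ j ∷ δ ∘ punchIn j)) ≈⟨ *-congˡ (move AD j (δ j) (δ ∘ punchIn j)) ⟨
      sign j * D (insertAt (δ ∘ punchIn j) j (δ j)) ≈⟨ *-congˡ (cong AD (≋-insertAt-removeAt δ j (δ j) (λ k → refl))) ⟨
      sign j * D δ                             ∎
    entry : ∀ j → D (δ j ∷ M ∘ suc) ≈ det (minor zero j M) * (sign j * D δ)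
    entry j = begin
      D (δ j ∷ M ∘ suc) ≈⟨ absorb (fix-head AD (δ j)) (δ j) (alt-head AD (δ j)) (λ i → M (suc i) j)
        (λ i → insertAt-elim _ j
          (begin
            M (suc i) j                                             ≈⟨ *-identityʳ _ ⟨
            M (suc i) j * 1#                                        ≈⟨ +-identityˡ _ ⟨
            0# + M (suc i) j * 1# ≡⟨ ≡.cong₂ (λ u v → u + M (suc i) j * v)
                (insertAt-lookup (minor zero j M i) j 0#) (δ-refl j) ⟨
            insertAt (minor zero j M i) j 0# j + M (suc i) j * δ j j ∎)
          λ l → begin
            M (suc i) (punchIn j l)                ≈⟨ +-identityʳ _ ⟨
            M (suc i) (punchIn j l) + 0#           ≈⟨ +-congˡ (zeroʳ _) ⟨
            M (suc i) (punchIn j l) + M (suc i) j * 0#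
              ≡⟨ ≡.cong₂ (λ u v → u + M (suc i) j * v)
                   (insertAt-punchIn (minor zero j M i) j 0# l) (δ-≢ (punchInᵢ≢i j l ∘ ≡.sym)) ⟨
            insertAt (minor zero j M i) j 0# (punchIn j l) + M (suc i) j * δ j (punchIn j l) ∎) ⟩
      cleared j (minor zero j M) ≈⟨ alternating-unique (pull-back (insert-zero-linear j) (fix-head AD (δ j))) _ ⟩
      det (minor zero j M) * cleared j δ         ≈⟨ *-congˡ (cleared-δ j) ⟩
      det (minor zero j M) * (sign j * D δ)      ∎

  cdet-transpose : ∀ {n} (M : Matrix n n) → cdet (λ i j → M j i) ≈ det M
  cdet-transpose {zero}  M = refl
  cdet-transpose {suc n} M = sum-cong-≋ λ j →
    *-congˡ {x = sign j} (*-congˡ {x = M zero j} (cdet-transpose (minor zero j M)))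

  cdet-δ : ∀ {n} → cdet {n} δ ≈ 1#
  cdet-δ {zero}  = refl
  cdet-δ {suc n} = begin
    cdet {suc n} δ
      ≈⟨ sum-only {suc n} zero {λ i → sign i * (δ i zero * cdet (minor i zero δ))} (λ { zero z → contradiction ≡.refl z
                          ; (suc i) _ → trans (*-congˡ (zeroˡ _)) (zeroʳ (sign (suc i))) }) ⟩
    1# * (1# * cdet {n} (λ k l → δ (suc k) (suc l)))   ≈⟨ trans (*-identityˡ _) (*-identityˡ _) ⟩
    cdet {n} (λ k l → δ (suc k) (suc l)) ≈⟨ cdet-cong {n} (λ k l → reflexive (δ-injective suc suc-injective k l)) ⟩
    cdet {n} δ                                     ≈⟨ cdet-δ {n} ⟩
    1#                                             ∎

  -- The two expansions need no comparison: `cdet` is alternating and equals 1 at the identity, so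
  -- uniqueness makes it `det`. As the column expansion of a transpose is the row expansion term by
  -- term, invariance under transposition follows.
  cdet≈det : ∀ {n} (M : Matrix n n) → cdet M ≈ det M
  cdet≈det {n} M = trans (alternating-unique cdet-alternating M) (trans (*-congˡ (cdet-δ {n})) (*-identityʳ _))

  det-transpose : ∀ {n} (M : Matrix n n) → det (λ i j → M j i) ≈ det M
  det-transpose M = trans (sym (cdet≈det λ i j → M j i)) (cdet-transpose M)

  det-alternating : ∀ {n} → Alternating {n} {n} det
  det-alternating = record
    { cong   = det-cong
    ; linear = λ i a b {P} {M} {N} p q r → trans (sym (cdet≈det P)) (trans (cdet-linear i a b p q r)
        (+-cong (*-congˡ (cdet≈det M)) (*-congˡ (cdet≈det N))))
    ; alt    = λ i j adj {M} eq → trans (sym (cdet≈det M)) (cdet-alt i j adj eq)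
    }

  det-δ : ∀ {n} → det {n} δ ≈ 1#
  det-δ {n} = trans (sym (cdet≈det {n} δ)) (cdet-δ {n})

  infixl 7 _⊗_
  _⊗_ : ∀ {k m n} → Matrix k m → Matrix m n → Matrix k n
  (M ⊗ N) i j = sum λ k → M i k * N k j

  ⊗-cong : ∀ {k m n} {M M′ : Matrix k m} {N N′ : Matrix m n} → M ≋ M′ → N ≋ N′ → M ⊗ N ≋ M′ ⊗ N′
  ⊗-cong p q i j = sum-cong-≋ λ k → *-cong (p i k) (q k j)

  ⊗-identityˡ : ∀ {m n} (M : Matrix m n) → δ ⊗ M ≋ M
  ⊗-identityˡ M i j = sum-δˡ i (λ k → M k j)

  ⊗-identityʳ : ∀ {m n} (M : Matrix m n) → M ⊗ δ ≋ M
  ⊗-identityʳ M i j = sum-δʳ j (M i)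

  ⊗-assoc : ∀ {k l m n} (M : Matrix k l) (N : Matrix l m) (P : Matrix m n) → (M ⊗ N) ⊗ P ≋ M ⊗ (N ⊗ P)
  ⊗-assoc M N P i j = begin
    sum (λ b → sum (λ a → M i a * N a b) * P b j) ≈⟨ sum-cong-≋ (λ b → *-distribʳ-sum (P b j) (λ a → M i a * N a b)) ⟩
    sum (λ b → sum (λ a → (M i a * N a b) * P b j))    ≈⟨ ∑-comm (λ b a → (M i a * N a b) * P b j) ⟩
    sum (λ a → sum (λ b → (M i a * N a b) * P b j)) ≈⟨ sum-cong-≋ (λ a → trans (sum-cong-≋ λ b → *-assoc (M i a) (N a b) (P b j)) (sym (*-distribˡ-sum (M i a) (λ b → N a b * P b j)))) ⟩
    sum (λ a → M i a * sum (λ b → N a b * P b j))      ∎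

  -- In its left factor the determinant of a product is alternating, with value `det N` at the
  -- identity, so uniqueness applies.
  det-⊗ : ∀ {n} (M N : Matrix n n) → det (M ⊗ N) ≈ det M * det N
  det-⊗ M N = trans
    (alternating-unique {D = λ X → det (X ⊗ N)} (pull-back {φ = λ x j → sum λ k → x k * N k j} lin det-alternating) M)
    (*-congˡ (det-cong (⊗-identityˡ N)))
    where
    lin : Linear λ x j → sum λ k → x k * N k j
    lin = record
      { φ-cong   = λ eq j → sum-cong-≋ λ k → *-congʳ (eq k)
      ; φ-linear = λ a b {p} {x} {y} eq j → begin
          sum (λ k → p k * N k j) ≈⟨ sum-cong-≋ (λ k → trans (*-congʳ (eq k)) (trans (distribʳ _ _ _) (+-cong (*-assoc _ _ _) (*-assoc _ _ _)))) ⟩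
          sum (λ k → a * (x k * N k j) + b * (y k * N k j)) ≈⟨ ∑-distrib-+ (λ k → a * (x k * N k j)) (λ k → b * (y k * N k j)) ⟩
          sum (λ k → a * (x k * N k j)) + sum (λ k → b * (y k * N k j)) ≈⟨ +-cong (*-distribˡ-sum a (λ k → x k * N k j)) (*-distribˡ-sum b (λ k → y k * N k j)) ⟨
          a * sum (λ k → x k * N k j) + b * sum (λ k → y k * N k j)    ∎
      }

  sum-↑ : ∀ m {n} (f : Vector Carrier (m ℕ.+ n)) → sum f ≈ sum (λ i → f (i ↑ˡ n)) + sum (λ j → f (m ↑ʳ j))
  sum-↑ zero    f = sym (+-identityˡ _)
  sum-↑ (suc m) f = trans (+-congˡ (sum-↑ m (f ∘ suc))) (sym (+-assoc _ _ _))

  -- Only the left block contributes to the first row, and removing one of its columns leaves a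
  -- matrix of the same shape.
  det-lower : ∀ m {n} (M : Matrix (m ℕ.+ n) (m ℕ.+ n)) →
              (∀ i j → M (i ↑ˡ n) (m ↑ʳ j) ≈ 0#) →
              det M ≈ det (λ i j → M (i ↑ˡ n) (j ↑ˡ n)) * det (λ i j → M (m ↑ʳ i) (m ↑ʳ j))
  det-lower zero    M z = sym (*-identityˡ _)
  det-lower (suc m) {n} M z = begin
    det M ≈⟨ sum-↑ (suc m) (λ j → sign j * (M zero j * det (minor zero j M))) ⟩
    sum (λ j → sign (j ↑ˡ n) * (M zero (j ↑ˡ n) * det (minor zero (j ↑ˡ n) M)))
     + sum (λ j → sign (suc m ↑ʳ j) * (M zero (suc m ↑ʳ j) * det (minor zero (suc m ↑ʳ j) M)))
      ≈⟨ +-cong (sum-cong-≋ entry) (sum-zero (λ j → trans (*-congˡ (trans (*-congʳ (z zero j)) (zeroˡ _))) (zeroʳ (sign (suc m ↑ʳ j))))) ⟩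
    sum (λ j → (sign j * (A zero j * det (minor zero j A))) * d) + 0#  ≈⟨ +-identityʳ _ ⟩
    sum (λ j → (sign j * (A zero j * det (minor zero j A))) * d) ≈⟨ *-distribʳ-sum d (λ j → sign j * (A zero j * det (minor zero j A))) ⟨
    det A * d ∎
    where
    A = λ i j → M (i ↑ˡ n) (j ↑ˡ n)
    d = det (λ i j → M (suc m ↑ʳ i) (suc m ↑ʳ j))
    toℕ-↑ˡ : ∀ {m} n (i : Fin m) → toℕ (i ↑ˡ n) ≡ toℕ i
    toℕ-↑ˡ n zero    = ≡.refl
    toℕ-↑ˡ n (suc i) = ≡.cong suc (toℕ-↑ˡ n i)
    entry : ∀ j → sign (j ↑ˡ n) * (M zero (j ↑ˡ n) * det (minor zero (j ↑ˡ n) M))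
                  ≈ (sign j * (A zero j * det (minor zero j A))) * d
    entry j = begin
      sign (j ↑ˡ n) * (M zero (j ↑ˡ n) * det (minor zero (j ↑ˡ n) M))
        ≈⟨ *-cong (reflexive (≡.cong ((- 1#) ^_) (toℕ-↑ˡ n j))) (*-congˡ (det-lower m _ λ i k →
             trans (reflexive (≡.cong (M (suc (i ↑ˡ n))) (punchIn-↑ʳ m j k))) (z (suc i) k))) ⟩
      sign j * (A zero j * (det (λ i k → M (suc i ↑ˡ n) (punchIn (j ↑ˡ n) (k ↑ˡ n)))
        * det (λ i k → M (suc (m ↑ʳ i)) (punchIn (j ↑ˡ n) (m ↑ʳ k)))))
        ≈⟨ *-congˡ (*-congˡ (*-cong
             (det-cong λ i k → reflexive (≡.cong (M (suc i ↑ˡ n)) (punchIn-↑ˡ n j k)))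
             (det-cong λ i k → reflexive (≡.cong (M (suc m ↑ʳ i)) (punchIn-↑ʳ m j k))))) ⟩
      sign j * (A zero j * (det (minor zero j A) * d)) ≈⟨ *-congˡ (*-assoc _ _ _) ⟨
      sign j * ((A zero j * det (minor zero j A)) * d) ≈⟨ *-assoc _ _ _ ⟨
      (sign j * (A zero j * det (minor zero j A))) * d ∎

  det-upper : ∀ m {n} (M : Matrix (m ℕ.+ n) (m ℕ.+ n)) →
              (∀ i j → M (m ↑ʳ i) (j ↑ˡ n) ≈ 0#) →
              det M ≈ det (λ i j → M (i ↑ˡ n) (j ↑ˡ n)) * det (λ i j → M (m ↑ʳ i) (m ↑ʳ j))
  det-upper m {n} M z = begin
    det M                  ≈⟨ det-transpose M ⟨
    det (λ i j → M j i)    ≈⟨ det-lower m _ (λ i j → z j i) ⟩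
    det (λ i j → M (j ↑ˡ n) (i ↑ˡ n)) * det (λ i j → M (m ↑ʳ j) (m ↑ʳ i))
      ≈⟨ *-cong (det-transpose (λ i j → M (i ↑ˡ n) (j ↑ˡ n))) (det-transpose (λ i j → M (m ↑ʳ i) (m ↑ʳ j))) ⟩
    det (λ i j → M (i ↑ˡ n) (j ↑ˡ n)) * det (λ i j → M (m ↑ʳ i) (m ↑ʳ j)) ∎

  product : ∀ {n} → Vector Carrier n → Carrier
  product = Algebra.Definitions.RawSemiring.product (Semiring.rawSemiring semiring)

  diagonal : ∀ {n} → Vector Carrier n → Matrix n n
  diagonal d i j = d i * δ i j

  det-diagonal : ∀ {n} (d : Vector Carrier n) → det (diagonal d) ≈ product d
  det-diagonal {zero}  d = refl
  det-diagonal {suc n} d = begin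
    det (diagonal d) ≈⟨ sum-only zero {λ j → sign j * (diagonal d zero j * det (minor zero j (diagonal d)))} (λ { zero z → contradiction ≡.refl z
       ; (suc j) _ → trans (*-congˡ (trans (*-congʳ (zeroʳ _)) (zeroˡ _))) (zeroʳ (sign (suc j))) }) ⟩
    1# * ((d zero * 1#) * det (λ i k → d (suc i) * δ (suc i) (suc k)))
      ≈⟨ trans (*-identityˡ _) (*-cong (*-identityʳ _) (trans
           (det-cong {n} λ i k → *-congˡ {x = d (suc i)} (reflexive (δ-injective suc suc-injective i k))) (det-diagonal (d ∘ suc)))) ⟩
    product d             ∎

module BlockMatrices {c ℓ} (R : CommutativeRing c ℓ) where
  open CommutativeRing R hiding (zero)
  open Determinant R
  open Algebra.Properties.CommutativeSemigroup *-commutativeSemigroup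
    using (x∙yz≈y∙xz)
  open Algebra.Properties.Semiring.Sum semiring
  open Relation.Binary.Reasoning.Setoid setoid

  beside : ∀ {k m n} → Matrix k m → Matrix k n → Matrix k (m ℕ.+ n)
  beside M N i = M i ++ N i

  ⊗-split : ∀ {k m n o} (M : Matrix k (m ℕ.+ n)) (N : Matrix (m ℕ.+ n) o) i j
            {p : Vector Carrier m} {p′ : Vector Carrier n} {q : Vector Carrier m} {q′ : Vector Carrier n} →
            (∀ a → M i (a ↑ˡ n) ≡ p a) → (∀ a → M i (m ↑ʳ a) ≡ p′ a) →
            (∀ a → N (a ↑ˡ n) j ≡ q a) → (∀ a → N (m ↑ʳ a) j ≡ q′ a) →
            (M ⊗ N) i j ≈ sum (λ a → p a * q a) + sum (λ a → p′ a * q′ a)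
  ⊗-split {m = m} M N i j p p′ q q′ = trans (sum-↑ m (λ a → M i a * N a j)) (+-cong
    (sum-cong-≋ λ a → reflexive (≡.cong₂ _*_ (p a) (q a)))
    (sum-cong-≋ λ a → reflexive (≡.cong₂ _*_ (p′ a) (q′ a))))

  above-ˡ : ∀ {m n o} (M : Matrix m o) (N : Matrix n o) i j → (M ++ N) (i ↑ˡ n) j ≡ M i j
  above-ˡ M N i j = ≡.cong (λ r → r j) (lookup-++ˡ M N i)

  above-ʳ : ∀ {m n o} (M : Matrix m o) (N : Matrix n o) i j → (M ++ N) (m ↑ʳ i) j ≡ N i j
  above-ʳ M N i j = ≡.cong (λ r → r j) (lookup-++ʳ M N i)

  ll : ∀ {m n o p} (M₁ : Matrix m o) (M₂ : Matrix m p) (M₃ : Matrix n o) (M₄ : Matrix n p) i j →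
       (beside M₁ M₂ ++ beside M₃ M₄) (i ↑ˡ n) (j ↑ˡ p) ≡ M₁ i j
  ll M₁ M₂ M₃ M₄ i j = ≡.trans (above-ˡ (beside M₁ M₂) _ i _) (lookup-++ˡ (M₁ i) (M₂ i) j)

  lr : ∀ {m n o p} (M₁ : Matrix m o) (M₂ : Matrix m p) (M₃ : Matrix n o) (M₄ : Matrix n p) i j →
       (beside M₁ M₂ ++ beside M₃ M₄) (i ↑ˡ n) (o ↑ʳ j) ≡ M₂ i j
  lr M₁ M₂ M₃ M₄ i j = ≡.trans (above-ˡ (beside M₁ M₂) _ i _) (lookup-++ʳ (M₁ i) (M₂ i) j)

  rl : ∀ {m n o p} (M₁ : Matrix m o) (M₂ : Matrix m p) (M₃ : Matrix n o) (M₄ : Matrix n p) i j →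
       (beside M₁ M₂ ++ beside M₃ M₄) (m ↑ʳ i) (j ↑ˡ p) ≡ M₃ i j
  rl M₁ M₂ M₃ M₄ i j = ≡.trans (above-ʳ (beside M₁ M₂) _ i _) (lookup-++ˡ (M₃ i) (M₄ i) j)

  rr : ∀ {m n o p} (M₁ : Matrix m o) (M₂ : Matrix m p) (M₃ : Matrix n o) (M₄ : Matrix n p) i j →
       (beside M₁ M₂ ++ beside M₃ M₄) (m ↑ʳ i) (o ↑ʳ j) ≡ M₄ i j
  rr M₁ M₂ M₃ M₄ i j = ≡.trans (above-ʳ (beside M₁ M₂) _ i _) (lookup-++ʳ (M₃ i) (M₄ i) j)

  beside⊗above : ∀ {m n o} (C : Matrix o m) (S : Matrix o n) (C* : Matrix m o) (B : Matrix n o) →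
                 (∀ a b → (C ⊗ C*) a b + (S ⊗ B) a b ≈ δ a b) → beside C S ⊗ (C* ++ B) ≋ δ
  beside⊗above C S C* B inverse a b = trans
    (⊗-split (beside C S) (C* ++ B) a b (lookup-++ˡ (C a) (S a)) (lookup-++ʳ (C a) (S a))
      (λ i → above-ˡ C* B i b) (λ i → above-ʳ C* B i b)) (inverse a b)

  -- [Cᵀ ; B L⁻¹] is block triangular both against the inverse [C* ; B] of
  -- [C | S] and against L [C | S]; comparing the two determinants relates
  -- the Gram matrix of C to that of B.
  complementary-gram : ∀ {h n} (C : Matrix (h ℕ.+ n) h) (S : Matrix (h ℕ.+ n) n)
    (C* : Matrix h (h ℕ.+ n)) (B : Matrix n (h ℕ.+ n)) (l l⁻¹ : Vector Carrier (h ℕ.+ n)) →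
    (∀ a → l a * l⁻¹ a ≈ 1#) →
    (∀ a b → (C ⊗ C*) a b + (S ⊗ B) a b ≈ δ a b) →
    C* ⊗ C ≋ δ → B ⊗ C ≋ (λ _ _ → 0#) → B ⊗ S ≋ δ →
    det (C* ++ B) * det (C* ++ B) ≈ 1# →
    det (λ i j → sum λ a → C a i * (l a * C a j))
      ≈ product l * det (λ v w → sum λ a → B v a * l⁻¹ a * B w a)
  complementary-gram {h} {n} C S C* B l l⁻¹ ll⁻¹≈1 UV≈1 C*C≈1 BC≈0 BS≈1 detV²≈1 = begin
    det G                                ≈⟨ det-G ⟨
    det X * (product l * det U)          ≈⟨ *-congˡ (*-congˡ detU≈detV) ⟩
    det X * (product l * det V)          ≈⟨ x∙yz≈y∙xz _ _ _ ⟩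
    product l * (det X * det V)          ≈⟨ *-congˡ det-N ⟩
    product l * det N                    ∎
    where
    m = h ℕ.+ n
    U V X Vᵀ LU : Matrix m m
    U  = beside C S
    V  = C* ++ B
    Vᵀ a b = V b a
    Cᵀ : Matrix h m
    Cᵀ i a = C a i
    BL : Matrix n m
    BL v a = B v a * l⁻¹ a
    X  = Cᵀ ++ BL
    LU = diagonal l ⊗ U
    G : Matrix h h
    G i j = sum λ a → C a i * (l a * C a j)
    N : Matrix n n
    N v w = sum λ a → B v a * l⁻¹ a * B w a
    detU*detV≈1 : det U * det V ≈ 1#
    detU*detV≈1 = trans (sym (det-⊗ U V)) (trans (det-cong (beside⊗above C S C* B UV≈1)) (det-δ {m}))
    -- `U` and `V` are inverse to each other, and `det V` is its own inverse. Thus `det-G` and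
    -- `det-N` can be compared without a leftover factor.
    detU≈detV : det U ≈ det V
    detU≈detV = begin
      det U                     ≈⟨ *-identityʳ _ ⟨
      det U * 1#                ≈⟨ *-congˡ detV²≈1 ⟨
      det U * (det V * det V)   ≈⟨ *-assoc _ _ _ ⟨
      (det U * det V) * det V   ≈⟨ *-congʳ detU*detV≈1 ⟩
      1# * det V                ≈⟨ *-identityˡ _ ⟩
      det V                     ∎
    entry : ∀ {k o} (M : Matrix k m) (P : Matrix m o) i j {f g : Vector Carrier m} →
            (∀ a → M i a ≡ f a) → (∀ a → P a j ≈ g a) → (M ⊗ P) i j ≈ sum (λ a → f a * g a)
    entry M P i j p q = sum-cong-≋ λ a → *-cong (reflexive (p a)) (q a)
    det-N : det X * det V ≈ det N
    det-N = begin
      det X * det V         ≈⟨ *-congˡ (det-transpose V) ⟨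
      det X * det Vᵀ        ≈⟨ det-⊗ X Vᵀ ⟨
      det (X ⊗ Vᵀ)          ≈⟨ det-lower h (X ⊗ Vᵀ) (λ i w → trans
          (entry X Vᵀ (i ↑ˡ n) (h ↑ʳ w) (above-ˡ Cᵀ BL i) (λ a → reflexive (above-ʳ C* B w a)))
          (trans (sum-cong-≋ λ a → *-comm (C a i) (B w a)) (BC≈0 w i))) ⟩
      det (λ i j → (X ⊗ Vᵀ) (i ↑ˡ n) (j ↑ˡ n)) * det (λ v w → (X ⊗ Vᵀ) (h ↑ʳ v) (h ↑ʳ w))
        ≈⟨ *-cong
           (det-cong λ i j → trans (entry X Vᵀ (i ↑ˡ n) (j ↑ˡ n) (above-ˡ Cᵀ BL i) (λ a → reflexive (above-ˡ C* B j a)))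
             (trans (sum-cong-≋ λ a → *-comm (C a i) (C* j a)) (trans (C*C≈1 j i) (reflexive (δ-sym j i)))))
           (det-cong λ v w → entry X Vᵀ (h ↑ʳ v) (h ↑ʳ w) (above-ʳ Cᵀ BL v) (λ a → reflexive (above-ʳ C* B w a))) ⟩
      det {h} δ * det N     ≈⟨ *-congʳ (det-δ {h}) ⟩
      1# * det N            ≈⟨ *-identityˡ _ ⟩
      det N                 ∎
    LU-entry : ∀ a b → LU a b ≈ l a * U a b
    LU-entry a b = begin
      sum (λ k → (l a * δ a k) * U k b)   ≈⟨ sum-cong-≋ (λ k → *-assoc (l a) (δ a k) (U k b)) ⟩
      sum (λ k → l a * (δ a k * U k b))   ≈⟨ *-distribˡ-sum (l a) (λ k → δ a k * U k b) ⟨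
      l a * sum (λ k → δ a k * U k b)     ≈⟨ *-congˡ (sum-δˡ a (λ k → U k b)) ⟩
      l a * U a b                         ∎
    LUˡ : ∀ j a → LU a (j ↑ˡ n) ≈ l a * C a j
    LUˡ j a = trans (LU-entry a (j ↑ˡ n)) (*-congˡ (reflexive (lookup-++ˡ (C a) (S a) j)))
    LUʳ : ∀ w a → LU a (h ↑ʳ w) ≈ l a * S a w
    LUʳ w a = trans (LU-entry a (h ↑ʳ w)) (*-congˡ (reflexive (lookup-++ʳ (C a) (S a) w)))
    cancel : ∀ b a x → (b * l⁻¹ a) * (l a * x) ≈ b * x
    cancel b a x = begin
      (b * l⁻¹ a) * (l a * x)   ≈⟨ *-assoc b _ _ ⟩
      b * (l⁻¹ a * (l a * x))   ≈⟨ *-congˡ (*-assoc _ _ x) ⟨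
      b * ((l⁻¹ a * l a) * x)   ≈⟨ *-congˡ (*-congʳ (trans (*-comm _ _) (ll⁻¹≈1 a))) ⟩
      b * (1# * x)              ≈⟨ *-congˡ (*-identityˡ x) ⟩
      b * x                     ∎
    det-G : det X * (product l * det U) ≈ det G
    det-G = begin
      det X * (product l * det U)       ≈⟨ *-congˡ (*-congʳ (det-diagonal l)) ⟨
      det X * (det (diagonal l) * det U) ≈⟨ *-congˡ (det-⊗ (diagonal l) U) ⟨
      det X * det LU                    ≈⟨ det-⊗ X LU ⟨
      det (X ⊗ LU)                      ≈⟨ det-upper h (X ⊗ LU) (λ v j → trans
           (entry X LU (h ↑ʳ v) (j ↑ˡ n) (above-ʳ Cᵀ BL v) (LUˡ j))
           (trans (sum-cong-≋ λ a → cancel (B v a) a (C a j)) (BC≈0 v j))) ⟩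
      det (λ i j → (X ⊗ LU) (i ↑ˡ n) (j ↑ˡ n)) * det (λ v w → (X ⊗ LU) (h ↑ʳ v) (h ↑ʳ w))
        ≈⟨ *-cong
           (det-cong λ i j → entry X LU (i ↑ˡ n) (j ↑ˡ n) (above-ˡ Cᵀ BL i) (LUˡ j))
           (det-cong λ v w → trans (entry X LU (h ↑ʳ v) (h ↑ʳ w) (above-ʳ Cᵀ BL v) (LUʳ w))
             (trans (sum-cong-≋ λ a → cancel (B v a) a (S a w)) (BS≈1 v w))) ⟩
      det G * det {n} δ                 ≈⟨ *-congˡ (det-δ {n}) ⟩
      det G * 1#                        ≈⟨ *-identityʳ _ ⟩
      det G                             ∎

-- Integer matrices and the index of a sublattice

module ℤ-Det = Determinant ℤ.+-*-commutativeRing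
module ℤ-Block = BlockMatrices ℤ.+-*-commutativeRing
module ℤ-Sum = Algebra.Properties.Semiring.Sum ℤ.+-*-semiring

open ℤ-Sum using () renaming (sum to ∑)

∣unit∣ : ∀ x y → x ℤ.* y ≡ + 1 → ℤ.∣ x ∣ ≡ 1
∣unit∣ x y xy≡1 = ℕ.m*n≡1⇒m≡1 ℤ.∣ x ∣ ℤ.∣ y ∣ (≡.trans (≡.sym (ℤ.abs-* x y)) (≡.cong ℤ.∣_∣ xy≡1))

unit² : ∀ x y → x ℤ.* y ≡ + 1 → x ℤ.* x ≡ + 1
unit² x y xy≡1 with x | ∣unit∣ x y xy≡1
... | + suc zero  | _ = ≡.refl
... | -[1+ zero ] | _ = ≡.refl

module _ where
  open ℤ-Det
  open ℤ-Block
  open ≡.≡-Reasoning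

  -- A row vector times a matrix. Boundaries, integral combinations and changes of basis all have
  -- this shape, so that `mul-assoc` passes between them.
  mul : ∀ {m n} → Vector ℤ m → Matrix m n → Vector ℤ n
  mul x M j = ∑ λ i → x i ℤ.* M i j

  mul-assoc : ∀ {l m n} (x : Vector ℤ l) (M : Matrix l m) (N : Matrix m n) j → mul (mul x M) N j ≡ mul x (M ⊗ N) j
  mul-assoc x M N j = ⊗-assoc {k = 1} (λ _ → x) M N zero j

  mul-+ : ∀ {m n} (x y : Vector ℤ m) (M : Matrix m n) j → mul (λ i → x i ℤ.+ y i) M j ≡ mul x M j ℤ.+ mul y M j
  mul-+ x y M j = ≡.trans (ℤ-Sum.sum-cong-≗ λ i → ℤ.*-distribʳ-+ (M i j) (x i) (y i)) (ℤ-Sum.∑-distrib-+ (λ i → x i ℤ.* M i j) (λ i → y i ℤ.* M i j))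

  mul-neg : ∀ {m n} (x : Vector ℤ m) (M : Matrix m n) j → mul (λ i → ℤ.- x i) M j ≡ ℤ.- mul x M j
  mul-neg x M j = begin
    mul (λ i → ℤ.- x i) M j ≡⟨ ℤ-Sum.sum-cong-≗ (λ i → ≡.trans (≡.sym (ℤ.neg-distribˡ-* (x i) (M i j))) (≡.sym (ℤ.-1*i≡-i (x i ℤ.* M i j)))) ⟩
    ∑ (λ i → ℤ.-1ℤ ℤ.* (x i ℤ.* M i j))    ≡⟨ ℤ-Sum.*-distribˡ-sum ℤ.-1ℤ (λ i → x i ℤ.* M i j) ⟨
    ℤ.-1ℤ ℤ.* mul x M j                    ≡⟨ ℤ.-1*i≡-i _ ⟩
    ℤ.- mul x M j                          ∎

  mul-sub : ∀ {m n} (x y : Vector ℤ m) (M : Matrix m n) j → mul (λ i → x i ℤ.- y i) M j ≡ mul x M j ℤ.- mul y M j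
  mul-sub x y M j = ≡.trans (mul-+ x (λ i → ℤ.- y i) M j) (≡.cong (λ t → mul x M j ℤ.+ t) (mul-neg y M j))

  mul-+ᴹ : ∀ {m n} (x : Vector ℤ m) (M N : Matrix m n) j → mul x M j ℤ.+ mul x N j ≡ mul x (λ i j → M i j ℤ.+ N i j) j
  mul-+ᴹ x M N j = ≡.sym (≡.trans (ℤ-Sum.sum-cong-≗ λ i → ℤ.*-distribˡ-+ (x i) (M i j) (N i j)) (ℤ-Sum.∑-distrib-+ (λ i → x i ℤ.* M i j) (λ i → x i ℤ.* N i j)))

  mul-negᴹ : ∀ {m n} (x : Vector ℤ m) (M : Matrix m n) j → mul x (λ i j → ℤ.- M i j) j ≡ ℤ.- mul x M j
  mul-negᴹ x M j = ≡.trans (ℤ-Sum.sum-cong-≗ λ i → ≡.trans (≡.sym (ℤ.neg-distribʳ-* (x i) (M i j))) (ℤ.neg-distribˡ-* (x i) (M i j))) (mul-neg x M j)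

  mul-subᴹ : ∀ {m n} (x : Vector ℤ m) (M N : Matrix m n) j → mul x (λ i j → M i j ℤ.- N i j) j ≡ mul x M j ℤ.- mul x N j
  mul-subᴹ x M N j = ≡.trans (≡.sym (mul-+ᴹ x M (λ i j → ℤ.- N i j) j)) (≡.cong (λ t → mul x M j ℤ.+ t) (mul-negᴹ x N j))

  mul-cong : ∀ {m n} {x y : Vector ℤ m} (M : Matrix m n) j → (∀ i → x i ≡ y i) → mul x M j ≡ mul y M j
  mul-cong M j x≗y = ℤ-Sum.sum-cong-≗ λ i → ≡.cong (ℤ._* M i j) (x≗y i)

  mul-congᴹ : ∀ {m n} (x : Vector ℤ m) (M N : Matrix m n) j → (∀ i → M i j ≡ N i j) → mul x M j ≡ mul x N j
  mul-congᴹ x M N j M≗N = ℤ-Sum.sum-cong-≗ λ i → ≡.cong (x i ℤ.*_) (M≗N i)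

  -- The lattice ℤʰ is generated by the rows of A and P, and the relations
  -- between these generators are 2 P = T A, so [R Q ; -T 2] is unimodular.
  det-index : ∀ {h k} (A R : Matrix h h) (P : Matrix k h) (Q : Matrix h k) (T : Matrix k h) →
    (∀ i j → (R ⊗ A) i j ℤ.+ (Q ⊗ P) i j ≡ δ i j) →
    (∀ l j → + 2 ℤ.* P l j ≡ (T ⊗ A) l j) →
    (∀ (x : Vector ℤ k) (y : Vector ℤ h) →
      (∀ j → ∑ (λ l → x l ℤ.* P l j) ≡ ∑ (λ i → y i ℤ.* A i j)) →
      ∃ λ (z : Vector ℤ k) → ∀ l → x l ≡ + 2 ℤ.* z l) →
    (∀ (y : Vector ℤ h) → (∀ j → ∑ (λ i → y i ℤ.* A i j) ≡ + 0) → ∀ i → y i ≡ + 0) →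
    ℤ.∣ det A ∣ ≡ 2 ℕ.^ k
  det-index {h} {k} A R P Q T RA+QP≡1 2P≡TA even injective = begin
    ℤ.∣ det A ∣                      ≡⟨ ℕ.*-identityˡ _ ⟨
    1 ℕ.* ℤ.∣ det A ∣ ≡⟨ ≡.cong (ℕ._* ℤ.∣ det A ∣) (∣unit∣ (det W) (det V) (≡.trans (ℤ.*-comm (det W) (det V)) detV*detW)) ⟨
    ℤ.∣ det W ∣ ℕ.* ℤ.∣ det A ∣      ≡⟨ ℤ.abs-* (det W) (det A) ⟨
    ℤ.∣ det W ℤ.* det A ∣            ≡⟨ ≡.cong ℤ.∣_∣ detW*detA ⟩
    ℤ.∣ product {k} (λ _ → + 2) ∣    ≡⟨ ∣2^∣ k ⟩
    2 ℕ.^ k                          ∎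
    where
    ∣2^∣ : ∀ k → ℤ.∣ product {k} (λ _ → + 2) ∣ ≡ 2 ℕ.^ k
    ∣2^∣ zero    = ≡.refl
    ∣2^∣ (suc k) = ≡.trans (ℤ.abs-* (+ 2) (product {k} λ _ → + 2)) (≡.cong (2 ℕ.*_) (∣2^∣ k))
    coordinates : ∀ (y : Vector ℤ h) (x : Vector ℤ k) → ∃₂ λ (u : Vector ℤ h) (z : Vector ℤ k) →
      (∀ i → mul u R i ℤ.- mul z T i ≡ y i) × (∀ l → mul u Q l ℤ.+ + 2 ℤ.* z l ≡ x l)
    coordinates y x = u , z , y-eq , x-eq
      where
      -- The value is forced: multiplying (u , z) W by the column [A ; P] returns `u`, because R A +
      -- Q P is the identity and 2 P = T A.
      u = λ j → mul y A j ℤ.+ mul x P j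
      y′ = λ i → y i ℤ.+ ℤ.- mul u R i
      x′ = λ l → x l ℤ.+ ℤ.- mul u Q l
      y′A : ∀ j → mul y′ A j ≡ mul y A j ℤ.- mul u (R ⊗ A) j
      y′A j = ≡.trans (mul-+ y _ A j) (≡.cong (λ t → mul y A j ℤ.+ t) (≡.trans (mul-neg (mul u R) A j) (≡.cong ℤ.-_ (mul-assoc u R A j))))
      x′P : ∀ j → mul x′ P j ≡ mul x P j ℤ.- mul u (Q ⊗ P) j
      x′P j = ≡.trans (mul-+ x _ P j) (≡.cong (λ t → mul x P j ℤ.+ t) (≡.trans (mul-neg (mul u Q) P j) (≡.cong ℤ.-_ (mul-assoc u Q P j))))
      u-eq : ∀ j → mul u (R ⊗ A) j ℤ.+ mul u (Q ⊗ P) j ≡ u j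
      u-eq j = ≡.trans (mul-+ᴹ u (R ⊗ A) (Q ⊗ P) j) (≡.trans (ℤ-Sum.sum-cong-≗ λ i → ≡.cong (u i ℤ.*_) (RA+QP≡1 i j)) (sum-δʳ j u))
      balance : ∀ a b c d → c ℤ.+ d ≡ a ℤ.+ b → b ℤ.- d ≡ ℤ.- (a ℤ.- c)
      balance a b c d e = begin
        b ℤ.- d                          ≡⟨ add-sub a b d ⟩
        (a ℤ.+ b) ℤ.- a ℤ.- d            ≡⟨ ≡.cong (λ t → t ℤ.- a ℤ.- d) e ⟨
        (c ℤ.+ d) ℤ.- a ℤ.- d            ≡⟨ sub-sub a c d ⟩
        ℤ.- (a ℤ.- c)                    ∎
        where
        add-sub : ∀ a b d → b ℤ.- d ≡ (a ℤ.+ b) ℤ.- a ℤ.- d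
        add-sub = ℤ-Solver.solve-∀
        sub-sub : ∀ a c d → (c ℤ.+ d) ℤ.- a ℤ.- d ≡ ℤ.- (a ℤ.- c)
        sub-sub = ℤ-Solver.solve-∀
      x′P≡-y′A : ∀ j → mul x′ P j ≡ mul (λ i → ℤ.- y′ i) A j
      x′P≡-y′A j = begin
        mul x′ P j                            ≡⟨ x′P j ⟩
        mul x P j ℤ.- mul u (Q ⊗ P) j ≡⟨ balance (mul y A j) (mul x P j) (mul u (R ⊗ A) j) (mul u (Q ⊗ P) j) (u-eq j) ⟩
        ℤ.- (mul y A j ℤ.- mul u (R ⊗ A) j)   ≡⟨ ≡.cong ℤ.-_ (y′A j) ⟨
        ℤ.- mul y′ A j                        ≡⟨ mul-neg y′ A j ⟨
        mul (λ i → ℤ.- y′ i) A j              ∎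
      -- The remainders satisfy x′ P = - y′ A, so `x′` is even by hypothesis, and its half is the
      -- wanted `z`.
      halves = even x′ (λ i → ℤ.- y′ i) x′P≡-y′A
      z = proj₁ halves
      zTA : ∀ j → mul (mul z T) A j ≡ mul x′ P j
      zTA j = begin
        mul (mul z T) A j                     ≡⟨ mul-assoc z T A j ⟩
        mul z (T ⊗ A) j ≡⟨ ℤ-Sum.sum-cong-≗ (λ l → ≡.cong (z l ℤ.*_) (2P≡TA l j)) ⟨
        ∑ (λ l → z l ℤ.* (+ 2 ℤ.* P l j)) ≡⟨ ℤ-Sum.sum-cong-≗ (λ l → ≡.trans (≡.sym (ℤ.*-assoc (z l) (+ 2) (P l j))) (≡.cong (ℤ._* P l j) (≡.trans (ℤ.*-comm (z l) (+ 2)) (≡.sym (proj₂ halves l))))) ⟩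
        mul x′ P j                            ∎
      y′+zT≡0 : ∀ i → y′ i ℤ.+ mul z T i ≡ + 0
      y′+zT≡0 = injective _ λ j → begin
        mul (λ i → y′ i ℤ.+ mul z T i) A j            ≡⟨ mul-+ y′ (mul z T) A j ⟩
        mul y′ A j ℤ.+ mul (mul z T) A j ≡⟨ ≡.cong (λ t → mul y′ A j ℤ.+ t) (≡.trans (zTA j) (≡.trans (x′P≡-y′A j) (mul-neg y′ A j))) ⟩
        mul y′ A j ℤ.- mul y′ A j                     ≡⟨ ℤ.+-inverseʳ (mul y′ A j) ⟩
        + 0                                           ∎
      y-eq : ∀ i → mul u R i ℤ.- mul z T i ≡ y i
      y-eq i = begin
        mul u R i ℤ.- mul z T i ≡⟨ regroup (y i) (mul u R i) (mul z T i) ⟩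
        y i ℤ.- (y′ i ℤ.+ mul z T i) ≡⟨ ≡.cong (λ t → y i ℤ.- t) (y′+zT≡0 i) ⟩
        y i ℤ.- + 0                                               ≡⟨ ℤ.+-identityʳ (y i) ⟩
        y i                                                       ∎
        where
        regroup : ∀ a b c → b ℤ.- c ≡ a ℤ.- ((a ℤ.+ ℤ.- b) ℤ.+ c)
        regroup = ℤ-Solver.solve-∀
      x-eq : ∀ l → mul u Q l ℤ.+ + 2 ℤ.* z l ≡ x l
      x-eq l = ≡.trans (≡.cong (λ t → mul u Q l ℤ.+ t) (≡.sym (proj₂ halves l))) (regroup (mul u Q l) (x l))
        where
        regroup : ∀ a b → a ℤ.+ (b ℤ.+ ℤ.- a) ≡ b
        regroup = ℤ-Solver.solve-∀
    2δ : Matrix k k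
    2δ = diagonal λ _ → + 2
    -T : Matrix k h
    -T l i = ℤ.- T l i
    0ᴹ : ∀ {m n} → Matrix m n
    0ᴹ _ _ = + 0
    -- `V` lists the solutions for the unit vectors, so V W is the identity and det W = ±1. The
    -- product W X is [1 Q ; 0 2] while det X = det A, which gives the power of 2.
    W V X : Matrix (h ℕ.+ k) (h ℕ.+ k)
    W = beside R Q ++ beside -T 2δ
    X = beside A 0ᴹ ++ beside P δ
    uˡ : Matrix h h
    uˡ i = proj₁ (coordinates (δ i) (λ _ → + 0))
    zˡ : Matrix h k
    zˡ i = proj₁ (proj₂ (coordinates (δ i) (λ _ → + 0)))
    uʳ : Matrix k h
    uʳ l = proj₁ (coordinates (λ _ → + 0) (δ l))
    zʳ : Matrix k k
    zʳ l = proj₁ (proj₂ (coordinates (λ _ → + 0) (δ l)))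
    V = beside uˡ zˡ ++ beside uʳ zʳ
    x*2δ : ∀ (x : Vector ℤ k) l → mul x 2δ l ≡ + 2 ℤ.* x l
    x*2δ x l = begin
      ∑ (λ a → x a ℤ.* (+ 2 ℤ.* δ a l))     ≡⟨ ℤ-Sum.sum-cong-≗ (λ a → regroup (x a) (δ a l)) ⟩
      ∑ (λ a → + 2 ℤ.* (x a ℤ.* δ a l))     ≡⟨ ℤ-Sum.*-distribˡ-sum (+ 2) (λ a → x a ℤ.* δ a l) ⟨
      + 2 ℤ.* ∑ (λ a → x a ℤ.* δ a l)       ≡⟨ ≡.cong (+ 2 ℤ.*_) (sum-δʳ l x) ⟩
      + 2 ℤ.* x l                           ∎
      where
      regroup : ∀ a b → a ℤ.* (+ 2 ℤ.* b) ≡ + 2 ℤ.* (a ℤ.* b)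
      regroup = ℤ-Solver.solve-∀
    2δ*M : ∀ {n} (M : Matrix k n) l j → (2δ ⊗ M) l j ≡ + 2 ℤ.* M l j
    2δ*M M l j = begin
      ∑ (λ a → + 2 ℤ.* δ l a ℤ.* M a j) ≡⟨ ℤ-Sum.sum-cong-≗ (λ a → ℤ.*-assoc (+ 2) (δ l a) (M a j)) ⟩
      ∑ (λ a → + 2 ℤ.* (δ l a ℤ.* M a j))   ≡⟨ ℤ-Sum.*-distribˡ-sum (+ 2) (λ a → δ l a ℤ.* M a j) ⟨
      + 2 ℤ.* ∑ (λ a → δ l a ℤ.* M a j)     ≡⟨ ≡.cong (+ 2 ℤ.*_) (sum-δˡ l (λ a → M a j)) ⟩
      + 2 ℤ.* M l j                         ∎
    mul-T : ∀ (z : Vector ℤ k) i → mul z -T i ≡ ℤ.- mul z T i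
    mul-T z i = ≡.trans (ℤ-Sum.sum-cong-≗ λ l → ≡.trans (≡.sym (ℤ.neg-distribʳ-* (z l) (T l i))) (ℤ.neg-distribˡ-* (z l) (T l i))) (mul-neg z T i)
    det-1 : ∀ {n} (M : Matrix n n) → M ≋ δ → det M ≡ + 1
    det-1 {n} M M≋δ = ≡.trans (det-cong M≋δ) (det-δ {n})
    detV*detW : det V ℤ.* det W ≡ + 1
    detV*detW = begin
      det V ℤ.* det W    ≡⟨ det-⊗ V W ⟨
      det (V ⊗ W) ≡⟨ det-lower h (V ⊗ W) (λ i l → ≡.trans (⊗-split V W (i ↑ˡ k) (h ↑ʳ l) (ll uˡ zˡ uʳ zʳ i) (lr uˡ zˡ uʳ zʳ i) (λ a → lr R Q -T 2δ a l) (λ a → rr R Q -T 2δ a l))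
                              (≡.trans (≡.cong (λ t → mul (uˡ i) Q l ℤ.+ t) (x*2δ (zˡ i) l)) (proj₂ (proj₂ (proj₂ (coordinates (δ i) (λ _ → + 0)))) l))) ⟩
      det (λ i j → (V ⊗ W) (i ↑ˡ k) (j ↑ˡ k)) ℤ.* det (λ i j → (V ⊗ W) (h ↑ʳ i) (h ↑ʳ j))
        ≡⟨ ≡.cong₂ ℤ._*_
             (det-1 (λ i j → (V ⊗ W) (i ↑ˡ k) (j ↑ˡ k)) λ i j → ≡.trans (⊗-split V W (i ↑ˡ k) (j ↑ˡ k) (ll uˡ zˡ uʳ zʳ i) (lr uˡ zˡ uʳ zʳ i) (λ a → ll R Q -T 2δ a j) (λ a → rl R Q -T 2δ a j))
               (≡.trans (≡.cong (λ t → mul (uˡ i) R j ℤ.+ t) (mul-T (zˡ i) j)) (proj₁ (proj₂ (proj₂ (coordinates (δ i) (λ _ → + 0)))) j)))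
             (det-1 (λ i j → (V ⊗ W) (h ↑ʳ i) (h ↑ʳ j)) λ l l′ → ≡.trans (⊗-split V W (h ↑ʳ l) (h ↑ʳ l′) (rl uˡ zˡ uʳ zʳ l) (rr uˡ zˡ uʳ zʳ l) (λ a → lr R Q -T 2δ a l′) (λ a → rr R Q -T 2δ a l′))
               (≡.trans (≡.cong (λ t → mul (uʳ l) Q l′ ℤ.+ t) (x*2δ (zʳ l) l′)) (proj₂ (proj₂ (proj₂ (coordinates (λ _ → + 0) (δ l)))) l′))) ⟩
      + 1                ∎
    detX≡detA : det X ≡ det A
    detX≡detA = begin
      det X         ≡⟨ det-lower h X (λ i l → lr A 0ᴹ P δ i l) ⟩
      det (λ i j → X (i ↑ˡ k) (j ↑ˡ k)) ℤ.* det (λ i j → X (h ↑ʳ i) (h ↑ʳ j))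
                    ≡⟨ ≡.cong₂ ℤ._*_ (det-cong (ll A 0ᴹ P δ)) (det-1 (λ i j → X (h ↑ʳ i) (h ↑ʳ j)) (rr A 0ᴹ P δ)) ⟩
      det A ℤ.* + 1 ≡⟨ ℤ.*-identityʳ (det A) ⟩
      det A         ∎
    detW*detA : det W ℤ.* det A ≡ product {k} (λ _ → + 2)
    detW*detA = begin
      det W ℤ.* det A       ≡⟨ ≡.cong (det W ℤ.*_) detX≡detA ⟨
      det W ℤ.* det X       ≡⟨ det-⊗ W X ⟨
      det (W ⊗ X)           ≡⟨ det-upper h (W ⊗ X) lower-left ⟩
      det (λ i j → (W ⊗ X) (i ↑ˡ k) (j ↑ˡ k)) ℤ.* det (λ i j → (W ⊗ X) (h ↑ʳ i) (h ↑ʳ j))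
        ≡⟨ ≡.cong₂ ℤ._*_
             (det-1 (λ i j → (W ⊗ X) (i ↑ˡ k) (j ↑ˡ k)) λ i j → ≡.trans (⊗-split W X (i ↑ˡ k) (j ↑ˡ k) (ll R Q -T 2δ i) (lr R Q -T 2δ i) (λ a → ll A 0ᴹ P δ a j) (λ a → rl A 0ᴹ P δ a j)) (RA+QP≡1 i j))
             (det-cong {k} λ l l′ → lower-right l l′) ⟩
      + 1 ℤ.* det 2δ        ≡⟨ ℤ.*-identityˡ _ ⟩
      det 2δ                ≡⟨ det-diagonal {k} (λ _ → + 2) ⟩
      product {k} (λ _ → + 2) ∎
      where
      neg-⊗ : ∀ {n} (M : Matrix h n) l j → (-T ⊗ M) l j ≡ ℤ.- (T ⊗ M) l j
      neg-⊗ M l j = mul-neg (T l) M j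
      lower-left : ∀ l j → (W ⊗ X) (h ↑ʳ l) (j ↑ˡ k) ≡ + 0
      lower-left l j = begin
        (W ⊗ X) (h ↑ʳ l) (j ↑ˡ k) ≡⟨ ⊗-split W X (h ↑ʳ l) (j ↑ˡ k) (rl R Q -T 2δ l) (rr R Q -T 2δ l) (λ a → ll A 0ᴹ P δ a j) (λ a → rl A 0ᴹ P δ a j) ⟩
        (-T ⊗ A) l j ℤ.+ (2δ ⊗ P) l j ≡⟨ ≡.cong₂ ℤ._+_ (neg-⊗ A l j) (≡.trans (2δ*M P l j) (2P≡TA l j)) ⟩
        ℤ.- (T ⊗ A) l j ℤ.+ (T ⊗ A) l j         ≡⟨ ℤ.+-inverseˡ ((T ⊗ A) l j) ⟩
        + 0                                     ∎
      lower-right : ∀ l l′ → (W ⊗ X) (h ↑ʳ l) (h ↑ʳ l′) ≡ 2δ l l′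
      lower-right l l′ = begin
        (W ⊗ X) (h ↑ʳ l) (h ↑ʳ l′) ≡⟨ ⊗-split W X (h ↑ʳ l) (h ↑ʳ l′) (rl R Q -T 2δ l) (rr R Q -T 2δ l) (λ a → lr A 0ᴹ P δ a l′) (λ a → rr A 0ᴹ P δ a l′) ⟩
        (-T ⊗ 0ᴹ) l l′ ℤ.+ (2δ ⊗ δ) l l′ ≡⟨ ≡.cong₂ ℤ._+_ (sum-zero {f = λ i → -T l i ℤ.* + 0} λ i → ℤ.*-zeroʳ (-T l i)) (⊗-identityʳ 2δ l l′) ⟩
        + 0 ℤ.+ 2δ l l′                         ≡⟨ ℤ.+-identityˡ _ ⟩
        2δ l l′                                 ∎

-- Ordered fields: images of integers, signs and powers

module OrderedFieldProperties {c ℓ₁ ℓ₂} (𝔽 : OrderedField c ℓ₁ ℓ₂) where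
  open OrderedField 𝔽
  module D = Determinant commutativeRing
  open CommutativeRing commutativeRing using (refl; sym; trans)
  open Algebra.Properties.Ring ring using (-‿distribˡ-*; -‿distribʳ-*; -‿involutive; -0#≈0#; -‿+-comm)
  open Algebra.Properties.CommutativeSemigroup +-commutativeSemigroup using (interchange)
  open Algebra.Properties.Semiring.Sum semiring using (sum-cong-≋)
  open Algebra.Properties.Semiring.Mult semiring using (×-homo-+; ×1-homo-*)
  open Algebra.Properties.Semiring.Exp semiring using (^-homo-*)
  open Algebra.Properties.CommutativeSemiring.Exp commutativeSemiring using (^-distrib-*)
  open Relation.Binary.Reasoning.Setoid setoid
  open IsStrictTotalOrder isStrictTotalOrder using (compare; <-resp-≈; irrefl)
    renaming (trans to <-trans)

  fromℤ-⊖ : ∀ m n → fromℤ (m ℤ.⊖ n) ≈ m · 1# - n · 1#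
  fromℤ-⊖ m       zero    = trans (sym (+-identityʳ _)) (+-congˡ (sym -0#≈0#))
  fromℤ-⊖ zero    (suc n) = sym (+-identityˡ _)
  fromℤ-⊖ (suc m) (suc n) = begin
    fromℤ (suc m ℤ.⊖ suc n)              ≡⟨ ≡.cong fromℤ (ℤ.[1+m]⊖[1+n]≡m⊖n m n) ⟩
    fromℤ (m ℤ.⊖ n)                      ≈⟨ fromℤ-⊖ m n ⟩
    m · 1# - n · 1#                      ≈⟨ +-identityˡ _ ⟨
    0# + (m · 1# - n · 1#)               ≈⟨ +-congʳ (-‿inverseʳ 1#) ⟨
    (1# - 1#) + (m · 1# - n · 1#)        ≈⟨ interchange 1# (- 1#) _ _ ⟩
    suc m · 1# + (- 1# - n · 1#)         ≈⟨ +-congˡ (-‿+-comm 1# (n · 1#)) ⟩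
    suc m · 1# - suc n · 1#              ∎

  fromℤ-neg : ∀ x → fromℤ (ℤ.- x) ≈ - fromℤ x
  fromℤ-neg (+ zero)  = sym -0#≈0#
  fromℤ-neg (+ suc n) = refl
  fromℤ-neg -[1+ n ]  = sym (-‿involutive _)

  fromℤ-+ : ∀ x y → fromℤ (x ℤ.+ y) ≈ fromℤ x + fromℤ y
  fromℤ-+ (+ m)    (+ n)    = ×-homo-+ 1# m n
  fromℤ-+ (+ m)    -[1+ n ] = fromℤ-⊖ m (suc n)
  fromℤ-+ -[1+ m ] (+ n)    = trans (fromℤ-⊖ n (suc m)) (+-comm _ _)
  fromℤ-+ -[1+ m ] -[1+ n ] = begin
    - (suc (suc (m ℕ.+ n)) · 1#)       ≡⟨ ≡.cong (λ k → - (k · 1#)) (≡.sym (ℕ.+-suc (suc m) n)) ⟩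
    - ((suc m ℕ.+ suc n) · 1#)         ≈⟨ -‿cong (×-homo-+ 1# (suc m) (suc n)) ⟩
    - (suc m · 1# + suc n · 1#)        ≈⟨ -‿+-comm _ _ ⟨
    - (suc m · 1#) + - (suc n · 1#)    ∎

  fromℤ-* : ∀ x y → fromℤ (x ℤ.* y) ≈ fromℤ x * fromℤ y
  fromℤ-* = λ { (+ m) → pos m ; -[1+ m ] y → begin
      fromℤ ((ℤ.- + suc m) ℤ.* y)      ≡⟨ ≡.cong fromℤ (ℤ.neg-distribˡ-* (+ suc m) y) ⟨
      fromℤ (ℤ.- (+ suc m ℤ.* y))      ≈⟨ fromℤ-neg (+ suc m ℤ.* y) ⟩
      - fromℤ (+ suc m ℤ.* y)          ≈⟨ -‿cong (pos (suc m) y) ⟩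
      - (suc m · 1# * fromℤ y)         ≈⟨ -‿distribˡ-* _ _ ⟩
      - (suc m · 1#) * fromℤ y         ∎ }
    where
    pos : ∀ m y → fromℤ (+ m ℤ.* y) ≈ m · 1# * fromℤ y
    pos m (+ n)    = trans (reflexive (≡.cong fromℤ (≡.sym (ℤ.pos-* m n)))) (×1-homo-* m n)
    pos m -[1+ n ] = begin
      fromℤ (+ m ℤ.* (ℤ.- + suc n))    ≡⟨ ≡.cong fromℤ (ℤ.neg-distribʳ-* (+ m) (+ suc n)) ⟨
      fromℤ (ℤ.- (+ m ℤ.* + suc n))    ≈⟨ fromℤ-neg (+ m ℤ.* + suc n) ⟩
      - fromℤ (+ m ℤ.* + suc n)        ≈⟨ -‿cong (pos m (+ suc n)) ⟩
      - (m · 1# * suc n · 1#)          ≈⟨ -‿distribʳ-* _ _ ⟩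
      m · 1# * - (suc n · 1#)          ∎

  fromℤ-1 : fromℤ (+ 1) ≈ 1#
  fromℤ-1 = +-identityʳ 1#

  fromℤ-sum : ∀ {n} (f : Vector ℤ n) → fromℤ (∑ f) ≈ sum (fromℤ ∘ f)
  fromℤ-sum {zero}  f = refl
  fromℤ-sum {suc n} f = trans (fromℤ-+ (f zero) _) (+-congˡ (fromℤ-sum (f ∘ suc)))

  fromℤᴹ : ∀ {m n} → ℤ-Det.Matrix m n → D.Matrix m n
  fromℤᴹ M i j = fromℤ (M i j)

  fromℤ-⊗ : ∀ {k m n} (M : ℤ-Det.Matrix k m) (N : ℤ-Det.Matrix m n) i j →
            fromℤ ((M ℤ-Det.⊗ N) i j) ≈ (fromℤᴹ M D.⊗ fromℤᴹ N) i j
  fromℤ-⊗ M N i j = trans (fromℤ-sum λ k → M i k ℤ.* N k j) (sum-cong-≋ λ k → fromℤ-* (M i k) (N k j))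

  fromℤ-δ : ∀ {n} (i j : Fin n) → fromℤ (ℤ-Det.δ i j) ≈ D.δ i j
  fromℤ-δ i j with i ≟ j
  ... | yes _ = fromℤ-1
  ... | no _  = refl

  fromℤ-sign : ∀ {n} (i : Fin n) → fromℤ (ℤ-Det.sign i) ≈ D.sign i
  fromℤ-sign zero    = fromℤ-1
  fromℤ-sign (suc i) = trans (fromℤ-* (ℤ.- + 1) (ℤ-Det.sign i)) (*-cong (-‿cong fromℤ-1) (fromℤ-sign i))

  fromℤ-det : ∀ {n} (M : ℤ-Det.Matrix n n) → fromℤ (ℤ-Det.det M) ≈ D.det (fromℤᴹ M)
  fromℤ-det {zero}  M = fromℤ-1
  fromℤ-det {suc n} M = trans
    (fromℤ-sum λ j → ℤ-Det.sign j ℤ.* (M zero j ℤ.* ℤ-Det.det (ℤ-Det.minor zero j M)))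
    (sum-cong-≋ λ j → trans (fromℤ-* (ℤ-Det.sign j) (M zero j ℤ.* ℤ-Det.det (ℤ-Det.minor zero j M))) (*-cong (fromℤ-sign j)
      (trans (fromℤ-* (M zero j) (ℤ-Det.det (ℤ-Det.minor zero j M))) (*-congˡ (fromℤ-det (ℤ-Det.minor zero j M))))))

  det-agrees : ∀ {n} (M : D.Matrix n n) → det M ≈ D.det M
  det-agrees {zero}  M = refl
  det-agrees {suc n} M = sum-cong-≋ λ j →
    *-congˡ {x = D.sign j} (*-congˡ {x = M zero j} (det-agrees (D.minor zero j M)))

  Nonnegative : Carrier → Set (ℓ₁ ⊔ ℓ₂)
  Nonnegative x = 0# < x ⊎ x ≈ 0#

  nonnegative-resp : ∀ {x y} → x ≈ y → Nonnegative x → Nonnegative y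
  nonnegative-resp x≈y (inj₁ 0<x) = inj₁ (proj₁ <-resp-≈ x≈y 0<x)
  nonnegative-resp x≈y (inj₂ x≈0) = inj₂ (trans (sym x≈y) x≈0)

  +-positiveˡ : ∀ {x y} → 0# < x → Nonnegative y → 0# < x + y
  +-positiveˡ {x} {y} 0<x (inj₁ 0<y) = <-trans 0<x (proj₂ <-resp-≈ (+-identityʳ x) (+-monoʳ-< x 0<y))
  +-positiveˡ 0<x (inj₂ y≈0) = proj₁ <-resp-≈ (sym (trans (+-congˡ y≈0) (+-identityʳ _))) 0<x

  +-nonnegative : ∀ {x y} → Nonnegative x → Nonnegative y → Nonnegative (x + y)
  +-nonnegative (inj₁ 0<x) y≥0 = inj₁ (+-positiveˡ 0<x y≥0)
  +-nonnegative (inj₂ x≈0) y≥0 = nonnegative-resp (sym (trans (+-congʳ x≈0) (+-identityˡ _))) y≥0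

  *-nonnegative : ∀ {x y} → Nonnegative x → Nonnegative y → Nonnegative (x * y)
  *-nonnegative (inj₁ 0<x) (inj₁ 0<y) = inj₁ (*-positive 0<x 0<y)
  *-nonnegative (inj₁ 0<x) (inj₂ y≈0) = inj₂ (trans (*-congˡ y≈0) (zeroʳ _))
  *-nonnegative (inj₂ x≈0) y≥0        = inj₂ (trans (*-congʳ x≈0) (zeroˡ _))

  ℕ-nonnegative : ∀ n → Nonnegative (n · 1#)
  ℕ-nonnegative zero    = inj₂ refl
  ℕ-nonnegative (suc n) = inj₁ (+-positiveˡ 0<1 (ℕ-nonnegative n))

  ^-positive : ∀ {x} n → 0# < x → 0# < x ^ n
  ^-positive zero    0<x = 0<1
  ^-positive (suc n) 0<x = *-positive 0<x (^-positive n 0<x)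

  ∏-nonnegative : ∀ {n p} {P : Pred (Fin n) p} (P? : Decidable P) {f : Vector Carrier n} →
                  (∀ i → 0# < f i) → Nonnegative (∏ P? f)
  ∏-nonnegative {zero}  P? 0<f = inj₁ 0<1
  ∏-nonnegative {suc n} P? 0<f with P? zero
  ... | yes _ = *-nonnegative (inj₁ (0<f zero)) (∏-nonnegative (P? ∘ suc) (0<f ∘ suc))
  ... | no _  = *-nonnegative (inj₁ 0<1) (∏-nonnegative (P? ∘ suc) (0<f ∘ suc))

  ∑ₗ-nonnegative : ∀ {a} {A : Set a} (xs : List A) {f : A → Carrier} →
                   (∀ x → Nonnegative (f x)) → Nonnegative (∑ₗ xs f)
  ∑ₗ-nonnegative List.[]       f≥0 = inj₂ refl
  ∑ₗ-nonnegative (x List.∷ xs) f≥0 = +-nonnegative (f≥0 x) (∑ₗ-nonnegative xs f≥0)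

  >⇒≉ : ∀ {x} → 0# < x → ¬ (x ≈ 0#)
  >⇒≉ 0<x x≈0 = irrefl refl (proj₁ <-resp-≈ x≈0 0<x)

  -- The bases of K and K′ are arbitrary, so the determinant is known only up to sign; a nonnegative
  -- candidate decides it.
  abs-± : ∀ {x y} → Nonnegative y → x ≈ y ⊎ x ≈ - y → abs x ≈ y
  abs-± {x} {y} y≥0 x≈±y with compare x 0# | x≈±y
  ... | tri≈ _ _ _   | inj₁ x≈y  = x≈y
  ... | tri> _ _ _   | inj₁ x≈y  = x≈y
  ... | tri< _ _ _   | inj₂ x≈-y = trans (-‿cong x≈-y) (-‿involutive y)
  ... | tri< x<0 _ _ | inj₁ x≈y  with y≥0
  ...   | inj₁ 0<y = contradiction (<-trans x<0 (proj₁ <-resp-≈ (sym x≈y) 0<y)) (irrefl refl)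
  ...   | inj₂ y≈0 = contradiction x<0 (irrefl (trans x≈y y≈0))
  abs-± {x} {y} y≥0 x≈±y | tri≈ _ x≈0 _ | inj₂ x≈-y = begin
    x       ≈⟨ trans x≈0 (sym -0#≈0#) ⟩
    - 0#    ≈⟨ -‿cong (trans (sym x≈0) x≈-y) ⟩
    - - y   ≈⟨ -‿involutive y ⟩
    y       ∎
  abs-± {x} {y} y≥0 x≈±y | tri> _ _ 0<x | inj₂ x≈-y with y≥0
  ... | inj₁ 0<y = contradiction
    (proj₁ <-resp-≈ (trans (+-congˡ x≈-y) (-‿inverseʳ y)) (+-positiveˡ 0<y (inj₁ 0<x))) (irrefl refl)
  ... | inj₂ y≈0 = contradiction 0<x (irrefl (sym (trans x≈-y (trans (-‿cong y≈0) -0#≈0#))))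

  fromℤ-± : ∀ z → fromℤ z ≈ ℤ.∣ z ∣ · 1# ⊎ fromℤ z ≈ - (ℤ.∣ z ∣ · 1#)
  fromℤ-± (+ n)    = inj₁ refl
  fromℤ-± -[1+ n ] = inj₂ refl

  fromℤ-^ : ∀ m n → fromℤ (+ (m ℕ.^ n)) ≈ fromℤ (+ m) ^ n
  fromℤ-^ m zero    = fromℤ-1
  fromℤ-^ m (suc n) = trans (×1-homo-* m (m ℕ.^ n)) (*-congˡ (fromℤ-^ m n))

  2ꟳ 4ꟳ : Carrier
  2ꟳ = fromℤ (+ 2)
  4ꟳ = fromℤ (+ 4)

  -- The exponent 1 - (k + 1) computes to `+ 0` for k = 0 and to a negative constructor otherwise.
  -- Only then is an inverse involved, of a power of 2 that is positive and therefore nonzero.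
  2^-inverse : ∀ k → 2ꟳ ^ℤ (+ 1 ℤ.- + suc k) * 2ꟳ ^ k ≈ 1#
  2^-inverse zero    = *-identityˡ _
  2^-inverse (suc k) = trans (*-comm _ _) (*-inverseʳ (>⇒≉ (^-positive (suc k) (+-positiveˡ 0<1 (ℕ-nonnegative 1)))))

  -- With d = k + 1 and r = d + s this reads 2^(1-d) 4^(r-1) = 2^(d-1) 4^(r-d): the shape of the
  -- statement against the one produced by lattice index and contraction.
  rescale : ∀ k s p → 2ꟳ ^ℤ (+ 1 ℤ.- + suc k) * (4ꟳ ^ℤ (+ (suc k ℕ.+ s) ℤ.- + 1) * p) ≈ 2ꟳ ^ k * (4ꟳ ^ s * p)
  rescale k s p = begin
    u * (4ꟳ ^ (k ℕ.+ s) * p)              ≈⟨ *-congˡ (*-congʳ (^-homo-* 4ꟳ k s)) ⟩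
    u * (4ꟳ ^ k * 4ꟳ ^ s * p)             ≈⟨ *-congˡ (*-assoc _ _ _) ⟩
    u * (4ꟳ ^ k * q) ≈⟨ *-congˡ (*-congʳ (trans (^-cong k (×1-homo-* 2 2)) (^-distrib-* 2ꟳ 2ꟳ k))) ⟩
    u * (2ꟳ ^ k * 2ꟳ ^ k * q)             ≈⟨ *-congˡ (*-assoc _ _ _) ⟩
    u * (2ꟳ ^ k * (2ꟳ ^ k * q))           ≈⟨ *-assoc _ _ _ ⟨
    u * 2ꟳ ^ k * (2ꟳ ^ k * q)             ≈⟨ *-congʳ (2^-inverse k) ⟩
    1# * (2ꟳ ^ k * q)                     ≈⟨ *-identityˡ _ ⟩
    2ꟳ ^ k * q                            ∎
    where
    u = 2ꟳ ^ℤ (+ 1 ℤ.- + suc k)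
    q = 4ꟳ ^ s * p
    ^-cong : ∀ {x y} n → x ≈ y → x ^ n ≈ y ^ n
    ^-cong zero    x≈y = refl
    ^-cong (suc n) x≈y = *-cong x≈y (^-cong n x≈y)

-- Deletion and contraction

module GramMatrices {c ℓ} (R : CommutativeRing c ℓ) where
  open CommutativeRing R hiding (zero)
  open Determinant R
  open Algebra.Properties.CommutativeSemigroup *-commutativeSemigroup using (x∙yz≈y∙xz)
  open Algebra.Properties.Semiring.Sum semiring
  open Relation.Binary.Reasoning.Setoid setoid

  gram : ∀ {m n} → Vector Carrier m → Matrix m n → Matrix n n
  gram x b v w = sum λ e → b e v * (x e * b e w)

  gram-cong : ∀ {m n} (x : Vector Carrier m) {b b′ : Matrix m n} → b ≋ b′ → gram x b ≋ gram x b′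
  gram-cong x b≋b′ v w = sum-cong-≋ λ e → *-cong (b≋b′ e v) (*-congˡ {x = x e} (b≋b′ e w))

  gram-drop : ∀ {m n} (x : Vector Carrier (suc m)) (b : Matrix (suc m) n) →
              (∀ v w → b zero v * (x zero * b zero w) ≈ 0#) → gram x b ≋ gram (x ∘ suc) (b ∘ suc)
  gram-drop x b b₀≈0 v w = trans (+-congʳ (b₀≈0 v w)) (+-identityˡ _)

  gram-conjugate : ∀ {m n} (U : Matrix n n) (x : Vector Carrier m) (b b′ : Matrix m n) →
                   (∀ e v → sum (λ d → U v d * b e d) ≈ b′ e v) →
                   (U ⊗ gram x b) ⊗ (λ d w → U w d) ≋ gram x b′
  gram-conjugate {m} {n} U x b b′ Ub≈b′ v w = begin
    ((U ⊗ gram x b) ⊗ Uᵀ) v w ≈⟨ ⊗-cong {N = Uᵀ} {N′ = Uᵀ} (λ i j → sym (⊗-assoc U bᵀ xb i j)) (λ _ _ → refl) v w ⟩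
    (((U ⊗ bᵀ) ⊗ xb) ⊗ Uᵀ) v w   ≈⟨ ⊗-assoc (U ⊗ bᵀ) xb Uᵀ v w ⟩
    ((U ⊗ bᵀ) ⊗ (xb ⊗ Uᵀ)) v w   ≈⟨ sum-cong-≋ (λ e → *-cong (Ub≈b′ e v) (right e)) ⟩
    gram x b′ v w                ∎
    where
    bᵀ : Matrix n m
    bᵀ v e = b e v
    xb : Matrix m n
    xb e w = x e * b e w
    Uᵀ : Matrix n n
    Uᵀ d w = U w d
    right : ∀ e → (xb ⊗ Uᵀ) e w ≈ x e * b′ e w
    right e = begin
      sum (λ d → (x e * b e d) * U w d) ≈⟨ sum-cong-≋ (λ d → trans (*-assoc (x e) _ _) (*-congˡ (*-comm (b e d) (U w d)))) ⟩
      sum (λ d → x e * (U w d * b e d))   ≈⟨ *-distribˡ-sum (x e) (λ d → U w d * b e d) ⟨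
      x e * sum (λ d → U w d * b e d)     ≈⟨ *-congˡ (Ub≈b′ e w) ⟩
      x e * b′ e w                        ∎

  -- The image of `v` in the quotient that identifies the `i`-th unit vector with `t`.
  eliminate : ∀ {k} → Fin (suc k) → Vector Carrier k → Vector Carrier (suc k) → Vector Carrier k
  eliminate i t v j = v (punchIn i j) + t j * v i

  -- Deletion and contraction: the unimodular substitution sending b₀ to a
  -- multiple of the first basis vector confines the first summand of the
  -- Gram matrix to its corner entry.
  det-gram : ∀ {m k} (x : Vector Carrier (suc m)) (b : Matrix (suc m) (suc k)) i t →
             (∀ j → eliminate i t (b zero) j ≈ 0#) →
             det (gram x b) ≈ det (gram (x ∘ suc) (b ∘ suc))
               + b zero i * (x zero * b zero i) * det (gram (x ∘ suc) (eliminate i t ∘ b ∘ suc))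
  det-gram {m} {k} x b i t elim≈0 = begin
    det (gram x b)                        ≈⟨ conjugation x b ⟨
    det G                                 ≈⟨ linear det-alternating zero 1# s {G} {G′} {E}
                                               (λ { zero z → contradiction ≡.refl z ; (suc v) _ w → row v w })
                                               (λ { zero z → contradiction ≡.refl z ; (suc v) _ w → row v w })
                                               first ⟩
    1# * det G′ + s * det E ≈⟨ +-cong (trans (*-identityˡ _) (conjugation (x ∘ suc) (b ∘ suc))) (*-congˡ det-E) ⟩
    det (gram (x ∘ suc) (b ∘ suc)) + s * det (gram (x ∘ suc) (eliminate i t ∘ b ∘ suc)) ∎
    where
    open Alternating
    U : Matrix (suc k) (suc k)
    U = δ i ∷ λ j a → δ (punchIn i j) a + t j * δ i a
    transformed : ∀ {m} → Matrix m (suc k) → Matrix m (suc k)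
    transformed b e = b e i ∷ eliminate i t (b e)
    U-transforms : ∀ {m} (b : Matrix m (suc k)) e v → sum (λ d → U v d * b e d) ≈ transformed b e v
    U-transforms b e zero    = sum-δˡ i (b e)
    U-transforms b e (suc j) = begin
      sum (λ d → (δ (punchIn i j) d + t j * δ i d) * b e d)
        ≈⟨ sum-cong-≋ (λ d → trans (distribʳ (b e d) (δ (punchIn i j) d) (t j * δ i d)) (+-congˡ (*-assoc (t j) (δ i d) (b e d)))) ⟩
      sum (λ d → δ (punchIn i j) d * b e d + t j * (δ i d * b e d))
        ≈⟨ ∑-distrib-+ (λ d → δ (punchIn i j) d * b e d) (λ d → t j * (δ i d * b e d)) ⟩
      sum (λ d → δ (punchIn i j) d * b e d) + sum (λ d → t j * (δ i d * b e d))
        ≈⟨ +-cong (sum-δˡ (punchIn i j) (b e)) (trans (sym (*-distribˡ-sum (t j) (λ d → δ i d * b e d))) (*-congˡ (sum-δˡ i (b e)))) ⟩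
      b e (punchIn i j) + t j * b e i ∎
    -- Without row zero and column `i` the matrix is the identity. The sign is harmless, since the
    -- conjugation uses `U` twice.
    det-U : det U ≈ sign i
    det-U = begin
      det U       ≈⟨ sum-only i {λ j → sign j * (δ i j * det (minor zero j U))} (λ j j≢i →
                       trans (*-congˡ (trans (*-congʳ (reflexive (δ-≢ (j≢i ∘ ≡.sym)))) (zeroˡ _))) (zeroʳ (sign j))) ⟩
      sign i * (δ i i * det (minor zero i U)) ≈⟨ *-congˡ (*-cong (reflexive (δ-refl i)) (trans (det-cong {k} corner) (det-δ {k}))) ⟩
      sign i * (1# * 1#)                      ≈⟨ trans (*-congˡ (*-identityˡ 1#)) (*-identityʳ _) ⟩
      sign i                                  ∎
      where
      corner : minor zero i U ≋ δ
      corner j l = begin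
        δ (punchIn i j) (punchIn i l) + t j * δ i (punchIn i l)
          ≡⟨ ≡.cong₂ (λ u v → u + t j * v) (δ-injective (punchIn i) (punchIn-injective i _ _) j l) (δ-≢ (punchInᵢ≢i i l ∘ ≡.sym)) ⟩
        δ j l + t j * 0#  ≈⟨ trans (+-congˡ (zeroʳ _)) (+-identityʳ _) ⟩
        δ j l             ∎
    conjugation : ∀ {m} (x : Vector Carrier m) (b : Matrix m (suc k)) → det (gram x (transformed b)) ≈ det (gram x b)
    conjugation x b = begin
      det (gram x (transformed b)) ≈⟨ det-cong (gram-conjugate U x b (transformed b) (U-transforms b)) ⟨
      det ((U ⊗ gram x b) ⊗ (λ d w → U w d))             ≈⟨ det-⊗ (U ⊗ gram x b) (λ d w → U w d) ⟩
      det (U ⊗ gram x b) * det (λ d w → U w d) ≈⟨ *-cong (det-⊗ U (gram x b)) (det-transpose U) ⟩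
      (det U * det (gram x b)) * det U ≈⟨ trans (*-comm _ _) (sym (*-assoc _ _ _)) ⟩
      (det U * det U) * det (gram x b) ≈⟨ *-congʳ (trans (*-cong det-U det-U) (sign² i)) ⟩
      1# * det (gram x b)                                ≈⟨ *-identityˡ _ ⟩
      det (gram x b)                                     ∎
    s = b zero i * (x zero * b zero i)
    G G′ E : Matrix (suc k) (suc k)
    G  = gram x (transformed b)
    G′ = gram (x ∘ suc) (transformed (b ∘ suc))
    E  = δ zero ∷ (G′ ∘ suc)
    row : ∀ v w → G (suc v) w ≈ G′ (suc v) w
    row v w = trans (+-congʳ (trans (*-congʳ (elim≈0 v)) (zeroˡ _))) (+-identityˡ _)
    first : ∀ w → G zero w ≈ 1# * G′ zero w + s * δ zero w
    first zero    = trans (+-comm _ _) (+-cong (sym (*-identityˡ _)) (sym (*-identityʳ _)))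
    first (suc w) = trans (+-comm _ _) (+-cong (sym (*-identityˡ _))
      (trans (*-congˡ (trans (*-congˡ (elim≈0 w)) (zeroʳ _))) (trans (zeroʳ _) (sym (zeroʳ s)))))
    det-E : det E ≈ det (gram (x ∘ suc) (eliminate i t ∘ b ∘ suc))
    det-E = begin
      det E ≈⟨ sum-only zero {λ j → sign j * (δ zero j * det (minor zero j E))}
         (λ { zero z → contradiction ≡.refl z ; (suc j) _ → trans (*-congˡ (zeroˡ _)) (zeroʳ (sign (suc j))) }) ⟩
      1# * (1# * det (minor zero zero E)) ≈⟨ trans (*-identityˡ _) (*-identityˡ _) ⟩
      det (gram (x ∘ suc) (eliminate i t ∘ b ∘ suc)) ∎

-- The vectors 0, e_i and - e_i as data. Contraction maps such vectors to such vectors, and a row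
-- can be classified by comparing the labels of its two ends.
data Label (k : ℕ) : Set where
  nil     : Label k
  pos neg : Fin k → Label k

opposite : ∀ {k} → Label k → Label k
opposite nil     = nil
opposite (pos i) = neg i
opposite (neg i) = pos i

opposite-involutive : ∀ {k} (a : Label k) → opposite (opposite a) ≡ a
opposite-involutive nil     = ≡.refl
opposite-involutive (pos i) = ≡.refl
opposite-involutive (neg i) = ≡.refl

⟦_⟧ : ∀ {k} → Label k → Vector ℤ k
⟦ nil   ⟧ j = + 0
⟦ pos i ⟧ j = ℤ-Det.δ i j
⟦ neg i ⟧ j = ℤ.- ℤ-Det.δ i j

⟦opposite⟧ : ∀ {k} (a : Label k) j → ⟦ opposite a ⟧ j ≡ ℤ.- ⟦ a ⟧ j
⟦opposite⟧ nil     j = ≡.refl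
⟦opposite⟧ (pos i) j = ≡.refl
⟦opposite⟧ (neg i) j = ≡.sym (ℤ.neg-involutive _)

contract : ∀ {k} → Fin (suc k) → Label k → Label (suc k) → Label k
contract i t nil = nil
contract i t (pos a) with i ≟ a
... | yes _  = t
... | no i≢a = pos (punchOut i≢a)
contract i t (neg a) with i ≟ a
... | yes _  = opposite t
... | no i≢a = neg (punchOut i≢a)

-- Ties the combinatorial recursion to the determinant: replacing e_i by `t` and renumbering the
-- labels is `eliminate` on their vectors.
⟦contract⟧ : ∀ {k} i (t : Label k) a j →
             ⟦ contract i t a ⟧ j ≡ ⟦ a ⟧ (punchIn i j) ℤ.+ ⟦ t ⟧ j ℤ.* ⟦ a ⟧ i
⟦contract⟧ i t nil     j = ≡.sym (≡.trans (ℤ.+-identityˡ _) (ℤ.*-zeroʳ (⟦ t ⟧ j)))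
⟦contract⟧ i t (pos a) j with i ≟ a
... | yes ≡.refl rewrite ℤ-Det.δ-refl i | ℤ-Det.δ-≢ (punchInᵢ≢i i j ∘ ≡.sym) =
  ≡.sym (≡.trans (ℤ.+-identityˡ _) (ℤ.*-identityʳ _))
... | no i≢a rewrite ℤ-Det.δ-≢ (i≢a ∘ ≡.sym) = ≡.sym (≡.trans (≡.cong (λ u → ℤ-Det.δ a (punchIn i j) ℤ.+ u) (ℤ.*-zeroʳ (⟦ t ⟧ j))) (≡.trans (ℤ.+-identityʳ _)
  (≡.trans (≡.cong (λ b → ℤ-Det.δ b (punchIn i j)) (≡.sym (punchIn-punchOut i≢a))) (ℤ-Det.δ-injective (punchIn i) (punchIn-injective i _ _) _ _))))
⟦contract⟧ i t (neg a) j with i ≟ a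
... | yes ≡.refl rewrite ℤ-Det.δ-refl i | ℤ-Det.δ-≢ (punchInᵢ≢i i j ∘ ≡.sym) =
  ≡.trans (⟦opposite⟧ t j) (≡.sym (≡.trans (ℤ.+-identityˡ _) (≡.trans (ℤ.*-comm (⟦ t ⟧ j) (ℤ.- + 1)) (ℤ.-1*i≡-i _))))
... | no i≢a rewrite ℤ-Det.δ-≢ (i≢a ∘ ≡.sym) = ≡.sym (≡.trans (≡.cong (λ u → ℤ.- ℤ-Det.δ a (punchIn i j) ℤ.+ u) (ℤ.*-zeroʳ (⟦ t ⟧ j))) (≡.trans (ℤ.+-identityʳ _)
  (≡.cong ℤ.-_ (≡.trans (≡.cong (λ b → ℤ-Det.δ b (punchIn i j)) (≡.sym (punchIn-punchOut i≢a))) (ℤ-Det.δ-injective (punchIn i) (punchIn-injective i _ _) _ _)))))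

At : ∀ {k} → Fin k → Label k → Set
At i a = a ≡ pos i ⊎ a ≡ neg i

-- A coordinate `i` at which a - b has the entry ±1 (`single`) or ±2 (`double`). It is attached to
-- the first label; the reversed pair serves when the first label is `nil`.
data Pivot : ∀ {k} → Label k → Label k → Set where
  single : ∀ {k} {a b : Label (suc k)} i → At i a → ¬ At i b → Pivot a b
  double : ∀ {k} {a b : Label (suc k)} i → At i a → b ≡ opposite a → Pivot a b

at? : ∀ {k} (i : Fin k) (a : Label k) → At i a ⊎ ¬ At i a
at? i nil = inj₂ λ { (inj₁ ()) ; (inj₂ ()) }
at? i (pos a) with a ≟ i
... | yes ≡.refl = inj₁ (inj₁ ≡.refl)
... | no a≢i     = inj₂ λ { (inj₁ ≡.refl) → a≢i ≡.refl ; (inj₂ ()) }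
at? i (neg a) with a ≟ i
... | yes ≡.refl = inj₁ (inj₂ ≡.refl)
... | no a≢i     = inj₂ λ { (inj₂ ≡.refl) → a≢i ≡.refl ; (inj₁ ()) }

at-both : ∀ {k} {i : Fin k} {a b : Label k} → At i a → At i b → a ≡ b ⊎ b ≡ opposite a
at-both (inj₁ ≡.refl) (inj₁ ≡.refl) = inj₁ ≡.refl
at-both (inj₁ ≡.refl) (inj₂ ≡.refl) = inj₂ ≡.refl
at-both (inj₂ ≡.refl) (inj₁ ≡.refl) = inj₂ ≡.refl
at-both (inj₂ ≡.refl) (inj₂ ≡.refl) = inj₁ ≡.refl

at-position : ∀ {k} (a : Label k) → a ≡ nil ⊎ ∃ λ i → At i a
at-position nil     = inj₁ ≡.refl
at-position (pos i) = inj₂ (i , inj₁ ≡.refl)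
at-position (neg i) = inj₂ (i , inj₂ ≡.refl)

classify : ∀ {k} (a b : Label k) → a ≡ b ⊎ Pivot a b ⊎ Pivot b a
classify {zero} nil nil = inj₁ ≡.refl
classify {suc k} a b with at-position a | at-position b
... | inj₁ ≡.refl   | inj₁ ≡.refl     = inj₁ ≡.refl
... | inj₁ ≡.refl   | inj₂ (i , at-b) = inj₂ (inj₂ (single i at-b λ { (inj₁ ()) ; (inj₂ ()) }))
... | inj₂ (i , at-a) | _ with at? i b
...   | inj₂ ¬at = inj₂ (inj₁ (single i at-a ¬at))
...   | inj₁ at-b with at-both at-a at-b
...     | inj₁ a≡b = inj₁ a≡b
...     | inj₂ opp = inj₂ (inj₁ (double i at-a opp))

pivot-at : ∀ {k} {a b : Label (suc k)} → Pivot a b → Fin (suc k)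
pivot-at (single i _ _) = i
pivot-at (double i _ _) = i

-- The value of e_i that gives both ends the same label: the other end, with the sign of `a`, or 0
-- where e_i = - e_i is imposed. The `nil` in `contract i nil b` is a dummy, because `b` does not
-- involve `i`.
target : ∀ {k} {a b : Label (suc k)} → Pivot a b → Label k
target {b = b} (single i (inj₁ _) _) = contract i nil b
target {b = b} (single i (inj₂ _) _) = opposite (contract i nil b)
target (double _ _ _) = nil

quotient : ∀ {k} {a b : Label (suc k)} → Pivot a b → Label (suc k) → Label k
quotient p = contract (pivot-at p) (target p)

multiplicity : ∀ {k} {a b : Label k} → Pivot a b → ℕ
multiplicity (single _ _ _) = 0
multiplicity (double _ _ _) = 1

contract-pos : ∀ {k} i (t : Label k) → contract i t (pos i) ≡ t
contract-pos i t with i ≟ i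
... | yes _  = ≡.refl
... | no i≢i = contradiction ≡.refl i≢i

contract-neg : ∀ {k} i (t : Label k) → contract i t (neg i) ≡ opposite t
contract-neg i t with i ≟ i
... | yes _  = ≡.refl
... | no i≢i = contradiction ≡.refl i≢i

contract-¬at : ∀ {k} i (t t′ : Label k) a → ¬ At i a → contract i t a ≡ contract i t′ a
contract-¬at i t t′ nil     ¬at = ≡.refl
contract-¬at i t t′ (pos a) ¬at with i ≟ a
... | yes ≡.refl = contradiction (inj₁ ≡.refl) ¬at
... | no _       = ≡.refl
contract-¬at i t t′ (neg a) ¬at with i ≟ a
... | yes ≡.refl = contradiction (inj₂ ≡.refl) ¬at
... | no _       = ≡.refl

quotient-merges : ∀ {k} {a b : Label (suc k)} (p : Pivot a b) → quotient p a ≡ quotient p b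
quotient-merges {b = b} p@(single i (inj₁ ≡.refl) ¬at) =
  ≡.trans (contract-pos i _) (contract-¬at i nil (target p) b ¬at)
quotient-merges {b = b} p@(single i (inj₂ ≡.refl) ¬at) =
  ≡.trans (contract-neg i _) (≡.trans (opposite-involutive _) (contract-¬at i nil (target p) b ¬at))
quotient-merges (double i (inj₁ ≡.refl) ≡.refl) = ≡.trans (contract-pos i nil) (≡.sym (contract-neg i nil))
quotient-merges (double i (inj₂ ≡.refl) ≡.refl) = ≡.trans (contract-neg i nil) (≡.sym (contract-pos i nil))

difference : ∀ {k} → Label k → Label k → Vector ℤ k
difference a b j = ⟦ a ⟧ j ℤ.- ⟦ b ⟧ j

¬at⇒0 : ∀ {k} i (b : Label k) → ¬ At i b → ⟦ b ⟧ i ≡ + 0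
¬at⇒0 i nil     ¬at = ≡.refl
¬at⇒0 i (pos j) ¬at = ℤ-Det.δ-≢ {i = j} λ { ≡.refl → ¬at (inj₁ ≡.refl) }
¬at⇒0 i (neg j) ¬at = ≡.cong ℤ.-_ (ℤ-Det.δ-≢ {i = j} λ { ≡.refl → ¬at (inj₂ ≡.refl) })

-- The only source of the factor 4: pivot entries are ±1 or ±2 and enter the Gram determinant
-- squared.
difference-pivot : ∀ {k} {a b : Label (suc k)} (p : Pivot a b) → let x = difference a b (pivot-at p) in
                   x ℤ.* x ≡ + (4 ℕ.^ multiplicity p)
difference-pivot {b = b} (single i (inj₁ ≡.refl) ¬at) rewrite ℤ-Det.δ-refl i | ¬at⇒0 i b ¬at = ≡.refl
difference-pivot {b = b} (single i (inj₂ ≡.refl) ¬at) rewrite ℤ-Det.δ-refl i | ¬at⇒0 i b ¬at = ≡.refl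
difference-pivot (double i (inj₁ ≡.refl) ≡.refl) rewrite ℤ-Det.δ-refl i = ≡.refl
difference-pivot (double i (inj₂ ≡.refl) ≡.refl) rewrite ℤ-Det.δ-refl i = ≡.refl

difference-contract : ∀ {k} i (t : Label k) a b j →
  difference a b (punchIn i j) ℤ.+ ⟦ t ⟧ j ℤ.* difference a b i ≡ difference (contract i t a) (contract i t b) j
difference-contract i t a b j = ≡.trans
  (regroup (⟦ a ⟧ (punchIn i j)) (⟦ b ⟧ (punchIn i j)) (⟦ t ⟧ j) (⟦ a ⟧ i) (⟦ b ⟧ i))
  (≡.sym (≡.cong₂ ℤ._-_ (⟦contract⟧ i t a j) (⟦contract⟧ i t b j)))
  where
  regroup : ∀ a b t c d → (a ℤ.- b) ℤ.+ t ℤ.* (c ℤ.- d) ≡ (a ℤ.+ t ℤ.* c) ℤ.- (b ℤ.+ t ℤ.* d)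
  regroup = ℤ-Solver.solve-∀

-- The edges outside F are contracted one after the other; the result is the
-- exponent of 4 in the squared minor of the incidence matrix they span, or
-- nothing if that minor vanishes.
module Contraction {E X : Set} (source sink : E → X) (live : E → Bool) where

  -- Without edges the Laplacian is the zero matrix of size `k`, whose determinant is 1 for k = 0
  -- and vanishes otherwise.
  terminal : ℕ → Maybe ℕ
  terminal zero    = just 0
  terminal (suc k) = nothing

  exponent : ∀ {k j} → (X → Label k) → Vector E j → Subset j → Maybe ℕ
  exponent-step : ∀ {k j} (ρ : X → Label k) (e : E) (es : Vector E j) → Subset j →
                  let a = ρ (source e) ; b = ρ (sink e) in a ≡ b ⊎ Pivot a b ⊎ Pivot b a → Maybe ℕ
  contraction : ∀ {k j} (ρ : X → Label k) {a b : Label k} → Vector E j → Subset j → Pivot a b → Maybe ℕ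

  exponent {k} ρ es Vec.[] = terminal k
  -- A dilated edge disqualifies a set that contains it; outside the set it is passed over.
  exponent ρ es (inside Vec.∷ F) = if live (es zero) then exponent ρ (es ∘ suc) F else nothing
  exponent ρ es (outside Vec.∷ F) = if live (es zero)
    then exponent-step ρ (es zero) (es ∘ suc) F (classify (ρ (source (es zero))) (ρ (sink (es zero))))
    else exponent ρ (es ∘ suc) F

  exponent-step ρ e es F (inj₁ _)        = nothing
  exponent-step ρ e es F (inj₂ (inj₁ p)) = contraction ρ es F p
  exponent-step ρ e es F (inj₂ (inj₂ p)) = contraction ρ es F p

  contraction {suc k} ρ es F p = Maybe.map (multiplicity p ℕ.+_) (exponent (quotient p ∘ ρ) es F)

module LabelledLaplacian {c ℓ₁ ℓ₂} (𝔽 : OrderedField c ℓ₁ ℓ₂) {E X : Set}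
  (source sink : E → X) (live : E → Bool)
  (l l⁻¹ : E → OrderedField.Carrier 𝔽)
  (l-inverse : ∀ e → OrderedField._≈_ 𝔽 (OrderedField._*_ 𝔽 (l e) (l⁻¹ e)) (OrderedField.1# 𝔽)) where
  open OrderedField 𝔽 hiding (det)
  open OrderedFieldProperties 𝔽
  open Determinant commutativeRing hiding (_≋_)
  open GramMatrices commutativeRing
  open Contraction source sink live
  open CommutativeRing commutativeRing using (refl; sym; trans)
  open Algebra.Properties.Ring ring using (-‿distribˡ-*; -‿distribʳ-*; -‿involutive)
  open Algebra.Properties.CommutativeSemigroup *-commutativeSemigroup using (x∙yz≈y∙xz; interchange)
  open Algebra.Properties.Semiring.Sum semiring using (sum-cong-≋)
  open Relation.Binary.Reasoning.Setoid setoid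

  incidence : ∀ {k} → (X → Label k) → E → Vector Carrier k
  incidence ρ e v = fromℤ (difference (ρ (source e)) (ρ (sink e)) v)

  -- Dilated edges stay in the list with the neutral values 1 and 0, so that the expansion runs over
  -- subsets of all edges, as the sum over ogods does.
  volume conductance : E → Carrier
  volume e      = if live e then l e else 1#
  conductance e = if live e then l⁻¹ e else 0#

  laplacian : ∀ {k j} → (X → Label k) → Vector E j → Matrix k k
  laplacian ρ es = gram (conductance ∘ es) (incidence ρ ∘ es)

  weight : Maybe ℕ → Carrier
  weight nothing  = 0#
  weight (just s) = 4ꟳ ^ s

  weight-map : ∀ m s → weight (Maybe.map (m ℕ.+_) s) ≈ fromℤ (+ (4 ℕ.^ m)) * weight s
  weight-map m nothing  = sym (zeroʳ _)
  weight-map m (just s) = trans (^-homo-* 4ꟳ m s) (*-congʳ (sym (fromℤ-^ 4 m)))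
    where open import Algebra.Properties.Semiring.Exp semiring using (^-homo-*)

  ∑ₗ-cong : ∀ {a} {A : Set a} (xs : List A) {f g : A → Carrier} → (∀ x → f x ≈ g x) → ∑ₗ xs f ≈ ∑ₗ xs g
  ∑ₗ-cong List.[]       f≈g = refl
  ∑ₗ-cong (x List.∷ xs) f≈g = +-cong (f≈g x) (∑ₗ-cong xs f≈g)

  ∑ₗ-++ : ∀ {a} {A : Set a} (xs ys : List A) (f : A → Carrier) → ∑ₗ (xs List.++ ys) f ≈ ∑ₗ xs f + ∑ₗ ys f
  ∑ₗ-++ List.[]       ys f = sym (+-identityˡ _)
  ∑ₗ-++ (x List.∷ xs) ys f = trans (+-congˡ (∑ₗ-++ xs ys f)) (sym (+-assoc _ _ _))

  ∑ₗ-map : ∀ {a b} {A : Set a} {B : Set b} (g : A → B) (xs : List A) (f : B → Carrier) →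
           ∑ₗ (List.map g xs) f ≈ ∑ₗ xs (f ∘ g)
  ∑ₗ-map g List.[]       f = refl
  ∑ₗ-map g (x List.∷ xs) f = +-congˡ (∑ₗ-map g xs f)

  *-distribˡ-∑ₗ : ∀ {a} {A : Set a} y (xs : List A) (f : A → Carrier) → y * ∑ₗ xs f ≈ ∑ₗ xs (λ x → y * f x)
  *-distribˡ-∑ₗ y List.[]       f = zeroʳ y
  *-distribˡ-∑ₗ y (x List.∷ xs) f = trans (distribˡ y _ _) (+-congˡ (*-distribˡ-∑ₗ y xs f))

  ∑ₗ-zero : ∀ {a} {A : Set a} (xs : List A) {f : A → Carrier} → (∀ x → f x ≈ 0#) → ∑ₗ xs f ≈ 0#
  ∑ₗ-zero List.[]       f≈0 = refl
  ∑ₗ-zero (x List.∷ xs) f≈0 = trans (+-cong (f≈0 x) (∑ₗ-zero xs f≈0)) (+-identityˡ _)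

  lengths : ∀ {j} → Vector E j → Subset j → Carrier
  lengths es F = ∏ (λ i → i ∈? F) (l ∘ es)

  term : ∀ {k j} → (X → Label k) → Vector E j → Subset j → Carrier
  term ρ es F = weight (exponent ρ es F) * lengths es F

  LaplacianExpansion : ∀ {k j} → (X → Label k) → Vector E j → Set ℓ₁
  LaplacianExpansion {j = j} ρ es =
    product (volume ∘ es) * det (laplacian ρ es) ≈ ∑ₗ (subsets j) (term ρ es)

  -- The product of the lengths clears the denominators: a deleted edge keeps its factor ℓ(e),
  -- whereas for a contracted edge ℓ(e) cancels against the weight ℓ(e)⁻¹ of the squared pivot.
  laplacian-expansion : ∀ {k} j (ρ : X → Label k) (es : Vector E j) → LaplacianExpansion ρ es
  laplacian-expansion {zero}  zero ρ es = sym (+-identityʳ _)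
  laplacian-expansion {suc k} zero ρ es = begin
    1# * det (laplacian ρ es)   ≈⟨ *-identityˡ _ ⟩
    det (laplacian ρ es) ≈⟨ sum-zero (λ j → trans (*-congˡ (zeroˡ (det (minor zero j (laplacian ρ es))))) (zeroʳ (sign j))) ⟩
    0#                          ≈⟨ trans (+-identityʳ _) (zeroˡ _) ⟨
    0# * 1# + 0#                ∎
  laplacian-expansion {k} (suc j) ρ es = begin
    product (volume ∘ es) * det (laplacian ρ es)                      ≈⟨ cases ⟩
    ∑ₗ (subsets j) (term ρ es ∘ (outside Vec.∷_)) + ∑ₗ (subsets j) (term ρ es ∘ (inside Vec.∷_))
      ≈⟨ +-cong (∑ₗ-map (outside Vec.∷_) (subsets j) (term ρ es)) (∑ₗ-map (inside Vec.∷_) (subsets j) (term ρ es)) ⟨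
    ∑ₗ (List.map (outside Vec.∷_) (subsets j)) (term ρ es) + ∑ₗ (List.map (inside Vec.∷_) (subsets j)) (term ρ es)
      ≈⟨ ∑ₗ-++ (List.map (outside Vec.∷_) (subsets j)) _ (term ρ es) ⟨
    ∑ₗ (subsets (suc j)) (term ρ es)                                  ∎
    where
    e = es zero
    es′ = es ∘ suc
    Π′ = product (volume ∘ es′)
    a = ρ (source e)
    b = ρ (sink e)
    rest : product (volume ∘ es′) * det (laplacian ρ es′) ≈ ∑ₗ (subsets j) (term ρ es′)
    rest = laplacian-expansion j ρ es′
    -- The row is compared with a - b only through products of two entries, so it may differ by a
    -- sign. This covers pivots that sit at the sink.
    contracted : ∀ {k} (ρ : X → Label k) {a b : Label k} (p : Pivot a b) →
      (∀ v w → incidence ρ e v * (l⁻¹ e * incidence ρ e w) ≈ fromℤ (difference a b v) * (l⁻¹ e * fromℤ (difference a b w))) →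
      (l e * Π′) * det (gram (l⁻¹ e ∷ conductance ∘ es′) (incidence ρ ∘ es))
        ≈ ∑ₗ (subsets j) (λ F → weight (contraction ρ es′ F p) * (1# * lengths es′ F))
          + l e * (Π′ * det (laplacian ρ es′))
    contracted {suc k} ρ {a} {b} p same = begin
      (l e * Π′) * det (gram x (incidence ρ ∘ es)) ≈⟨ *-congˡ (det-cong {M = gram x (incidence ρ ∘ es)} {gram x d} λ v w → +-congʳ {x = N v w} (same v w)) ⟩
      (l e * Π′) * det (gram x d)                         ≈⟨ *-congˡ (det-gram x d i t null) ⟩
      (l e * Π′) * (det N + c² * det N/)                  ≈⟨ trans (distribˡ _ _ _) (+-comm _ _) ⟩
      (l e * Π′) * (c² * det N/) + (l e * Π′) * det N     ≈⟨ +-cong left (*-assoc _ _ _) ⟩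
      ∑ₗ (subsets j) (λ F → weight (contraction ρ es′ F p) * (1# * lengths es′ F)) + l e * (Π′ * det N) ∎
      where
      i = pivot-at p
      t : Vector Carrier k
      t = fromℤ ∘ ⟦ target p ⟧
      x = l⁻¹ e ∷ conductance ∘ es′
      d : Matrix (suc j) (suc k)
      d = (fromℤ ∘ difference a b) ∷ incidence ρ ∘ es′
      N = laplacian ρ es′
      m = fromℤ (+ (4 ℕ.^ multiplicity p))
      N/ = gram (conductance ∘ es′) (eliminate i t ∘ incidence ρ ∘ es′)
      c² = fromℤ (difference a b i) * (l⁻¹ e * fromℤ (difference a b i))
      eliminate-difference : ∀ a b j → eliminate i t (fromℤ ∘ difference a b) j ≈ fromℤ (difference (quotient p a) (quotient p b) j)
      eliminate-difference a b j = begin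
        fromℤ (difference a b (punchIn i j)) + fromℤ (⟦ target p ⟧ j) * fromℤ (difference a b i)
          ≈⟨ +-congˡ (fromℤ-* (⟦ target p ⟧ j) (difference a b i)) ⟨
        fromℤ (difference a b (punchIn i j)) + fromℤ (⟦ target p ⟧ j ℤ.* difference a b i)
          ≈⟨ fromℤ-+ (difference a b (punchIn i j)) (⟦ target p ⟧ j ℤ.* difference a b i) ⟨
        fromℤ (difference a b (punchIn i j) ℤ.+ ⟦ target p ⟧ j ℤ.* difference a b i)
          ≡⟨ ≡.cong fromℤ (difference-contract i (target p) a b j) ⟩
        fromℤ (difference (quotient p a) (quotient p b) j) ∎
      null : ∀ j → eliminate i t (fromℤ ∘ difference a b) j ≈ 0#
      null j = trans (eliminate-difference a b j) (reflexive (≡.cong fromℤ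
        (≡.trans (≡.cong (λ u → ⟦ u ⟧ j ℤ.- ⟦ quotient p b ⟧ j) (quotient-merges p)) (ℤ.+-inverseʳ (⟦ quotient p b ⟧ j)))))
      c²-value : l e * c² ≈ m
      c²-value = begin
        l e * (f * (l⁻¹ e * f))   ≈⟨ *-congˡ (x∙yz≈y∙xz f (l⁻¹ e) f) ⟩
        l e * (l⁻¹ e * (f * f))   ≈⟨ *-assoc _ _ _ ⟨
        (l e * l⁻¹ e) * (f * f)   ≈⟨ trans (*-congʳ (l-inverse e)) (*-identityˡ _) ⟩
        f * f                     ≈⟨ fromℤ-* (difference a b i) (difference a b i) ⟨
        fromℤ (difference a b i ℤ.* difference a b i) ≡⟨ ≡.cong fromℤ (difference-pivot p) ⟩
        m                         ∎
        where f = fromℤ (difference a b i)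
      left : (l e * Π′) * (c² * det N/) ≈ ∑ₗ (subsets j) (λ F → weight (contraction ρ es′ F p) * (1# * lengths es′ F))
      left = begin
        (l e * Π′) * (c² * det N/)      ≈⟨ interchange (l e) Π′ c² (det N/) ⟩
        (l e * c²) * (Π′ * det N/) ≈⟨ *-cong c²-value (*-congˡ (det-cong (gram-cong (conductance ∘ es′)
              λ f v → eliminate-difference (ρ (source (es′ f))) (ρ (sink (es′ f))) v))) ⟩
        m * (Π′ * det (laplacian (quotient p ∘ ρ) es′)) ≈⟨ *-congˡ (laplacian-expansion j (quotient p ∘ ρ) es′) ⟩
        m * ∑ₗ (subsets j) (term (quotient p ∘ ρ) es′)  ≈⟨ *-distribˡ-∑ₗ m (subsets j) (term (quotient p ∘ ρ) es′) ⟩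
        ∑ₗ (subsets j) (λ F → m * term (quotient p ∘ ρ) es′ F)
          ≈⟨ ∑ₗ-cong (subsets j) (λ F → trans (sym (*-assoc _ _ _)) (*-cong
               (sym (weight-map (multiplicity p) (exponent (quotient p ∘ ρ) es′ F))) (sym (*-identityˡ _)))) ⟩
        ∑ₗ (subsets j) (λ F → weight (contraction ρ es′ F p) * (1# * lengths es′ F)) ∎

    deleted : l e * (Π′ * det (laplacian ρ es′)) ≈ ∑ₗ (subsets j) (λ F → weight (exponent ρ es′ F) * (l e * lengths es′ F))
    deleted = begin
      l e * (Π′ * det (laplacian ρ es′))          ≈⟨ *-congˡ rest ⟩
      l e * ∑ₗ (subsets j) (term ρ es′)           ≈⟨ *-distribˡ-∑ₗ (l e) (subsets j) (term ρ es′) ⟩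
      ∑ₗ (subsets j) (λ F → l e * term ρ es′ F) ≈⟨ ∑ₗ-cong (subsets j) (λ F → x∙yz≈y∙xz (l e) _ _) ⟩
      ∑ₗ (subsets j) (λ F → weight (exponent ρ es′ F) * (l e * lengths es′ F)) ∎

    cases : product (volume ∘ es) * det (laplacian ρ es)
            ≈ ∑ₗ (subsets j) (term ρ es ∘ (outside Vec.∷_)) + ∑ₗ (subsets j) (term ρ es ∘ (inside Vec.∷_))
    cases with live e
    ... | false = begin
      (1# * Π′) * det (gram (0# ∷ conductance ∘ es′) (incidence ρ ∘ es))
        ≈⟨ *-cong (*-identityˡ _) (det-cong (gram-drop (0# ∷ conductance ∘ es′) (incidence ρ ∘ es)
             (λ v w → trans (*-congˡ (zeroˡ _)) (zeroʳ _)))) ⟩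
      Π′ * det (laplacian ρ es′)                  ≈⟨ rest ⟩
      ∑ₗ (subsets j) (term ρ es′) ≈⟨ ∑ₗ-cong (subsets j) (λ F → *-congˡ (sym (*-identityˡ _))) ⟩
      ∑ₗ (subsets j) (λ F → weight (exponent ρ es′ F) * (1# * lengths es′ F)) ≈⟨ +-identityʳ _ ⟨
      ∑ₗ (subsets j) (λ F → weight (exponent ρ es′ F) * (1# * lengths es′ F)) + 0# ≈⟨ +-congˡ (∑ₗ-zero (subsets j) (λ F → zeroˡ (l e * lengths es′ F))) ⟨
      ∑ₗ (subsets j) (λ F → weight (exponent ρ es′ F) * (1# * lengths es′ F)) + ∑ₗ (subsets j) (λ F → 0# * (l e * lengths es′ F)) ∎
    ... | true with classify a b
    ...   | inj₁ a≡b = begin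
      (l e * Π′) * det (gram (l⁻¹ e ∷ conductance ∘ es′) (incidence ρ ∘ es))
        ≈⟨ *-congˡ (det-cong (gram-drop (l⁻¹ e ∷ conductance ∘ es′) (incidence ρ ∘ es) λ v w → trans (*-congʳ (null v)) (zeroˡ _))) ⟩
      (l e * Π′) * det (laplacian ρ es′)          ≈⟨ trans (*-assoc _ _ _) deleted ⟩
      ∑ₗ (subsets j) (λ F → weight (exponent ρ es′ F) * (l e * lengths es′ F)) ≈⟨ +-identityˡ _ ⟨
      0# + ∑ₗ (subsets j) (λ F → weight (exponent ρ es′ F) * (l e * lengths es′ F)) ≈⟨ +-congʳ (∑ₗ-zero (subsets j) (λ F → zeroˡ (1# * lengths es′ F))) ⟨
      ∑ₗ (subsets j) (λ F → 0# * (1# * lengths es′ F)) + ∑ₗ (subsets j) (λ F → weight (exponent ρ es′ F) * (l e * lengths es′ F)) ∎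
      where
      null : ∀ v → incidence ρ e v ≈ 0#
      null v = reflexive (≡.cong fromℤ (≡.trans (≡.cong (λ u → ⟦ u ⟧ v ℤ.- ⟦ b ⟧ v) a≡b) (ℤ.+-inverseʳ (⟦ b ⟧ v))))
    ...   | inj₂ (inj₁ p) = trans (contracted ρ p λ v w → refl) (+-congˡ deleted)
    ...   | inj₂ (inj₂ p) = trans (contracted ρ p opposite-sign) (+-congˡ deleted)
      where
      flip : ∀ v → incidence ρ e v ≈ - fromℤ (difference b a v)
      flip v = trans (reflexive (≡.cong fromℤ (negate (⟦ a ⟧ v) (⟦ b ⟧ v)))) (fromℤ-neg (difference b a v))
        where
        negate : ∀ x y → x ℤ.- y ≡ ℤ.- (y ℤ.- x)
        negate = ℤ-Solver.solve-∀
      opposite-sign : ∀ v w → incidence ρ e v * (l⁻¹ e * incidence ρ e w) ≈ fromℤ (difference b a v) * (l⁻¹ e * fromℤ (difference b a w))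
      opposite-sign v w = begin
        incidence ρ e v * (l⁻¹ e * incidence ρ e w) ≈⟨ *-cong (flip v) (trans (*-congˡ (flip w)) (sym (-‿distribʳ-* _ _))) ⟩
        - y * - z                                   ≈⟨ -‿distribˡ-* _ _ ⟨
        - (y * - z)                                 ≈⟨ -‿cong (-‿distribʳ-* _ _) ⟨
        - - (y * z)                                 ≈⟨ -‿involutive _ ⟩
        y * z                                       ∎
        where
        y = fromℤ (difference b a v)
        z = l⁻¹ e * fromℤ (difference b a w)

open BigOperator ℕ.+-0-rawMonoid using () renaming (fold-over to ∑ᴺ)
open BigOperator ℤ.+-0-rawMonoid using () renaming (fold-over to ∑ᶻ)

-- The involution of a double cover

count : ∀ {n} → (Fin n → Bool) → ℕ
count {zero}  p = 0
count {suc n} p = if p zero then suc (count (p ∘ suc)) else count (p ∘ suc)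

enumerate : ∀ {n} (p : Fin n → Bool) → Fin (count p) → Fin n
enumerate {suc n} p a with p zero
enumerate {suc n} p zero    | true  = zero
enumerate {suc n} p (suc a) | true  = suc (enumerate (p ∘ suc) a)
enumerate {suc n} p a       | false = suc (enumerate (p ∘ suc) a)

enumerate-true : ∀ {n} (p : Fin n → Bool) a → p (enumerate p a) ≡ true
enumerate-true {suc n} p a with p zero in eq
enumerate-true {suc n} p zero    | true  = eq
enumerate-true {suc n} p (suc a) | true  = enumerate-true (p ∘ suc) a
enumerate-true {suc n} p a       | false = enumerate-true (p ∘ suc) a

enumerate-surjective : ∀ {n} (p : Fin n → Bool) {x} → p x ≡ true → ∃ λ a → enumerate p a ≡ x
enumerate-surjective {suc n} p {zero}  px with p zero
... | true = zero , ≡.refl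
enumerate-surjective {suc n} p {suc x} px with p zero | enumerate-surjective (p ∘ suc) px
... | true  | a , eq = suc a , ≡.cong suc eq
... | false | a , eq = a , ≡.cong suc eq

enumerate-injective : ∀ {n} (p : Fin n → Bool) {a b} → enumerate p a ≡ enumerate p b → a ≡ b
enumerate-injective {suc n} p {a} {b} eq with p zero
enumerate-injective {suc n} p {zero}  {zero}  eq | true  = ≡.refl
enumerate-injective {suc n} p {suc a} {suc b} eq | true  = ≡.cong suc (enumerate-injective (p ∘ suc) (suc-injective eq))
enumerate-injective {suc n} p eq | false = enumerate-injective (p ∘ suc) (suc-injective eq)

module EnumeratedSums {c ℓ} (M : CommutativeMonoid c ℓ) where
  open CommutativeMonoid M
    renaming (_∙_ to _+_; ε to 0#; ∙-congˡ to +-congˡ; identityˡ to +-identityˡ)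
  open Algebra.Properties.CommutativeMonoid.Sum M

  sum-enumerate : ∀ {n} (p : Fin n → Bool) (g : Vector Carrier n) →
                  sum (g ∘ enumerate p) ≈ sum (λ x → if p x then g x else 0#)
  sum-enumerate {zero}  p g = refl
  sum-enumerate {suc n} p g with p zero
  ... | true  = +-congˡ (sum-enumerate (p ∘ suc) (g ∘ suc))
  ... | false = trans (sum-enumerate (p ∘ suc) (g ∘ suc)) (sym (+-identityˡ _))

-- A map with fibres of one or two elements, together with the involution
-- exchanging the elements of each fibre.
record Folding (M N : ℕ) : Set where
  field
    proj         : Fin M → Fin N
    σ            : Fin M → Fin M
    lift         : Fin N → Fin M
    proj-σ       : ∀ x → proj (σ x) ≡ proj x
    σ-involutive : ∀ x → σ (σ x) ≡ x
    proj-lift    : ∀ y → proj (lift y) ≡ y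
    fibre        : ∀ {x y} → proj x ≡ proj y → y ≡ x ⊎ y ≡ σ x

  -- Marks the undilated vertices or edges, whose two lifts differ. Comparing the chosen lift with
  -- its image suffices, since `σ` permutes each fibre.
  live : Fin N → Bool
  live y = not (does (σ (lift y) ≟ lift y))

  fixed-or-free : ∀ x → live (proj x) ≡ false × σ x ≡ x ⊎ live (proj x) ≡ true × σ x ≢ x
  fixed-or-free x with σ (lift (proj x)) ≟ lift (proj x) | fibre (proj-lift (proj x))
  ... | yes fix | inj₁ eq = inj₁ (≡.refl , ≡.trans (≡.cong σ eq) (≡.trans fix (≡.sym eq)))
  ... | yes fix | inj₂ eq = inj₁ (≡.refl , ≡.trans (≡.cong σ (≡.trans eq fix)) (≡.sym eq))
  ... | no free | inj₁ eq = inj₂ (≡.refl , λ fix → free (≡.trans (≡.cong σ (≡.sym eq)) (≡.trans fix eq)))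
  ... | no free | inj₂ eq = inj₂ (≡.refl , λ fix → free
    (≡.trans (≡.sym eq) (≡.trans (≡.sym fix) (≡.trans (≡.cong σ eq) (σ-involutive _)))))

  fixed : ∀ {x} → live (proj x) ≡ false → σ x ≡ x
  fixed {x} dead with fixed-or-free x
  ... | inj₁ (_ , fix)   = fix
  ... | inj₂ (alive , _) = contradiction (≡.trans (≡.sym alive) dead) λ ()

  free : ∀ {x} → live (proj x) ≡ true → σ x ≢ x
  free {x} alive with fixed-or-free x
  ... | inj₁ (dead , _) = contradiction (≡.trans (≡.sym alive) dead) λ ()
  ... | inj₂ (_ , free) = free

  module FibreSums {c ℓ} (R : CommutativeMonoid c ℓ) where
    open CommutativeMonoid R
      renaming (_∙_ to _+_; ε to 0#; ∙-congˡ to +-congˡ; identityˡ to +-identityˡ; identityʳ to +-identityʳ)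
    open Algebra.Properties.CommutativeMonoid.Sum R
    open FiniteSums R
    open BigOperator rawMonoid
    open Relation.Binary.Reasoning.Setoid setoid

    fold-fibre : ∀ y (g : Vector Carrier M) →
                 fold-over (λ x → proj x ≟ y) g ≈ g (lift y) + (if live y then g (σ (lift y)) else 0#)
    fold-fibre y g with σ (lift y) ≟ lift y
    ... | yes fix = trans (trans (sum-only (lift y) elsewhere) at-lift) (sym (+-identityʳ _))
      where
      h : Vector Carrier M
      h x = if does (proj x ≟ y) then g x else 0#
      at-lift : h (lift y) ≈ g (lift y)
      at-lift with proj (lift y) ≟ y
      ... | yes _ = refl
      ... | no ≢y = contradiction (proj-lift y) ≢y
      elsewhere : ∀ x → x ≢ lift y → h x ≈ 0#
      elsewhere x x≢ with proj x ≟ y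
      ... | no _  = refl
      ... | yes p with fibre (≡.trans (proj-lift y) (≡.sym p))
      ...   | inj₁ eq = contradiction eq x≢
      ...   | inj₂ eq = contradiction (≡.trans eq fix) x≢
    ... | no free = trans (sum-pair {i = lift y} {σ (lift y)} (free ∘ ≡.sym) elsewhere) (∙-cong (over (proj-lift y)) (over (≡.trans (proj-σ _) (proj-lift y))))
      where
      h : Vector Carrier M
      h x = if does (proj x ≟ y) then g x else 0#
      over : ∀ {x} → proj x ≡ y → h x ≈ g x
      over {x} p with proj x ≟ y
      ... | yes _ = refl
      ... | no ≢y = contradiction p ≢y
      elsewhere : ∀ x → x ≡ lift y ⊎ x ≡ σ (lift y) ⊎ h x ≈ 0#
      elsewhere x with proj x ≟ y
      ... | no _  = inj₂ (inj₂ refl)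
      ... | yes p with fibre (≡.trans (proj-lift y) (≡.sym p))
      ...   | inj₁ eq = inj₁ eq
      ...   | inj₂ eq = inj₂ (inj₁ eq)

    sum-over-fibres : ∀ (g : Vector Carrier M) → sum g ≈ sum (λ y → fold-over (λ x → proj x ≟ y) g)
    sum-over-fibres g = sym (begin
      sum (λ y → sum λ x → if does (proj x ≟ y) then g x else 0#) ≈⟨ ∑-comm (λ y x → if does (proj x ≟ y) then g x else 0#) ⟩
      sum (λ x → sum λ y → if does (proj x ≟ y) then g x else 0#)   ≈⟨ sum-cong-≋ collapse ⟩
      sum g                                                        ∎)
      where
      collapse : ∀ x → sum (λ y → if does (proj x ≟ y) then g x else 0#) ≈ g x
      collapse x = trans (sum-only (proj x) off) on
        where
        on : (if does (proj x ≟ proj x) then g x else 0#) ≈ g x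
        on with proj x ≟ proj x
        ... | yes _ = refl
        ... | no ≢  = contradiction ≡.refl ≢
        off : ∀ y → y ≢ proj x → (if does (proj x ≟ y) then g x else 0#) ≈ 0#
        off y y≢ with proj x ≟ y
        ... | yes p = contradiction (≡.sym p) y≢
        ... | no _  = refl

    sum-fibres : ∀ (g : Vector Carrier M) →
                 sum g ≈ sum (g ∘ lift) + sum (λ y → if live y then g (σ (lift y)) else 0#)
    sum-fibres g = trans (sum-over-fibres g) (trans (sum-cong-≋ λ y → fold-fibre y g)
      (∑-distrib-+ (g ∘ lift) (λ y → if live y then g (σ (lift y)) else 0#)))

  #free : ℕ
  #free = count live

  -- The constant 1 is summed by fibres. Applied to edges and to vertices, this makes h the number
  -- of undilated edges minus the number of undilated vertices.
  cardinality : M ≡ N ℕ.+ #free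
  cardinality = begin
    M                                                  ≡⟨ ones M ⟨
    sum {M} (λ _ → 1)                                  ≡⟨ sum-fibres (λ _ → 1) ⟩
    sum {N} (λ _ → 1) ℕ.+ sum (λ y → if live y then 1 else 0) ≡⟨ ≡.cong₂ ℕ._+_ (ones N) (≡.trans (≡.sym (sum-enumerate live (λ _ → 1))) (ones #free)) ⟩
    N ℕ.+ #free                                        ∎
    where
    open ≡.≡-Reasoning
    open FibreSums ℕ.+-0-commutativeMonoid
    open EnumeratedSums ℕ.+-0-commutativeMonoid
    open Algebra.Properties.CommutativeMonoid.Sum ℕ.+-0-commutativeMonoid using (sum)
    ones : ∀ n → sum {n} (λ _ → 1) ≡ n
    ones zero    = ≡.refl
    ones (suc n) = ≡.cong suc (ones n)

-- The two listed elements may coincide; the exchange is then the identity on the fibre, so dilated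
-- fibres need no separate treatment.
pair-folding : ∀ {M N} (f : Fin M → Fin N) →
               (∀ y → ∃₂ λ i j → f i ≡ y × f j ≡ y × ∀ k → f k ≡ y → k ≡ i ⊎ k ≡ j) → Folding M N
pair-folding {M} {N} f pair = record
  { proj         = f
  ; σ            = σ
  ; lift         = first
  ; proj-σ       = proj-σ
  ; σ-involutive = σσ
  ; proj-lift    = λ y → proj₁ (proj₂ (proj₂ (pair y)))
  ; fibre        = fibre
  }
  where
  first second : Fin N → Fin M
  first y  = proj₁ (pair y)
  second y = proj₁ (proj₂ (pair y))
  members : ∀ y k → f k ≡ y → k ≡ first y ⊎ k ≡ second y
  members y = proj₂ (proj₂ (proj₂ (proj₂ (pair y))))
  other : Fin N → Fin M → Fin M
  other y x = if does (x ≟ first y) then second y else first y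
  σ : Fin M → Fin M
  σ x = other (f x) x
  f-other : ∀ y x → f (other y x) ≡ y
  f-other y x with does (x ≟ first y)
  ... | true  = proj₁ (proj₂ (proj₂ (proj₂ (pair y))))
  ... | false = proj₁ (proj₂ (proj₂ (pair y)))
  proj-σ : ∀ x → f (σ x) ≡ f x
  proj-σ x = f-other (f x) x
  other-first : ∀ y → other y (first y) ≡ second y
  other-first y with first y ≟ first y
  ... | yes _ = ≡.refl
  ... | no ≢  = contradiction ≡.refl ≢
  other-second : ∀ y → other y (second y) ≡ first y
  other-second y with second y ≟ first y
  ... | yes eq = eq
  ... | no _   = ≡.refl
  other-other : ∀ y x → f x ≡ y → other y (other y x) ≡ x
  other-other y x p with members y x p
  ... | inj₁ ≡.refl = ≡.trans (≡.cong (other y) (other-first y)) (other-second y)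
  ... | inj₂ ≡.refl = ≡.trans (≡.cong (other y) (other-second y)) (other-first y)
  σσ : ∀ x → σ (σ x) ≡ x
  σσ x = ≡.trans (≡.cong (λ y → other y (σ x)) (proj-σ x)) (other-other (f x) x ≡.refl)
  fibre : ∀ {x y} → f x ≡ f y → y ≡ x ⊎ y ≡ σ x
  fibre {x} {y} p with members (f x) x ≡.refl | members (f x) y (≡.sym p)
  ... | inj₁ x₁ | inj₁ y₁ = inj₁ (≡.trans y₁ (≡.sym x₁))
  ... | inj₂ x₂ | inj₂ y₂ = inj₁ (≡.trans y₂ (≡.sym x₂))
  ... | inj₁ x₁ | inj₂ y₂ = inj₂ (≡.trans y₂ (≡.trans (≡.sym (other-first (f x))) (≡.cong (other (f x)) (≡.sym x₁))))
  ... | inj₂ x₂ | inj₁ y₁ = inj₂ (≡.trans y₁ (≡.trans (≡.sym (other-second (f x))) (≡.cong (other (f x)) (≡.sym x₂))))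

module _ where
  private
    ∑≡0 : ∀ {n} {P : Pred (Fin n) 0ℓ} (P? : Decidable P) {f : Fin n → ℕ} → (∀ i → f i ≢ 0) →
          ∑ᴺ P? f ≡ 0 → ∀ i → ¬ P i
    ∑≡0 {suc n} P? {f} f≢0 s i p with P? zero
    ... | yes _ = f≢0 zero (ℕ.m+n≡0⇒m≡0 (f zero) s)
    ∑≡0 {suc n} P? f≢0 s zero    p | no ¬p = ¬p p
    ∑≡0 {suc n} P? f≢0 s (suc i) p | no ¬p = ∑≡0 (P? ∘ suc) (f≢0 ∘ suc) s i p

    ∑≡1 : ∀ {n} {P : Pred (Fin n) 0ℓ} (P? : Decidable P) {f : Fin n → ℕ} → (∀ i → f i ≢ 0) →
          ∑ᴺ P? f ≡ 1 → ∃ λ i → P i × f i ≡ 1 × ∀ k → P k → k ≡ i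
    ∑≡1 {suc n} P? {f} f≢0 s with P? zero
    ... | yes p with f zero in f₀
    ...   | zero  = contradiction f₀ (f≢0 zero)
    ...   | suc m = zero , p , ≡.trans f₀ (≡.cong suc (ℕ.m+n≡0⇒m≡0 m (ℕ.suc-injective s))) , only
      where
      only : ∀ k → _ → k ≡ zero
      only zero    _ = ≡.refl
      only (suc k) q = contradiction q (∑≡0 (P? ∘ suc) (f≢0 ∘ suc) (ℕ.m+n≡0⇒n≡0 m (ℕ.suc-injective s)) k)
    ∑≡1 {suc n} P? f≢0 s | no ¬p with ∑≡1 (P? ∘ suc) (f≢0 ∘ suc) s
    ... | i , p , f₁ , only = suc i , p , f₁ , λ { zero q → contradiction q ¬p ; (suc k) q → ≡.cong suc (only k q) }

  -- Positive degrees with sum 2 leave only the partitions 1 + 1 and 2, the undilated and the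
  -- dilated case. The degree conditions of the cover thus become statements about fibres.
  ∑≡2 : ∀ {n} {P : Pred (Fin n) 0ℓ} (P? : Decidable P) {f : Fin n → ℕ} → (∀ i → f i ≢ 0) →
        ∑ᴺ P? f ≡ 2 → ∃₂ λ i j → P i × P j × (∀ k → P k → k ≡ i ⊎ k ≡ j) ×
        (i ≢ j → f i ≡ 1 × f j ≡ 1) × (i ≡ j → f i ≡ 2)
  ∑≡2 {suc n} P? {f} f≢0 s with P? zero
  ... | yes p with f zero in f₀
  ...   | zero        = contradiction f₀ (f≢0 zero)
  ...   | suc zero    with ∑≡1 (P? ∘ suc) (f≢0 ∘ suc) (ℕ.suc-injective s)
  ...     | i , q , f₁ , only = zero , suc i , p , q ,
    (λ { zero _ → inj₁ ≡.refl ; (suc k) r → inj₂ (≡.cong suc (only k r)) }) , (λ _ → f₀ , f₁) , λ ()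
  ∑≡2 {suc n} P? {f} f≢0 s | yes p | suc (suc m) = zero , zero , p , p ,
    (λ { zero _ → inj₁ ≡.refl
       ; (suc k) q → contradiction q (∑≡0 (P? ∘ suc) (f≢0 ∘ suc)
           (ℕ.m+n≡0⇒n≡0 m (ℕ.suc-injective (ℕ.suc-injective s))) k) }) ,
    (λ ≢ → contradiction ≡.refl ≢) ,
    λ _ → ≡.trans f₀ (≡.cong (2 ℕ.+_) (ℕ.m+n≡0⇒m≡0 m (ℕ.suc-injective (ℕ.suc-injective s))))
  ∑≡2 {suc n} P? f≢0 s | no ¬p with ∑≡2 (P? ∘ suc) (f≢0 ∘ suc) s
  ... | i , j , p , q , only , f₁ , f₂ = suc i , suc j , p , q ,
    (λ { zero r → contradiction r ¬p
       ; (suc k) r → case only k r of λ { (inj₁ eq) → inj₁ (≡.cong suc eq) ; (inj₂ eq) → inj₂ (≡.cong suc eq) } }) ,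
    (λ ≢ → f₁ (≢ ∘ ≡.cong suc)) , f₂ ∘ suc-injective

  ∑-inhabited : ∀ {n} {P : Pred (Fin n) 0ℓ} (P? : Decidable P) {f : Fin n → ℕ} →
                ∑ᴺ P? f ≢ 0 → ∃ P
  ∑-inhabited {zero}  P? s≢0 = contradiction ≡.refl s≢0
  ∑-inhabited {suc n} P? s≢0 with P? zero
  ... | yes p = zero , p
  ... | no  _ with ∑-inhabited (P? ∘ suc) s≢0
  ...   | i , p = suc i , p

module CoverStructure {c ℓ₁ ℓ₂} {𝔽 : OrderedField c ℓ₁ ℓ₂} {Γ̃ Γ : MetricGraph 𝔽}
         (π : DoubleCover Γ̃ Γ) (o : CompatibleOrientations π) where
  open DoubleCover π
  open CompatibleOrientations o
  open OrderedField 𝔽 using (_≈_; +-identityʳ)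
  module T = MetricGraph Γ̃
  module B = MetricGraph Γ
  open Orientation

  private
    pairH = λ h → ∑≡2 (λ h̃ → πH h̃ ≟ h) {degE ∘ T.edge} (λ h̃ → ℕ.≢-nonZero⁻¹ _) (degree-H h)
    pairV = λ v → ∑≡2 (λ ṽ → πV ṽ ≟ v) {degV} (λ ṽ → ℕ.≢-nonZero⁻¹ _) (degree-V v)

  foldingV : Folding T.#V B.#V
  foldingV = pair-folding πV λ v → let i , j , p , q , only , _ = pairV v in i , j , p , q , only

  foldingH : Folding T.#H B.#H
  foldingH = pair-folding πH λ h → let i , j , p , q , only , _ = pairH h in i , j , p , q , only

  module FV = Folding foldingV
  module FH = Folding foldingH

  half-edge-lift : ∀ ṽ h → B.r h ≡ πV ṽ → ∃ λ h̃ → T.r h̃ ≡ ṽ × πH h̃ ≡ h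
  half-edge-lift ṽ h eq = ∑-inhabited (λ h̃ → (T.r h̃ ≟ ṽ) ×-dec (πH h̃ ≟ h))
    λ s≡0 → ℕ.≢-nonZero⁻¹ (degV ṽ) (≡.trans (harmonic ṽ h eq) s≡0)

  -- The involutions on half-edges and on vertices are chosen separately. Harmonicity provides a
  -- lift of `πH h̃` rooted at the conjugate vertex; it is either `FH.σ h̃`, or `h̃` itself, and
  -- then the vertex is fixed and both lifts are rooted there.
  r-σ : ∀ h̃ → T.r (FH.σ h̃) ≡ FV.σ (T.r h̃)
  r-σ h̃ with half-edge-lift (FV.σ (T.r h̃)) (πH h̃) (≡.trans (πH-r h̃) (≡.sym (FV.proj-σ _)))
  ... | h̃′ , r≡ , πH≡ with FH.fibre {h̃} {h̃′} (≡.sym πH≡)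
  ...   | inj₂ ≡.refl = r≡
  ...   | inj₁ ≡.refl with FV.fibre {T.r h̃} {T.r (FH.σ h̃)}
                            (≡.trans (≡.sym (πH-r h̃)) (≡.trans (≡.cong B.r (≡.sym (FH.proj-σ h̃))) (πH-r (FH.σ h̃))))
  ...     | inj₁ eq = ≡.trans eq r≡
  ...     | inj₂ eq = eq

  ι-σ : ∀ h̃ → T.ι (FH.σ h̃) ≡ FH.σ (T.ι h̃)
  ι-σ h̃ with FH.fibre {T.ι h̃} {T.ι (FH.σ h̃)}
              (≡.trans (πH-ι h̃) (≡.trans (≡.cong B.ι (≡.sym (FH.proj-σ h̃))) (≡.sym (πH-ι (FH.σ h̃)))))
  ... | inj₂ eq = eq
  ... | inj₁ eq with FH.fibre {h̃} {T.ι (FH.σ (T.ι h̃))}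
                      (≡.sym (≡.trans (πH-ι _) (≡.trans (≡.cong B.ι (≡.trans (FH.proj-σ (T.ι h̃)) (πH-ι h̃))) (B.ι-involutive _))))
  ...   | inj₁ eq′ = ≡.trans eq (≡.trans (≡.cong T.ι (≡.sym eq′)) (T.ι-involutive _))
  ...   | inj₂ eq′ = ≡.trans (≡.cong T.ι (≡.sym eq′)) (T.ι-involutive _)

  source sink : T.E → T.V
  source ẽ = T.r (out upper ẽ)
  sink   ẽ = T.r (T.ι (out upper ẽ))

  σᴱ : T.E → T.E
  σᴱ ẽ = T.edge (FH.σ (out upper ẽ))

  πE-σᴱ : ∀ ẽ → πE (σᴱ ẽ) ≡ πE ẽ
  πE-σᴱ ẽ = ≡.trans (πE-edge _) (≡.trans (≡.cong B.edge (FH.proj-σ _))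
    (≡.trans (≡.sym (πE-edge _)) (≡.cong πE (edge-out upper ẽ))))

  -- If σ reversed the orientation, compatibility would give the base a half-edge fixed by its
  -- involution.
  out-σ : ∀ ẽ → out upper (σᴱ ẽ) ≡ FH.σ (out upper ẽ)
  out-σ ẽ with Equivalence.to (T.edge-orbit (out upper (σᴱ ẽ)) (FH.σ (out upper ẽ))) (edge-out upper (σᴱ ẽ))
  ... | inj₁ eq = eq
  ... | inj₂ eq = contradiction (begin
    B.ι (πH (out upper ẽ))              ≡⟨ ≡.cong B.ι (FH.proj-σ _) ⟨
    B.ι (πH (FH.σ (out upper ẽ)))       ≡⟨ πH-ι _ ⟨
    πH (T.ι (FH.σ (out upper ẽ)))       ≡⟨ ≡.cong πH eq ⟨
    πH (out upper (σᴱ ẽ))               ≡⟨ compatible (σᴱ ẽ) ⟩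
    out lower (πE (σᴱ ẽ))               ≡⟨ ≡.cong (out lower) (πE-σᴱ ẽ) ⟩
    out lower (πE ẽ)                    ≡⟨ compatible ẽ ⟨
    πH (out upper ẽ)                    ∎) (B.ι-fixpoint-free _)
    where open ≡.≡-Reasoning

  πE-lift : ∀ e → πE (T.edge (FH.lift (out lower e))) ≡ e
  πE-lift e = ≡.trans (πE-edge _) (≡.trans (≡.cong B.edge (FH.proj-lift _)) (edge-out lower e))

  -- Induced by the involution on half-edges, so that passing to the ends of an edge commutes with
  -- σ.
  foldingE : Folding T.#E B.#E
  foldingE = record
    { proj         = πE
    ; σ            = σᴱ
    ; lift         = λ e → T.edge (FH.lift (out lower e))
    ; proj-σ       = πE-σᴱ
    ; σ-involutive = λ ẽ → ≡.trans (≡.cong (T.edge ∘ FH.σ) (out-σ ẽ))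
                       (≡.trans (≡.cong T.edge (FH.σ-involutive _)) (edge-out upper ẽ))
    ; proj-lift    = πE-lift
    ; fibre        = fibre
    }
    where
    fibre : ∀ {x y} → πE x ≡ πE y → y ≡ x ⊎ y ≡ σᴱ x
    fibre {x} {y} p with FH.fibre {out upper x} {out upper y}
                           (≡.trans (compatible x) (≡.trans (≡.cong (out lower) p) (≡.sym (compatible y))))
    ... | inj₁ eq = inj₁ (≡.trans (≡.sym (edge-out upper y)) (≡.trans (≡.cong T.edge eq) (edge-out upper x)))
    ... | inj₂ eq = inj₂ (≡.trans (≡.sym (edge-out upper y)) (≡.cong T.edge eq))

  module FE = Folding foldingE

  source-σ : ∀ ẽ → source (σᴱ ẽ) ≡ FV.σ (source ẽ)
  source-σ ẽ = ≡.trans (≡.cong T.r (out-σ ẽ)) (r-σ _)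

  sink-σ : ∀ ẽ → sink (σᴱ ẽ) ≡ FV.σ (sink ẽ)
  sink-σ ẽ = ≡.trans (≡.cong (T.r ∘ T.ι) (out-σ ẽ)) (≡.trans (≡.cong T.r (ι-σ _)) (r-σ _))

  degree-free : ∀ ẽ → FE.live (πE ẽ) ≡ true → degE ẽ ≡ 1
  degree-free ẽ alive with pairH (πH (out upper ẽ))
  ... | i , j , pᵢ , pⱼ , only , deg , _ with i ≟ j | only (out upper ẽ) ≡.refl
  ... | no i≢j | inj₁ eq = ≡.trans (≡.cong degE (≡.sym (edge-out upper ẽ))) (≡.trans (≡.cong (degE ∘ T.edge) eq) (proj₁ (deg i≢j)))
  ... | no i≢j | inj₂ eq = ≡.trans (≡.cong degE (≡.sym (edge-out upper ẽ))) (≡.trans (≡.cong (degE ∘ T.edge) eq) (proj₂ (deg i≢j)))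
  ... | yes ≡.refl | _ = contradiction (≡.trans (≡.cong T.edge (≡.trans (collapse (FH.σ (out upper ẽ)) (FH.proj-σ _)) (≡.sym (collapse (out upper ẽ) ≡.refl)))) (edge-out upper ẽ)) (FE.free alive)
    where
    collapse : ∀ k → πH k ≡ πH (out upper ẽ) → k ≡ i
    collapse k p with only k p
    ... | inj₁ eq = eq
    ... | inj₂ eq = eq

  degree-fixed : ∀ ẽ → FE.live (πE ẽ) ≡ false → degE ẽ ≡ 2
  degree-fixed ẽ dead with pairH (πH (out upper ẽ))
  ... | i , j , pᵢ , pⱼ , only , _ , deg = ≡.trans (≡.cong degE (≡.sym (over i pᵢ)))
    (deg (≡.trans (is-out i pᵢ) (≡.sym (is-out j pⱼ))))
    where
    fix : FH.σ (out upper ẽ) ≡ out upper ẽ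
    fix = ≡.trans (≡.sym (out-σ ẽ)) (≡.cong (out upper) (FE.fixed dead))
    is-out : ∀ k → πH k ≡ πH (out upper ẽ) → k ≡ out upper ẽ
    is-out k p with FH.fibre {out upper ẽ} {k} (≡.sym p)
    ... | inj₁ eq = eq
    ... | inj₂ eq = ≡.trans eq fix
    over : ∀ k → πH k ≡ πH (out upper ẽ) → T.edge k ≡ ẽ
    over k p = ≡.trans (≡.cong T.edge (is-out k p)) (edge-out upper ẽ)

  len-free : ∀ ẽ → FE.live (πE ẽ) ≡ true → T.len ẽ ≈ B.len (πE ẽ)
  len-free ẽ alive = sym (trans (len-πE ẽ) (trans (reflexive (≡.cong (λ d → OrderedField._·_ 𝔽 d (T.len ẽ)) (degree-free ẽ alive))) (+-identityʳ _)))
    where open OrderedField 𝔽 using (reflexive; commutativeRing)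
          open CommutativeRing commutativeRing using (sym; trans)

  dilatedE⇒dead : ∀ {e} → DilatedE π e → FE.live e ≡ false
  dilatedE⇒dead {e} (ẽ , p , only) with FE.σ (FE.lift e) ≟ FE.lift e
  ... | yes _ = ≡.refl
  ... | no ≢  = contradiction (≡.trans (≡.sym (only (≡.trans (πE-σᴱ _) (πE-lift e)))) (only (πE-lift e))) ≢

  dead⇒dilatedE : ∀ {e} → FE.live e ≡ false → DilatedE π e
  dead⇒dilatedE {e} dead = FE.lift e , πE-lift e , λ {y} p → case FE.fibre {FE.lift e} {y} (≡.trans (πE-lift e) (≡.sym p)) of λ
    { (inj₁ eq) → ≡.sym eq
    ; (inj₂ eq) → ≡.sym (≡.trans eq (FE.fixed (≡.trans (≡.cong FE.live (πE-lift e)) dead))) }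

  dilatedV⇒fixed : ∀ {x} → DilatedV π (πV x) → FV.σ x ≡ x
  dilatedV⇒fixed (ṽ , p , only) = ≡.trans (≡.sym (only (FV.proj-σ _))) (only ≡.refl)

  fixed⇒dilatedV : ∀ {x} → FV.σ x ≡ x → DilatedV π (πV x)
  fixed⇒dilatedV {x} fix = x , ≡.refl , λ {y} p → case FV.fibre {x} {y} (≡.sym p) of λ
    { (inj₁ eq) → ≡.sym eq ; (inj₂ eq) → ≡.sym (≡.trans eq fix) }

-- Chains and lattices

module _ {G : Graph} (S : Subgraph G) where
  open Graph G

  adjacent-sym : ∀ {u v} → Adjacent S u v → Adjacent S v u
  adjacent-sym (h , e∈ , rh , rιh) =
    ι h , ≡.subst (E∈ S) (≡.sym (edge-ι h)) e∈ , rιh , ≡.trans (≡.cong r (ι-involutive h)) rh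

  linked-sym : ∀ {u v} → Linked S u v → Linked S v u
  linked-sym ε       = ε
  linked-sym (a ◅ p) = linked-sym p ◅◅ (adjacent-sym a ◅ ε)

  record Components (d : ℕ) : Set where
    field
      rep      : Fin d → V
      rep∈     : ∀ i → V∈ S (rep i)
      index    : ∀ v → V∈ S v → Fin d
      to-rep   : ∀ v (v∈ : V∈ S v) → Linked S (rep (index v v∈)) v
      distinct : ∀ i j → Linked S (rep i) (rep j) → i ≡ j

module Chains {c ℓ₁ ℓ₂} {𝔽 : OrderedField c ℓ₁ ℓ₂} {Γ̃ Γ : MetricGraph 𝔽}
         (π : DoubleCover Γ̃ Γ) (o : CompatibleOrientations π) where
  open DoubleCover π
  open CompatibleOrientations o
  open CoverStructure π o
  open Orientation
  open ℤ-Det hiding (product)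
  open ≡.≡-Reasoning

  adjacent-up : ∀ (S : Subgraph B.graph) {u v y} → Adjacent S u v → πV y ≡ v →
                ∃ λ x → πV x ≡ u × Adjacent (preimage π S) x y
  adjacent-up S {y = y} (h , e∈ , ≡.refl , ≡.refl) πy with half-edge-lift y (B.ι h) (≡.sym πy)
  ... | h̃ , ≡.refl , πh̃ = T.r (T.ι h̃) , lies-over , T.ι h̃
      , ≡.subst (E∈ S) (≡.sym (≡.trans (πE-edge (T.ι h̃)) (≡.cong B.edge πι))) e∈
      , ≡.refl , ≡.cong T.r (T.ι-involutive h̃)
    where
    πι : πH (T.ι h̃) ≡ h
    πι = ≡.trans (πH-ι h̃) (≡.trans (≡.cong B.ι πh̃) (B.ι-involutive h))
    lies-over : πV (T.r (T.ι h̃)) ≡ B.r h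
    lies-over = ≡.trans (≡.sym (πH-r (T.ι h̃))) (≡.cong B.r πι)

  -- A half-edge lifts to any vertex over its root, so walks lift from a prescribed end point. Their
  -- start is then some lift of `u`, which cannot be prescribed.
  linked-up : ∀ (S : Subgraph B.graph) {u v y} → Linked S u v → πV y ≡ v →
              ∃ λ x → πV x ≡ u × Linked (preimage π S) x y
  linked-up S {y = y} ε       πy = y , πy , ε
  linked-up S         (a ◅ p) πy with linked-up S p πy
  ... | x′ , πx′ , p′ with adjacent-up S a πx′
  ...   | x , πx , a′ = x , πx , a′ ◅ p′

  adjacent-down : ∀ (S : Subgraph B.graph) {x y} → Adjacent (preimage π S) x y → Adjacent S (πV x) (πV y)
  adjacent-down S (h̃ , e∈ , ≡.refl , ≡.refl) =
    πH h̃ , ≡.subst (E∈ S) (πE-edge h̃) e∈ , πH-r h̃ , ≡.trans (≡.cong B.r (≡.sym (πH-ι h̃))) (πH-r _)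

  linked-down : ∀ (S : Subgraph B.graph) {x y} → Linked (preimage π S) x y → Linked S (πV x) (πV y)
  linked-down S = gmap πV (adjacent-down S)

  linked-σ : ∀ (S : Subgraph B.graph) {x y} → Linked (preimage π S) x y → Linked (preimage π S) (FV.σ x) (FV.σ y)
  linked-σ S = gmap FV.σ λ { (h̃ , e∈ , ≡.refl , ≡.refl) → FH.σ h̃
    , ≡.subst (E∈ S) (≡.trans (πE-edge h̃) (≡.trans (≡.cong B.edge (≡.sym (FH.proj-σ h̃))) (≡.sym (πE-edge (FH.σ h̃))))) e∈
    , r-σ h̃ , ≡.trans (≡.cong T.r (ι-σ h̃)) (r-σ _) }

  boundary : ∀ {G} → Orientation G → Matrix (Graph.#E G) (Graph.#V G)
  boundary {G} o e v = δ (r (ι (out o e))) v ℤ.- δ (r (out o e)) v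
    where open Graph G

  ∂-mul : ∀ {G} (o : Orientation G) (a : Chain G) v → ∂ o a v ≡ mul a (boundary o) v
  ∂-mul {G} o a v = begin
    ∂ o a v ≡⟨ ≡.cong₂ ℤ._-_ (fold-δ λ e → r (ι (out o e))) (fold-δ λ e → r (out o e)) ⟩
    mul a (λ e v → δ (r (ι (out o e))) v) v ℤ.- mul a (λ e v → δ (r (out o e)) v) v
                                                       ≡⟨ mul-subᴹ a (λ e v → δ (r (ι (out o e))) v) (λ e v → δ (r (out o e)) v) v ⟨
    mul a (boundary o) v                               ∎
    where
    open Graph G
    fold-δ : (f : E → V) → ∑ᶻ (λ e → f e ≟ v) a ≡ mul a (λ e v → δ (f e) v) v
    fold-δ f = ℤ-Sum.sum-cong-≗ λ e → select (does (f e ≟ v)) (a e)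
      where
      select : ∀ b x → (if b then x else + 0) ≡ x ℤ.* (if b then + 1 else + 0)
      select true  x = ≡.sym (ℤ.*-identityʳ x)
      select false x = ≡.sym (ℤ.*-zeroʳ x)

  sum-boundary : ∀ {G} (o : Orientation G) e (φ : Graph.V G → ℤ) →
    ∑ (λ v → boundary o e v ℤ.* φ v) ≡ φ (Graph.r G (Graph.ι G (out o e))) ℤ.- φ (Graph.r G (out o e))
  sum-boundary {G} o e φ = begin
    ∑ (λ v → (δ t v ℤ.- δ s v) ℤ.* φ v) ≡⟨ mul-sub (δ t) (δ s) (λ v (_ : Fin 1) → φ v) zero ⟩
    ∑ (λ v → δ t v ℤ.* φ v) ℤ.- ∑ (λ v → δ s v ℤ.* φ v) ≡⟨ ≡.cong₂ ℤ._-_ (sum-δˡ t φ) (sum-δˡ s φ) ⟩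
    φ t ℤ.- φ s                                      ∎
    where
    open Graph G
    t = r (ι (out o e))
    s = r (out o e)

  D : Matrix T.#E T.#V
  D = boundary upper

  cycle : ∀ {a} → H₁ upper a → ∀ x → mul a D x ≡ + 0
  cycle ∂a≡0 x = ≡.trans (≡.sym (∂-mul upper _ x)) (∂a≡0 x)

  cycle⁻¹ : ∀ {a} → (∀ x → mul a D x ≡ + 0) → H₁ upper a
  cycle⁻¹ eq x = ≡.trans (∂-mul upper _ x) (eq x)

  σᴱ-permutation : Permutation.Permutation T.#E T.#E
  σᴱ-permutation = Permutation.permutation σᴱ σᴱ FE.σ-involutive FE.σ-involutive

  σⱽ-injective : ∀ {x y} → FV.σ x ≡ FV.σ y → x ≡ y
  σⱽ-injective {x} {y} eq = ≡.trans (≡.sym (FV.σ-involutive x)) (≡.trans (≡.cong FV.σ eq) (FV.σ-involutive y))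

  δ-σ : ∀ x y → δ (FV.σ x) y ≡ δ x (FV.σ y)
  δ-σ x y = ≡.trans (≡.cong (δ (FV.σ x)) (≡.sym (FV.σ-involutive y))) (δ-injective FV.σ σⱽ-injective x (FV.σ y))

  ∂-σ : ∀ (a : Chain T.graph) x → mul (a ∘ σᴱ) D x ≡ mul a D (FV.σ x)
  ∂-σ a x = begin
    ∑ (λ ẽ → a (σᴱ ẽ) ℤ.* D ẽ x) ≡⟨ ℤ-Sum.sum-cong-≗ (λ ẽ → ≡.cong (a (σᴱ ẽ) ℤ.*_) (D-σ ẽ)) ⟩
    ∑ (λ ẽ → a (σᴱ ẽ) ℤ.* D (σᴱ ẽ) (FV.σ x)) ≡⟨ ℤ-Sum.sum-permute (λ ẽ → a ẽ ℤ.* D ẽ (FV.σ x)) σᴱ-permutation ⟨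
    ∑ (λ ẽ → a ẽ ℤ.* D ẽ (FV.σ x))               ∎
    where
    D-σ : ∀ ẽ → D ẽ x ≡ D (σᴱ ẽ) (FV.σ x)
    D-σ ẽ = ≡.sym (≡.cong₂ ℤ._-_
      (≡.trans (≡.cong (λ y → δ y (FV.σ x)) (sink-σ ẽ)) (δ-injective FV.σ σⱽ-injective (sink ẽ) x))
      (≡.trans (≡.cong (λ y → δ y (FV.σ x)) (source-σ ẽ)) (δ-injective FV.σ σⱽ-injective (source ẽ) x)))

  anti : Chain T.graph → Chain T.graph
  anti a ẽ = a ẽ ℤ.- a (σᴱ ẽ)

  Invariant Antiinvariant : Chain T.graph → Set
  Invariant a     = ∀ ẽ → a (σᴱ ẽ) ≡ a ẽ
  Antiinvariant a = ∀ ẽ → a (σᴱ ẽ) ≡ ℤ.- a ẽ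

  anti-antiinvariant : ∀ a → Antiinvariant (anti a)
  anti-antiinvariant a ẽ = ≡.trans (≡.cong (λ e → a (σᴱ ẽ) ℤ.- a e) (FE.σ-involutive ẽ)) (flip (a (σᴱ ẽ)) (a ẽ))
    where
    flip : ∀ x y → x ℤ.- y ≡ ℤ.- (y ℤ.- x)
    flip = ℤ-Solver.solve-∀

  anti-invariant : ∀ {a} → Invariant a → ∀ ẽ → anti a ẽ ≡ + 0
  anti-invariant {a} inv ẽ = ≡.trans (≡.cong (λ t → a ẽ ℤ.- t) (inv ẽ)) (ℤ.+-inverseʳ (a ẽ))

  anti≡0⇒invariant : ∀ {a} → (∀ ẽ → anti a ẽ ≡ + 0) → Invariant a
  anti≡0⇒invariant {a} eq ẽ = ≡.sym (ℤ.i-j≡0⇒i≡j (a ẽ) (a (σᴱ ẽ)) (eq ẽ))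

  mul-anti : ∀ {k} (x : Vector ℤ k) (b : Matrix k T.#E) ẽ → mul x (anti ∘ b) ẽ ≡ anti (mul x b) ẽ
  mul-anti x b ẽ = mul-subᴹ x b (λ i ẽ → b i (σᴱ ẽ)) ẽ

  ∂-anti : ∀ a x → mul (anti a) D x ≡ mul a D x ℤ.- mul a D (FV.σ x)
  ∂-anti a x = ≡.trans (mul-sub a (a ∘ σᴱ) D x) (≡.cong (λ t → mul a D x ℤ.- t) (∂-σ a x))

  open FE.FibreSums ℤ.+-0-commutativeMonoid using (sum-fibres; fold-fibre)

  push-at : ∀ a ẽ → push π a (πE ẽ) ≡ (if FE.live (πE ẽ) then a ẽ ℤ.+ a (σᴱ ẽ) else a ẽ)
  push-at a ẽ with FE.fixed-or-free ẽ | FE.fibre (FE.proj-lift (πE ẽ)) | fold-fibre (πE ẽ) a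
  ... | inj₁ (dead , fix) | inj₁ eq | fold rewrite dead = ≡.trans fold (≡.trans (ℤ.+-identityʳ _) (≡.cong a (≡.sym eq)))
  ... | inj₁ (dead , fix) | inj₂ eq | fold rewrite dead = ≡.trans fold (≡.trans (ℤ.+-identityʳ _) (≡.cong a
    (≡.trans (≡.sym (FE.σ-involutive _)) (≡.trans (≡.cong σᴱ (≡.sym eq)) fix))))
  ... | inj₂ (alive , _)  | inj₁ eq | fold rewrite alive = ≡.trans fold (≡.cong₂ ℤ._+_ (≡.cong a (≡.sym eq)) (≡.cong (a ∘ σᴱ) (≡.sym eq)))
  ... | inj₂ (alive , _)  | inj₂ eq | fold rewrite alive = ≡.trans fold (≡.trans (ℤ.+-comm (a (FE.lift (πE ẽ))) (a (σᴱ (FE.lift (πE ẽ)))))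
    (≡.cong₂ ℤ._+_ (≡.cong a (≡.sym eq)) (≡.cong a (≡.trans (≡.sym (FE.σ-involutive _)) (≡.cong σᴱ (≡.sym eq))))))

  push≡0⇒antiinvariant : ∀ {a} → (∀ e → push π a e ≡ + 0) → Antiinvariant a
  push≡0⇒antiinvariant {a} push≡0 ẽ with FE.fixed-or-free ẽ | ≡.trans (≡.sym (push-at a ẽ)) (push≡0 (πE ẽ))
  ... | inj₁ (dead , fix) | eq rewrite dead = ≡.trans (≡.cong a fix) (≡.trans eq (≡.cong ℤ.-_ (≡.sym eq)))
  ... | inj₂ (alive , _)  | eq rewrite alive = begin
    a (σᴱ ẽ)                            ≡⟨ regroup (a ẽ) (a (σᴱ ẽ)) ⟩
    a ẽ ℤ.+ a (σᴱ ẽ) ℤ.- a ẽ            ≡⟨ ≡.cong (ℤ._- a ẽ) eq ⟩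
    + 0 ℤ.- a ẽ                         ≡⟨ ℤ.+-identityˡ _ ⟩
    ℤ.- a ẽ                             ∎
    where
    regroup : ∀ x y → y ≡ x ℤ.+ y ℤ.- x
    regroup = ℤ-Solver.solve-∀

  self-negative : ∀ z → z ≡ ℤ.- z → z ≡ + 0
  self-negative (+ zero)  _ = ≡.refl
  self-negative (+ suc n) ()
  self-negative -[1+ n ]  ()

  antiinvariant-dead : ∀ {a} → Antiinvariant a → ∀ {ẽ} → FE.live (πE ẽ) ≡ false → a ẽ ≡ + 0
  antiinvariant-dead {a} anti {ẽ} dead = self-negative _ (≡.trans (≡.cong a (≡.sym (FE.fixed dead))) (anti ẽ))

  antiinvariant⇒push≡0 : ∀ {a} → Antiinvariant a → ∀ e → push π a e ≡ + 0
  antiinvariant⇒push≡0 {a} anti e = ≡.subst (λ e → push π a e ≡ + 0) (FE.proj-lift e) (≡.trans (push-at a _) value)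
    where
    ẽ = FE.lift e
    value : (if FE.live (πE ẽ) then a ẽ ℤ.+ a (σᴱ ẽ) else a ẽ) ≡ + 0
    value with FE.live (πE ẽ) in eq
    ... | true  = ≡.trans (≡.cong (λ t → a ẽ ℤ.+ t) (anti ẽ)) (ℤ.+-inverseʳ (a ẽ))
    ... | false = antiinvariant-dead anti eq

  K′-intro : ∀ {a} → (∀ x → mul a D x ≡ + 0) → Antiinvariant a → K′ π o a
  K′-intro ∂a≡0 anti = cycle⁻¹ ∂a≡0 , antiinvariant⇒push≡0 anti

  anti-cycle : ∀ {a} → H₁ upper a → K′ π o (anti a)
  anti-cycle {a} a∈ = K′-intro (λ x → ≡.trans (∂-anti a x) (≡.cong₂ ℤ._-_ (cycle {a} a∈ x) (cycle {a} a∈ (FV.σ x)))) (anti-antiinvariant a)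

  pull-invariant : ∀ z → Invariant (pull π z)
  pull-invariant z ẽ with FE.fixed-or-free ẽ
  ... | inj₁ (_ , fix)   = ≡.cong (pull π z) fix
  ... | inj₂ (alive , _) = ≡.cong₂ (λ d e → + d ℤ.* z e)
    (≡.trans (degree-free (σᴱ ẽ) (≡.trans (≡.cong FE.live (FE.proj-σ ẽ)) alive)) (≡.sym (degree-free ẽ alive))) (FE.proj-σ ẽ)

  -- This makes 1 - σ well defined on K: pullbacks are invariant and hence killed, and the nonzero
  -- multiplier `m`, which accounts for torsion, cancels in ℤ.
  ≈K⇒anti : ∀ {a b} → _≈K_ π o a b → ∀ ẽ → anti a ẽ ≡ anti b ẽ
  ≈K⇒anti {a} {b} (m , m≢0 , z , _ , eq) ẽ = ℤ.i-j≡0⇒i≡j (anti a ẽ) (anti b ẽ)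
    (case ℤ.i*j≡0⇒i≡0∨j≡0 m scaled of λ { (inj₁ m≡0) → contradiction m≡0 m≢0 ; (inj₂ d≡0) → d≡0 })
    where
    distribute : ∀ m a b a′ b′ → m ℤ.* ((a ℤ.- a′) ℤ.- (b ℤ.- b′)) ≡ m ℤ.* (a ℤ.- b) ℤ.- m ℤ.* (a′ ℤ.- b′)
    distribute = ℤ-Solver.solve-∀
    scaled : m ℤ.* (anti a ẽ ℤ.- anti b ẽ) ≡ + 0
    scaled = ≡.trans (distribute m (a ẽ) (b ẽ) (a (σᴱ ẽ)) (b (σᴱ ẽ)))
      (≡.trans (≡.cong₂ ℤ._-_ (eq ẽ) (eq (σᴱ ẽ))) (anti-invariant (pull-invariant z) ẽ))

  D-B : Matrix B.#E B.#V
  D-B = boundary lower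

  push-cycle : ∀ {a} → H₁ upper a → H₁ lower (push π a)
  push-cycle {a} a∈ v = begin
    ∂ lower (push π a) v       ≡⟨ ∂-mul lower (push π a) v ⟩
    mul (push π a) D-B v ≡⟨ mul-cong D-B v (λ e → ℤ-Sum.sum-cong-≗ λ ẽ → select (does (πE ẽ ≟ e)) (a ẽ)) ⟩
    mul (mul a ΠE) D-B v       ≡⟨ mul-assoc a ΠE D-B v ⟩
    mul a (ΠE ⊗ D-B) v         ≡⟨ mul-congᴹ a (ΠE ⊗ D-B) (D ⊗ ΠV) v exchange ⟩
    mul a (D ⊗ ΠV) v           ≡⟨ mul-assoc a D ΠV v ⟨
    mul (mul a D) ΠV v ≡⟨ sum-zero (λ x → ≡.trans (≡.cong (ℤ._* ΠV x v) (cycle a∈ x)) (ℤ.*-zeroˡ (ΠV x v))) ⟩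
    + 0                        ∎
    where
    ΠE : Matrix T.#E B.#E
    ΠE ẽ e = δ (πE ẽ) e
    ΠV : Matrix T.#V B.#V
    ΠV x v = δ (πV x) v
    select : ∀ b x → (if b then x else + 0) ≡ x ℤ.* (if b then + 1 else + 0)
    select true  x = ≡.sym (ℤ.*-identityʳ x)
    select false x = ≡.sym (ℤ.*-zeroʳ x)
    exchange : ∀ ẽ → (ΠE ⊗ D-B) ẽ v ≡ (D ⊗ ΠV) ẽ v
    exchange ẽ = begin
      (ΠE ⊗ D-B) ẽ v                                         ≡⟨ sum-δˡ (πE ẽ) (λ e → D-B e v) ⟩
      D-B (πE ẽ) v                                           ≡⟨ ≡.cong₂ ℤ._-_
         (≡.cong (λ u → δ u v) (≡.trans (≡.cong (B.r ∘ B.ι) (≡.sym (compatible ẽ))) (≡.trans (≡.cong B.r (≡.sym (πH-ι _))) (πH-r _))))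
         (≡.cong (λ u → δ u v) (≡.trans (≡.cong B.r (≡.sym (compatible ẽ))) (πH-r _))) ⟩
      δ (πV (sink ẽ)) v ℤ.- δ (πV (source ẽ)) v ≡⟨ sum-boundary upper ẽ (λ x → δ (πV x) v) ⟨
      (D ⊗ ΠV) ẽ v                                           ∎

  -- Injectivity of 1 - σ on K. An invariant cycle satisfies 2 a = π^* π_* a, the 2 being
  -- contributed by the two lifts of an undilated edge or by the degree of a dilated one; so m = 2
  -- works.
  invariant-cycle≈0 : ∀ {a} → H₁ upper a → Invariant a → _≈K_ π o a (λ _ → + 0)
  invariant-cycle≈0 {a} a∈ inv = + 2 , (λ ()) , push π a , push-cycle a∈ , double-pull
    where
    twice : ∀ x → + 2 ℤ.* (x ℤ.- + 0) ≡ + 1 ℤ.* (x ℤ.+ x)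
    twice = ℤ-Solver.solve-∀
    double-pull : ∀ ẽ → + 2 ℤ.* (a ẽ ℤ.- + 0) ≡ pull π (push π a) ẽ
    double-pull ẽ with FE.fixed-or-free ẽ | push-at a ẽ
    ... | inj₂ (alive , _)  | eq rewrite alive | degree-free ẽ alive | eq | inv ẽ = twice (a ẽ)
    ... | inj₁ (dead , fix) | eq rewrite dead | degree-fixed ẽ dead | eq = ≡.cong (+ 2 ℤ.*_) (ℤ.+-identityʳ (a ẽ))

  EdgeChain : T.V → T.V → Chain T.graph → Set
  EdgeChain x y γ = ∀ z → mul γ D z ≡ δ y z ℤ.- δ x z

  half-edge-chain : ∀ h̃ → ∃ λ γ → EdgeChain (T.r h̃) (T.r (T.ι h̃)) γ × (∀ ẽ → ẽ ≢ T.edge h̃ → γ ẽ ≡ + 0)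
  half-edge-chain h̃ with Equivalence.to (T.edge-orbit h̃ (out upper (T.edge h̃))) (≡.sym (edge-out upper (T.edge h̃)))
  ... | inj₁ eq = δ (T.edge h̃)
      , (λ z → ≡.trans (sum-δˡ (T.edge h̃) (λ ẽ → D ẽ z))
           (≡.cong₂ (λ a b → δ a z ℤ.- δ b z) (≡.cong (T.r ∘ T.ι) (≡.sym eq)) (≡.cong T.r (≡.sym eq))))
      , λ ẽ ≢ → δ-≢ (≢ ∘ ≡.sym)
  ... | inj₂ eq = (λ ẽ → ℤ.- δ (T.edge h̃) ẽ)
      , (λ z → ≡.trans (mul-neg (δ (T.edge h̃)) D z) (≡.trans (≡.cong ℤ.-_ (sum-δˡ (T.edge h̃) (λ ẽ → D ẽ z)))
           (≡.trans (flip (δ (sink (T.edge h̃)) z) (δ (source (T.edge h̃)) z))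
           (≡.cong₂ (λ a b → δ a z ℤ.- δ b z)
             (≡.cong T.r (≡.trans (≡.sym (T.ι-involutive _)) (≡.cong T.ι (≡.sym eq)))) (≡.cong T.r (≡.sym eq))))))
      , λ ẽ ≢ → ≡.cong ℤ.-_ (δ-≢ (≢ ∘ ≡.sym))
    where
    flip : ∀ x y → ℤ.- (x ℤ.- y) ≡ y ℤ.- x
    flip = ℤ-Solver.solve-∀

  path-chain : ∀ (S : Subgraph T.graph) {x y} → Linked S x y →
               ∃ λ γ → EdgeChain x y γ × (∀ ẽ → ¬ E∈ S ẽ → γ ẽ ≡ + 0)
  path-chain S {x} ε = (λ _ → + 0) , (λ z → ≡.trans (sum-zero λ ẽ → ℤ.*-zeroˡ (D ẽ z)) (≡.sym (ℤ.+-inverseʳ (δ x z)))) , λ _ _ → ≡.refl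
  path-chain S {x} {y} ((h̃ , e∈ , ≡.refl , ≡.refl) ◅ p) with half-edge-chain h̃ | path-chain S p
  ... | γ₁ , ∂γ₁ , off₁ | γ₂ , ∂γ₂ , off₂ = (λ ẽ → γ₁ ẽ ℤ.+ γ₂ ẽ)
      , (λ z → ≡.trans (mul-+ γ₁ γ₂ D z) (≡.trans (≡.cong₂ ℤ._+_ (∂γ₁ z) (∂γ₂ z)) (telescope (δ (T.r (T.ι h̃)) z) (δ (T.r h̃) z) (δ y z))))
      , λ ẽ ∉ → ≡.cong₂ ℤ._+_ (off₁ ẽ λ { ≡.refl → ∉ e∈ }) (off₂ ẽ ∉)
    where
    telescope : ∀ a b c → (a ℤ.- b) ℤ.+ (c ℤ.- a) ≡ c ℤ.- b
    telescope = ℤ-Solver.solve-∀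

indicator : ∀ {a} {A : Set a} → Dec A → ℤ
indicator A? = if does A? then + 1 else + 0

indicator-cong : ∀ {a b} {A : Set a} {B : Set b} (A? : Dec A) (B? : Dec B) →
                 (A → B) → (B → A) → indicator A? ≡ indicator B?
indicator-cong (yes _) (yes _) to from = ≡.refl
indicator-cong (no _)  (no _)  to from = ≡.refl
indicator-cong (yes a) (no ¬b) to from = contradiction (to a) ¬b
indicator-cong (no ¬a) (yes b) to from = contradiction (from b) ¬a

-- The index of the image of 1 - σ in K′

module PrymLattice {c ℓ₁ ℓ₂} {𝔽 : OrderedField c ℓ₁ ℓ₂} {Γ̃ Γ : MetricGraph 𝔽}
         (π : DoubleCover Γ̃ Γ) (o : CompatibleOrientations π)
         (connected : Connected (whole (MetricGraph.graph Γ)))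
         {k : ℕ} (components : Components (dilationSubgraph π) (suc k))
         {h : ℕ} (κ : BasisK π o h) (μ : BasisK′ π o h) where
  open DoubleCover π
  open CompatibleOrientations o
  open CoverStructure π o
  open Chains π o
  open Components components
  open ℤ-Det hiding (product)
  open ≡.≡-Reasoning

  private
    Γdil : Subgraph B.graph
    Γdil = dilationSubgraph π

  base : Fin (suc k) → T.V
  base i = FV.lift (rep i)

  base-fixed : ∀ i → FV.σ (base i) ≡ base i
  base-fixed i = dilatedV⇒fixed (≡.subst (DilatedV π) (≡.sym (FV.proj-lift (rep i))) (rep∈ i))

  over-base : ∀ i {y} → πV y ≡ rep i → y ≡ base i
  over-base i {y} p with FV.fibre {base i} {y} (≡.trans (FV.proj-lift (rep i)) (≡.sym p))
  ... | inj₁ eq = eq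
  ... | inj₂ eq = ≡.trans eq (base-fixed i)

  -- A dilated vertex has a single lift, so a walk that starts there lifts with both end points
  -- prescribed.
  lifted-path : ∀ (S : Subgraph B.graph) i x → Linked S (rep i) (πV x) →
                ∃ λ γ → EdgeChain (base i) x γ × (∀ ẽ → ¬ E∈ S (πE ẽ) → γ ẽ ≡ + 0)
  lifted-path S i x p with linked-up S p ≡.refl
  ... | y , πy , p̃ with over-base i πy
  ...   | ≡.refl = path-chain (preimage π S) p̃

  origin : T.V
  origin = base zero

  -- Connectedness of the cover in the form used below: the base is connected and `origin` is the
  -- only vertex in its fibre.
  reach : ∀ x → ∃ λ γ → EdgeChain origin x γ
  reach x = let γ , ∂γ , _ = lifted-path (whole B.graph) zero x (connected _ _ _ _) in γ , ∂γ

  -- The chain of a path inside the dilation subgraph is supported on edges fixed by σ.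
  dilated-path : ∀ i x → Linked Γdil (rep i) (πV x) → ∃ λ γ → EdgeChain (base i) x γ × Invariant γ
  dilated-path i x p = γ , ∂γ , inv
    where
    γ = proj₁ (lifted-path Γdil i x p)
    ∂γ = proj₁ (proj₂ (lifted-path Γdil i x p))
    off : ∀ ẽ → FE.live (πE ẽ) ≡ true → γ ẽ ≡ + 0
    off ẽ alive = proj₂ (proj₂ (lifted-path Γdil i x p)) ẽ
      λ dil → contradiction (≡.trans (≡.sym alive) (dilatedE⇒dead dil)) λ ()
    inv : Invariant γ
    inv ẽ with FE.fixed-or-free ẽ
    ... | inj₁ (_ , fix)   = ≡.cong γ fix
    ... | inj₂ (alive , _) = ≡.trans (off (σᴱ ẽ) (≡.trans (≡.cong FE.live (FE.proj-σ ẽ)) alive)) (≡.sym (off ẽ alive))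

  -- Their ends are fixed by σ, so 1 - σ turns them into cycles, and these generate K′ modulo the
  -- image of K. One path for each dilated component but the first accounts for the exponent d - 1.
  paths : Matrix k T.#E
  paths l = proj₁ (reach (base (suc l)))

  ∂γ : Matrix k T.#V
  ∂γ l x = δ (base (suc l)) x ℤ.- δ origin x

  paths-boundary : ∀ l x → mul (paths l) D x ≡ ∂γ l x
  paths-boundary l = proj₂ (reach (base (suc l)))

  -- Summing a boundary against this indicator gives its mass on the `i`-th dilated component, whose
  -- parity separates the paths modulo the image of 1 - σ.
  χ : Fin (suc k) → T.V → ℤ
  χ i x = indicator (linked? Γdil (rep i) (πV x))

  χ-σ : ∀ i x → χ i (FV.σ x) ≡ χ i x
  χ-σ i x = ≡.cong (λ v → indicator (linked? Γdil (rep i) v)) (FV.proj-σ x)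

  χ-base : ∀ i j → χ i (base j) ≡ δ i j
  χ-base i j = indicator-cong (linked? Γdil (rep i) (πV (base j))) (i ≟ j)
    (λ l → distinct i j (≡.subst (Linked Γdil (rep i)) (FV.proj-lift (rep j)) l))
    (λ { ≡.refl → ≡.subst (Linked Γdil (rep i)) (≡.sym (FV.proj-lift (rep i))) ε })

  χ-dead : ∀ i ẽ → FE.live (πE ẽ) ≡ false → χ i (sink ẽ) ≡ χ i (source ẽ)
  χ-dead i ẽ dead = indicator-cong (linked? Γdil (rep i) (πV (sink ẽ))) (linked? Γdil (rep i) (πV (source ẽ))) (λ l → l ◅◅ (adjacent-sym Γdil edge ◅ ε)) (λ l → l ◅◅ (edge ◅ ε))
    where
    open Orientation
    edge : Adjacent Γdil (πV (source ẽ)) (πV (sink ẽ))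
    edge = adjacent-down Γdil (out upper ẽ
      , ≡.subst (DilatedE π) (≡.cong πE (≡.sym (edge-out upper ẽ))) (dead⇒dilatedE dead) , ≡.refl , ≡.refl)

  -- The two lifts of an undilated edge contribute equally to the boundary
  -- mass of a dilated component, and dilated edges do not contribute.
  boundary-even : ∀ {a} → Invariant a → ∀ i → ∃ λ z → ∑ (λ x → mul a D x ℤ.* χ i x) ≡ + 2 ℤ.* z
  boundary-even {a} inv i = z , (begin
    ∑ (λ x → mul a D x ℤ.* χ i x)                      ≡⟨ mul-assoc a D X zero ⟩
    mul a (D ⊗ X) zero ≡⟨ mul-congᴹ a (D ⊗ X) (λ ẽ _ → jump ẽ) zero (λ ẽ → sum-boundary upper ẽ (χ i)) ⟩
    ∑ g                                                ≡⟨ sum-fibres g ⟩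
    z ℤ.+ ∑ (λ e → if FE.live e then g (σᴱ (FE.lift e)) else + 0)
                                                       ≡⟨ ≡.cong (λ t → z ℤ.+ t) (ℤ-Sum.sum-cong-≗ second) ⟩
    z ℤ.+ z                                            ≡⟨ twice z ⟨
    + 2 ℤ.* z                                          ∎)
    where
    open FE.FibreSums ℤ.+-0-commutativeMonoid using (sum-fibres)
    X : Matrix T.#V 1
    X x _ = χ i x
    jump g : T.E → ℤ
    jump ẽ = χ i (sink ẽ) ℤ.- χ i (source ẽ)
    g ẽ = a ẽ ℤ.* jump ẽ
    z = ∑ (g ∘ FE.lift)
    twice : ∀ z → + 2 ℤ.* z ≡ z ℤ.+ z
    twice = ℤ-Solver.solve-∀
    second : ∀ e → (if FE.live e then g (σᴱ (FE.lift e)) else + 0) ≡ g (FE.lift e)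
    second e with FE.live e in eq
    ... | true  = ≡.cong₂ ℤ._*_ (inv (FE.lift e)) (≡.cong₂ ℤ._-_
      (≡.trans (≡.cong (χ i) (sink-σ _)) (χ-σ i _)) (≡.trans (≡.cong (χ i) (source-σ _)) (χ-σ i _)))
    ... | false = ≡.sym (≡.trans (≡.cong (a ẽ ℤ.*_) (≡.trans (≡.cong (ℤ._- χ i (source ẽ)) (χ-dead i ẽ dead)) (ℤ.+-inverseʳ (χ i (source ẽ))))) (ℤ.*-zeroʳ (a ẽ)))
      where
      ẽ = FE.lift e
      dead : FE.live (πE ẽ) ≡ false
      dead = ≡.trans (≡.cong FE.live (FE.proj-lift e)) eq

  weighted-fibres : ∀ (β : T.V → ℤ) → (∀ x → β (FV.σ x) ≡ β x) → (φ : T.V → ℤ) →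
    ∑ (λ v → β (FV.lift v) ℤ.* (φ (FV.lift v) ℤ.+ (if FV.live v then φ (FV.σ (FV.lift v)) else + 0))) ≡ ∑ (λ x → β x ℤ.* φ x)
  weighted-fibres β inv φ = begin
    ∑ (λ v → β (FV.lift v) ℤ.* (φ (FV.lift v) ℤ.+ (if FV.live v then φ (FV.σ (FV.lift v)) else + 0)))
      ≡⟨ ℤ-Sum.sum-cong-≗ split ⟩
    ∑ (λ v → g (FV.lift v) ℤ.+ (if FV.live v then g (FV.σ (FV.lift v)) else + 0))
      ≡⟨ ℤ-Sum.∑-distrib-+ (g ∘ FV.lift) (λ v → if FV.live v then g (FV.σ (FV.lift v)) else + 0) ⟩
    ∑ (g ∘ FV.lift) ℤ.+ ∑ (λ v → if FV.live v then g (FV.σ (FV.lift v)) else + 0) ≡⟨ sum-fibres g ⟨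
    ∑ g ∎
    where
    open FV.FibreSums ℤ.+-0-commutativeMonoid using (sum-fibres)
    g : T.V → ℤ
    g x = β x ℤ.* φ x
    split : ∀ v → β (FV.lift v) ℤ.* (φ (FV.lift v) ℤ.+ (if FV.live v then φ (FV.σ (FV.lift v)) else + 0))
                ≡ g (FV.lift v) ℤ.+ (if FV.live v then g (FV.σ (FV.lift v)) else + 0)
    split v with FV.live v
    ... | true  = ≡.trans (ℤ.*-distribˡ-+ (β (FV.lift v)) _ _) (≡.cong (λ b → g (FV.lift v) ℤ.+ b ℤ.* φ (FV.σ (FV.lift v))) (≡.sym (inv (FV.lift v))))
    ... | false = ≡.trans (ℤ.*-distribˡ-+ (β (FV.lift v)) _ (+ 0)) (≡.cong (λ t → g (FV.lift v) ℤ.+ t) (ℤ.*-zeroʳ (β (FV.lift v))))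

  -- The fibre over `v` as a 0-chain; `mass` is its number of points. Invariant 0-chains are
  -- combinations of fibres, so it suffices to bound these.
  η : Matrix B.#V T.#V
  η v x = δ (FV.lift v) x ℤ.+ (if FV.live v then δ (FV.σ (FV.lift v)) x else + 0)

  mass : B.V → ℤ
  mass v = + 1 ℤ.+ (if FV.live v then + 1 else + 0)

  -- Over an undilated vertex, a path from `origin` plus its σ-image is invariant and bounds the
  -- fibre minus 2 `origin`. Over a dilated one, an invariant path leads only to the base point of
  -- its component, and the way from there to `origin` is recorded by `q`.
  fibre-chain : ∀ v → ∃₂ λ z (q : Vector ℤ k) → Invariant z ×
                (∀ x → mul z D x ≡ (η v x ℤ.- mass v ℤ.* δ origin x) ℤ.- mul q ∂γ x)
  fibre-chain v with FV.live v in eq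
  ... | true = (λ ẽ → ζ ẽ ℤ.+ ζ (σᴱ ẽ)) , (λ _ → + 0)
      , (λ ẽ → ≡.trans (≡.cong (λ e → ζ (σᴱ ẽ) ℤ.+ ζ e) (FE.σ-involutive ẽ)) (ℤ.+-comm (ζ (σᴱ ẽ)) (ζ ẽ)))
      , λ x → begin
      mul (λ ẽ → ζ ẽ ℤ.+ ζ (σᴱ ẽ)) D x           ≡⟨ mul-+ ζ (ζ ∘ σᴱ) D x ⟩
      mul ζ D x ℤ.+ mul (ζ ∘ σᴱ) D x             ≡⟨ ≡.cong (λ t → mul ζ D x ℤ.+ t) (∂-σ ζ x) ⟩
      mul ζ D x ℤ.+ mul ζ D (FV.σ x)             ≡⟨ ≡.cong₂ ℤ._+_ (∂ζ x) (∂ζ (FV.σ x)) ⟩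
      (δ y x ℤ.- δ origin x) ℤ.+ (δ y (FV.σ x) ℤ.- δ origin (FV.σ x))
        ≡⟨ ≡.cong₂ (λ a b → (δ y x ℤ.- δ origin x) ℤ.+ (a ℤ.- b)) (≡.sym (δ-σ y x))
             (≡.trans (≡.sym (δ-σ origin x)) (≡.cong (λ u → δ u x) (base-fixed zero))) ⟩
      (δ y x ℤ.- δ origin x) ℤ.+ (δ (FV.σ y) x ℤ.- δ origin x) ≡⟨ regroup (δ y x) (δ (FV.σ y) x) (δ origin x) ⟩
      ((δ y x ℤ.+ δ (FV.σ y) x) ℤ.- + 2 ℤ.* δ origin x) ℤ.- + 0
        ≡⟨ ≡.cong (λ t → ((δ y x ℤ.+ δ (FV.σ y) x) ℤ.- + 2 ℤ.* δ origin x) ℤ.- t) (sum-zero (λ l → ℤ.*-zeroˡ (∂γ l x))) ⟨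
      ((δ y x ℤ.+ δ (FV.σ y) x) ℤ.- + 2 ℤ.* δ origin x) ℤ.- mul (λ _ → + 0) ∂γ x ∎
    where
    y = FV.lift v
    ζ = proj₁ (reach y)
    ∂ζ = proj₂ (reach y)
    regroup : ∀ a b c → (a ℤ.- c) ℤ.+ (b ℤ.- c) ≡ ((a ℤ.+ b) ℤ.- + 2 ℤ.* c) ℤ.- + 0
    regroup = ℤ-Solver.solve-∀
  ... | false = ζ , q i , proj₂ (proj₂ path) , λ x → begin
      mul ζ D x                                    ≡⟨ proj₁ (proj₂ path) x ⟩
      δ y x ℤ.- δ (base i) x                       ≡⟨ regroup (δ y x) (δ origin x) (δ (base i) x) ⟩
      ((δ y x ℤ.+ + 0) ℤ.- + 1 ℤ.* δ origin x) ℤ.- (δ (base i) x ℤ.- δ origin x)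
        ≡⟨ ≡.cong (λ t → ((δ y x ℤ.+ + 0) ℤ.- + 1 ℤ.* δ origin x) ℤ.- t) (q-boundary i x) ⟨
      ((δ y x ℤ.+ + 0) ℤ.- + 1 ℤ.* δ origin x) ℤ.- mul (q i) ∂γ x ∎
    where
    y = FV.lift v
    dil : DilatedV π v
    dil = ≡.subst (DilatedV π) (FV.proj-lift v) (fixed⇒dilatedV (FV.fixed (≡.trans (≡.cong FV.live (FV.proj-lift v)) eq)))
    i = index v dil
    path = dilated-path i y (≡.subst (Linked Γdil (rep i)) (≡.sym (FV.proj-lift v)) (to-rep v dil))
    ζ = proj₁ path
    q : Fin (suc k) → Vector ℤ k
    q zero    = λ _ → + 0
    q (suc l) = δ l
    q-boundary : ∀ i x → mul (q i) ∂γ x ≡ δ (base i) x ℤ.- δ origin x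
    q-boundary zero x = ≡.trans (sum-zero λ l → ℤ.*-zeroˡ (∂γ l x)) (≡.sym (ℤ.+-inverseʳ (δ origin x)))
    q-boundary (suc l) x = sum-δˡ l (λ l → ∂γ l x)
    regroup : ∀ a c b → a ℤ.- b ≡ ((a ℤ.+ + 0) ℤ.- + 1 ℤ.* c) ℤ.- (b ℤ.- c)
    regroup = ℤ-Solver.solve-∀

  -- Half of c has σ-invariant boundary of total mass zero, which fibre-chain
  -- corrects by invariant chains and the paths.
  decompose-by : (z : Matrix B.#V T.#E) (Q : Matrix B.#V k) → (∀ v → Invariant (z v)) →
    (∀ v x → mul (z v) D x ≡ (η v x ℤ.- mass v ℤ.* δ origin x) ℤ.- mul (Q v) ∂γ x) →
    ∀ {c} → K′ π o c → ∃₂ λ (q : Vector ℤ k) a → H₁ upper a × (∀ ẽ → c ẽ ≡ mul q (anti ∘ paths) ẽ ℤ.+ anti a ẽ)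
  decompose-by z Q z-inv ∂z {c} (∂c≡0 , push≡0) = q , a , cycle⁻¹ ∂a≡0 , decomposition
    where
    antiinv = push≡0⇒antiinvariant push≡0
    select : T.E → Chain T.graph
    select y ẽ = if does (y ≟ ẽ) then c ẽ else + 0
    -- Keeps the coefficient of `c` on the chosen lift of each edge only. As `c` is antiinvariant,
    -- half - σ half is `c`, without any division.
    half : Chain T.graph
    half ẽ = select (FE.lift (πE ẽ)) ẽ
    anti-select : ∀ y ẽ → ẽ ≡ y ⊎ ẽ ≡ σᴱ y → (σᴱ ẽ ≡ ẽ → c ẽ ≡ + 0) → select y ẽ ℤ.- select y (σᴱ ẽ) ≡ c ẽ
    anti-select y ẽ over vanish with y ≟ ẽ | y ≟ σᴱ ẽ
    ... | yes _ | no _  = ℤ.+-identityʳ (c ẽ)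
    ... | yes p | yes q = ≡.trans (≡.cong (λ t → c ẽ ℤ.- t) (≡.trans (≡.cong c fix) (vanish fix))) (ℤ.+-identityʳ (c ẽ))
      where fix = ≡.trans (≡.sym q) p
    ... | no _  | yes _ = ≡.trans (ℤ.+-identityˡ (ℤ.- c (σᴱ ẽ))) (≡.trans (≡.cong ℤ.-_ (antiinv ẽ)) (ℤ.neg-involutive (c ẽ)))
    ... | no ≢₁ | no ≢₂ = case over of λ
      { (inj₁ eq) → contradiction (≡.sym eq) ≢₁
      ; (inj₂ eq) → contradiction (≡.trans (≡.sym (FE.σ-involutive y)) (≡.cong σᴱ (≡.sym eq))) ≢₂ }
    anti-half : ∀ ẽ → anti half ẽ ≡ c ẽ
    anti-half ẽ = ≡.trans (≡.cong (λ e → half ẽ ℤ.- select (FE.lift e) (σᴱ ẽ)) (FE.proj-σ ẽ))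
      (anti-select (FE.lift (πE ẽ)) ẽ (FE.fibre (FE.proj-lift (πE ẽ))) λ fix → self-negative (c ẽ)
        (≡.trans (≡.cong c (≡.sym fix)) (antiinv ẽ)))
    β : T.V → ℤ
    β = mul half D
    β-invariant : ∀ x → β (FV.σ x) ≡ β x
    β-invariant x = ≡.sym (ℤ.i-j≡0⇒i≡j (β x) (β (FV.σ x))
      (≡.trans (≡.sym (∂-anti half x)) (≡.trans (mul-cong D x anti-half) (cycle ∂c≡0 x))))
    β-total : ∑ (λ x → β x ℤ.* + 1) ≡ + 0
    β-total = begin
      ∑ (λ x → β x ℤ.* + 1)      ≡⟨ mul-assoc half D one zero ⟩
      mul half (D ⊗ one) zero ≡⟨ sum-zero (λ ẽ → ≡.trans (≡.cong (half ẽ ℤ.*_) (sum-boundary upper ẽ (λ _ → + 1))) (ℤ.*-zeroʳ (half ẽ))) ⟩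
      + 0                        ∎
      where
      one : Matrix T.#V 1
      one _ _ = + 1
    β′ : Vector ℤ B.#V
    β′ v = β (FV.lift v)
    q = mul β′ Q
    -- Removing the invariant chains does not change the image under 1 - σ; removing the paths
    -- produces the summand with `q`. The multiples of `origin` cancel because the total mass is
    -- zero.
    a : Chain T.graph
    a ẽ = (half ẽ ℤ.- mul β′ z ẽ) ℤ.- mul q paths ẽ
    corrections : ∀ x → mul (mul β′ z) D x ≡ β x ℤ.- mul q ∂γ x
    corrections x = begin
      mul (mul β′ z) D x                                   ≡⟨ mul-assoc β′ z D x ⟩
      mul β′ (z ⊗ D) x ≡⟨ mul-congᴹ β′ (z ⊗ D) (λ v x → (η v x ℤ.- mass v ℤ.* δ origin x) ℤ.- (Q ⊗ ∂γ) v x) x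
                                                                (λ v → ∂z v x) ⟩
      mul β′ (λ v x → (η v x ℤ.- mass v ℤ.* δ origin x) ℤ.- (Q ⊗ ∂γ) v x) x
        ≡⟨ mul-subᴹ β′ (λ v x → η v x ℤ.- mass v ℤ.* δ origin x) (Q ⊗ ∂γ) x ⟩
      mul β′ (λ v x → η v x ℤ.- mass v ℤ.* δ origin x) x ℤ.- mul β′ (Q ⊗ ∂γ) x
        ≡⟨ ≡.cong₂ ℤ._-_ (mul-subᴹ β′ η (λ v x → mass v ℤ.* δ origin x) x) (≡.sym (mul-assoc β′ Q ∂γ x)) ⟩
      (mul β′ η x ℤ.- mul β′ (λ v x → mass v ℤ.* δ origin x) x) ℤ.- mul q ∂γ x
        ≡⟨ ≡.cong₂ (λ s t → (s ℤ.- t) ℤ.- mul q ∂γ x)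
             (≡.trans (weighted-fibres β β-invariant (λ y → δ y x)) (sum-δʳ x β)) no-mass ⟩
      (β x ℤ.- + 0) ℤ.- mul q ∂γ x ≡⟨ ≡.cong (ℤ._- mul q ∂γ x) (ℤ.+-identityʳ (β x)) ⟩
      β x ℤ.- mul q ∂γ x                                   ∎
      where
      no-mass : mul β′ (λ v x → mass v ℤ.* δ origin x) x ≡ + 0
      no-mass = begin
        ∑ (λ v → β′ v ℤ.* (mass v ℤ.* δ origin x)) ≡⟨ ℤ-Sum.sum-cong-≗ (λ v → ≡.sym (ℤ.*-assoc (β′ v) (mass v) (δ origin x))) ⟩
        ∑ (λ v → β′ v ℤ.* mass v ℤ.* δ origin x) ≡⟨ ℤ-Sum.*-distribʳ-sum (δ origin x) (λ v → β′ v ℤ.* mass v) ⟨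
        ∑ (λ v → β′ v ℤ.* mass v) ℤ.* δ origin x ≡⟨ ≡.cong (ℤ._* δ origin x) (≡.trans (weighted-fibres β β-invariant (λ _ → + 1)) β-total) ⟩
        + 0 ℤ.* δ origin x                           ≡⟨ ℤ.*-zeroˡ (δ origin x) ⟩
        + 0                                          ∎
    ∂a≡0 : ∀ x → mul a D x ≡ + 0
    ∂a≡0 x = begin
      mul a D x ≡⟨ mul-sub (λ ẽ → half ẽ ℤ.- mul β′ z ẽ) (mul q paths) D x ⟩
      mul (λ ẽ → half ẽ ℤ.- mul β′ z ẽ) D x ℤ.- mul (mul q paths) D x ≡⟨ ≡.cong₂ ℤ._-_ (mul-sub half (mul β′ z) D x) (mul-assoc q paths D x) ⟩
      (β x ℤ.- mul (mul β′ z) D x) ℤ.- mul q (paths ⊗ D) x ≡⟨ ≡.cong₂ (λ s t → (β x ℤ.- s) ℤ.- t) (corrections x) (mul-congᴹ q (paths ⊗ D) ∂γ x (λ l → paths-boundary l x)) ⟩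
      (β x ℤ.- (β x ℤ.- mul q ∂γ x)) ℤ.- mul q ∂γ x           ≡⟨ cancel (β x) (mul q ∂γ x) ⟩
      + 0                                                     ∎
      where
      cancel : ∀ b q → (b ℤ.- (b ℤ.- q)) ℤ.- q ≡ + 0
      cancel = ℤ-Solver.solve-∀
    z-invariant : Invariant (mul β′ z)
    z-invariant ẽ = ℤ-Sum.sum-cong-≗ λ v → ≡.cong (β′ v ℤ.*_) (z-inv v ẽ)
    decomposition : ∀ ẽ → c ẽ ≡ mul q (anti ∘ paths) ẽ ℤ.+ anti a ẽ
    decomposition ẽ = begin
      c ẽ                                          ≡⟨ anti-half ẽ ⟨
      half ẽ ℤ.- half (σᴱ ẽ) ≡⟨ regroup (half ẽ) (half (σᴱ ẽ)) (mul β′ z ẽ) (mul q paths ẽ) (mul q paths (σᴱ ẽ)) ⟩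
      (mul q paths ẽ ℤ.- mul q paths (σᴱ ẽ)) ℤ.+ (a ẽ ℤ.- ((half (σᴱ ẽ) ℤ.- mul β′ z ẽ) ℤ.- mul q paths (σᴱ ẽ)))
        ≡⟨ ≡.cong₂ (λ s t → s ℤ.+ (a ẽ ℤ.- ((half (σᴱ ẽ) ℤ.- t) ℤ.- mul q paths (σᴱ ẽ)))) (mul-anti q paths ẽ) (z-invariant ẽ) ⟨
      mul q (anti ∘ paths) ẽ ℤ.+ anti a ẽ                       ∎
      where
      regroup : ∀ x x′ z g g′ → x ℤ.- x′ ≡ (g ℤ.- g′) ℤ.+ (((x ℤ.- z) ℤ.- g) ℤ.- ((x′ ℤ.- z) ℤ.- g′))
      regroup = ℤ-Solver.solve-∀

  decompose : ∀ {c} → K′ π o c → ∃₂ λ (q : Vector ℤ k) a → H₁ upper a × (∀ ẽ → c ẽ ≡ mul q (anti ∘ paths) ẽ ℤ.+ anti a ẽ)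
  decompose = decompose-by (proj₁ ∘ fibre-chain) (proj₁ ∘ proj₂ ∘ fibre-chain)
    (proj₁ ∘ proj₂ ∘ proj₂ ∘ fibre-chain) (proj₂ ∘ proj₂ ∘ proj₂ ∘ fibre-chain)

  private
    K M : Matrix h T.#E
    K = BasisK.basis κ
    M = BasisK′.basis μ

  coordinates-unique : ∀ (x y : Vector ℤ h) → (∀ ẽ → mul x M ẽ ≡ mul y M ẽ) → ∀ i → x i ≡ y i
  coordinates-unique x y eq i = ℤ.i-j≡0⇒i≡j (x i) (y i) (IsBasis.independent (BasisK′.isBasis μ) (λ i → x i ℤ.- y i)
    (λ ẽ → ≡.trans (mul-sub x y M ẽ) (≡.trans (≡.cong (ℤ._- mul y M ẽ) (eq ẽ)) (ℤ.+-inverseʳ (mul y M ẽ)))) i)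

  K-member : ∀ i → H₁ upper (K i)
  K-member = IsBasis.members (BasisK.isBasis κ)

  combination-cycle : ∀ y → H₁ upper (mul y K)
  combination-cycle y = cycle⁻¹ λ x → ≡.trans (mul-assoc y K D x) (sum-zero λ i → ≡.trans (≡.cong (y i ℤ.*_) (cycle (K-member i) x)) (ℤ.*-zeroʳ (y i)))

  A : Matrix h h
  A i = proj₁ (IsBasis.spanning (BasisK′.isBasis μ) (anti (K i)) (anti-cycle (K-member i)))

  A-spec : ∀ i ẽ → anti (K i) ẽ ≡ mul (A i) M ẽ
  A-spec i = proj₂ (IsBasis.spanning (BasisK′.isBasis μ) (anti (K i)) (anti-cycle (K-member i)))

  module AntiIndex (γ : Matrix k T.#E) (γ-boundary : ∀ l x → mul (γ l) D x ≡ ∂γ l x)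
    (decompose : ∀ {c} → K′ π o c → ∃₂ λ (q : Vector ℤ k) a →
      H₁ upper a × (∀ ẽ → c ẽ ≡ mul q (anti ∘ γ) ẽ ℤ.+ anti a ẽ))
    (A : Matrix h h) (A-spec : ∀ i ẽ → anti (K i) ẽ ≡ mul (A i) M ẽ) where

    p : Matrix k T.#E
    p l = anti (γ l)

    anti-combination : ∀ y ẽ → anti (mul y K) ẽ ≡ mul (mul y A) M ẽ
    anti-combination y ẽ = begin
      anti (mul y K) ẽ       ≡⟨ mul-anti y K ẽ ⟨
      mul y (anti ∘ K) ẽ     ≡⟨ mul-congᴹ y (anti ∘ K) (A ⊗ M) ẽ (λ i → A-spec i ẽ) ⟩
      mul y (A ⊗ M) ẽ        ≡⟨ mul-assoc y A M ẽ ⟨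
      mul (mul y A) M ẽ      ∎

    anti-span : ∀ {a} → H₁ upper a → ∃ λ y → ∀ ẽ → anti a ẽ ≡ mul (mul y A) M ẽ
    anti-span {a} a∈ with IsBasis.spanning (BasisK.isBasis κ) a a∈
    ... | y , a≈ = y , λ ẽ → ≡.trans (≈K⇒anti {a} {mul y K} a≈ ẽ) (anti-combination y ẽ)

    p∈K′ : ∀ l → K′ π o (p l)
    p∈K′ l = K′-intro (λ x → begin
      mul (p l) D x                                  ≡⟨ ∂-anti (γ l) x ⟩
      mul (γ l) D x ℤ.- mul (γ l) D (FV.σ x) ≡⟨ ≡.cong₂ ℤ._-_ (γ-boundary l x) (≡.trans (γ-boundary l (FV.σ x)) (≡.cong₂ ℤ._-_ (invariant (suc l) x) (invariant zero x))) ⟩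
      ∂γ l x ℤ.- ∂γ l x                              ≡⟨ ℤ.+-inverseʳ (∂γ l x) ⟩
      + 0                                            ∎) (anti-antiinvariant (γ l))
      where
      invariant : ∀ i x → δ (base i) (FV.σ x) ≡ δ (base i) x
      invariant i x = ≡.trans (≡.sym (δ-σ (base i) x)) (≡.cong (λ u → δ u x) (base-fixed i))

    P : Matrix k h
    P l = proj₁ (IsBasis.spanning (BasisK′.isBasis μ) (p l) (p∈K′ l))

    P-spec : ∀ l ẽ → p l ẽ ≡ mul (P l) M ẽ
    P-spec l = proj₂ (IsBasis.spanning (BasisK′.isBasis μ) (p l) (p∈K′ l))

    -- The rows of `A` are the images of the basis of K, those of `P` the cycles of the paths.
    -- `decompose` says that they generate, `boundary-even` that the paths are independent modulo 2,
    -- and `invariant-cycle≈0` that `A` is injective.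
    ∣det∣ : ℤ.∣ det A ∣ ≡ 2 ℕ.^ k
    ∣det∣ = det-index A R P Q T RA+QP≡1 2P≡TA even injective
      where
      decomposition = λ j → decompose (IsBasis.members (BasisK′.isBasis μ) j)
      Q : Matrix h k
      Q j = proj₁ (decomposition j)
      R-span = λ j → anti-span (proj₁ (proj₂ (proj₂ (decomposition j))))
      R : Matrix h h
      R j = proj₁ (R-span j)
      RA+QP≡1 : ∀ i j → (R ⊗ A) i j ℤ.+ (Q ⊗ P) i j ≡ δ i j
      RA+QP≡1 i = coordinates-unique _ (δ i) λ ẽ → begin
        mul (λ j → (R ⊗ A) i j ℤ.+ (Q ⊗ P) i j) M ẽ          ≡⟨ mul-+ ((R ⊗ A) i) ((Q ⊗ P) i) M ẽ ⟩
        mul ((R ⊗ A) i) M ẽ ℤ.+ mul ((Q ⊗ P) i) M ẽ ≡⟨ ≡.cong₂ ℤ._+_ (≡.sym (proj₂ (R-span i) ẽ)) (mul-assoc (Q i) P M ẽ) ⟩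
        anti (proj₁ (proj₂ (decomposition i))) ẽ ℤ.+ mul (Q i) (P ⊗ M) ẽ
          ≡⟨ ≡.cong (λ t → anti (proj₁ (proj₂ (decomposition i))) ẽ ℤ.+ t) (mul-congᴹ (Q i) p (P ⊗ M) ẽ (λ l → P-spec l ẽ)) ⟨
        anti (proj₁ (proj₂ (decomposition i))) ẽ ℤ.+ mul (Q i) p ẽ ≡⟨ ℤ.+-comm (anti (proj₁ (proj₂ (decomposition i))) ẽ) (mul (Q i) p ẽ) ⟩
        mul (Q i) p ẽ ℤ.+ anti (proj₁ (proj₂ (decomposition i))) ẽ ≡⟨ proj₂ (proj₂ (proj₂ (decomposition i))) ẽ ⟨
        M i ẽ                                                ≡⟨ sum-δˡ i (λ j → M j ẽ) ⟨
        mul (δ i) M ẽ                                        ∎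
      T-span = λ l → anti-span (proj₁ (p∈K′ l))
      T : Matrix k h
      T l = proj₁ (T-span l)
      -- Since σ p = - p, doubling `p` is the same as applying 1 - σ to it.
      2P≡TA : ∀ l j → + 2 ℤ.* P l j ≡ (T ⊗ A) l j
      2P≡TA l = coordinates-unique _ ((T ⊗ A) l) λ ẽ → begin
        mul (λ j → + 2 ℤ.* P l j) M ẽ ≡⟨ ℤ-Sum.sum-cong-≗ (λ j → ℤ.*-assoc (+ 2) (P l j) (M j ẽ)) ⟩
        ∑ (λ j → + 2 ℤ.* (P l j ℤ.* M j ẽ)) ≡⟨ ℤ-Sum.*-distribˡ-sum (+ 2) (λ j → P l j ℤ.* M j ẽ) ⟨
        + 2 ℤ.* mul (P l) M ẽ               ≡⟨ ≡.cong (+ 2 ℤ.*_) (P-spec l ẽ) ⟨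
        + 2 ℤ.* p l ẽ                       ≡⟨ twice (p l ẽ) ⟩
        p l ẽ ℤ.- (ℤ.- p l ẽ) ≡⟨ ≡.cong (λ t → p l ẽ ℤ.- t) (anti-antiinvariant (γ l) ẽ) ⟨
        anti (p l) ẽ                        ≡⟨ proj₂ (T-span l) ẽ ⟩
        mul ((T ⊗ A) l) M ẽ                 ∎
        where
        twice : ∀ z → + 2 ℤ.* z ≡ z ℤ.- (ℤ.- z)
        twice = ℤ-Solver.solve-∀
      injective : ∀ (y : Vector ℤ h) → (∀ j → ∑ (λ i → y i ℤ.* A i j) ≡ + 0) → ∀ i → y i ≡ + 0
      injective y yA≡0 = IsBasis.independent (BasisK.isBasis κ) y
        (invariant-cycle≈0 (combination-cycle y) (anti≡0⇒invariant λ ẽ → ≡.trans (anti-combination y ẽ)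
          (sum-zero λ j → ≡.trans (≡.cong (ℤ._* M j ẽ) (yA≡0 j)) (ℤ.*-zeroˡ (M j ẽ)))))
      even : ∀ (x : Vector ℤ k) (y : Vector ℤ h) →
             (∀ j → ∑ (λ l → x l ℤ.* P l j) ≡ ∑ (λ i → y i ℤ.* A i j)) →
             ∃ λ (z : Vector ℤ k) → ∀ l → x l ≡ + 2 ℤ.* z l
      -- The combination of paths minus that of the basis of K is killed by 1 - σ, hence invariant.
      -- Its boundary comes from the paths alone and has mass `x l` on the component `suc l`.
      even x y xP≡yA = (λ l → proj₁ (boundary-even inv (suc l))) , λ l → ≡.trans (≡.sym (detect l)) (proj₂ (boundary-even inv (suc l)))
        where
        a : Chain T.graph
        a ẽ = mul x γ ẽ ℤ.- mul y K ẽ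
        anti-a : ∀ ẽ → anti a ẽ ≡ + 0
        anti-a ẽ = begin
          anti a ẽ ≡⟨ regroup (mul x γ ẽ) (mul y K ẽ) (mul x γ (σᴱ ẽ)) (mul y K (σᴱ ẽ)) ⟩
          anti (mul x γ) ẽ ℤ.- anti (mul y K) ẽ ≡⟨ ≡.cong₂ ℤ._-_ (≡.sym (mul-anti x γ ẽ)) (anti-combination y ẽ) ⟩
          mul x p ẽ ℤ.- mul (mul y A) M ẽ ≡⟨ ≡.cong (ℤ._- mul (mul y A) M ẽ) (≡.trans (mul-congᴹ x p (P ⊗ M) ẽ (λ l → P-spec l ẽ)) (≡.sym (mul-assoc x P M ẽ))) ⟩
          mul (mul x P) M ẽ ℤ.- mul (mul y A) M ẽ ≡⟨ ≡.cong (ℤ._- mul (mul y A) M ẽ) (mul-cong M ẽ xP≡yA) ⟩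
          mul (mul y A) M ẽ ℤ.- mul (mul y A) M ẽ          ≡⟨ ℤ.+-inverseʳ (mul (mul y A) M ẽ) ⟩
          + 0                                              ∎
          where
          regroup : ∀ a b a′ b′ → (a ℤ.- b) ℤ.- (a′ ℤ.- b′) ≡ (a ℤ.- a′) ℤ.- (b ℤ.- b′)
          regroup = ℤ-Solver.solve-∀
        inv : Invariant a
        inv = anti≡0⇒invariant {a} anti-a
        ∂a : ∀ z → mul a D z ≡ mul x ∂γ z
        ∂a z = begin
          mul a D z                               ≡⟨ mul-sub (mul x γ) (mul y K) D z ⟩
          mul (mul x γ) D z ℤ.- mul (mul y K) D z ≡⟨ ≡.cong₂ ℤ._-_ (≡.trans (mul-assoc x γ D z) (mul-congᴹ x (γ ⊗ D) ∂γ z (λ l → γ-boundary l z))) (cycle (combination-cycle y) z) ⟩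
          mul x ∂γ z ℤ.- + 0                      ≡⟨ ℤ.+-identityʳ _ ⟩
          mul x ∂γ z                              ∎
        detect : ∀ l → ∑ (λ z → mul a D z ℤ.* χ (suc l) z) ≡ x l
        detect l = begin
          ∑ (λ z → mul a D z ℤ.* χ (suc l) z) ≡⟨ ℤ-Sum.sum-cong-≗ (λ z → ≡.cong (ℤ._* χ (suc l) z) (∂a z)) ⟩
          mul (mul x ∂γ) X zero                    ≡⟨ mul-assoc x ∂γ X zero ⟩
          mul x (∂γ ⊗ X) zero ≡⟨ mul-congᴹ x (∂γ ⊗ X) (λ i _ → δ i l) zero evaluate ⟩
          ∑ (λ i → x i ℤ.* δ i l)                  ≡⟨ sum-δʳ l x ⟩
          x l                                      ∎
          where
          X : Matrix T.#V 1
          X z _ = χ (suc l) z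
          evaluate : ∀ i → (∂γ ⊗ X) i zero ≡ δ i l
          evaluate i = begin
            (∂γ ⊗ X) i zero                        ≡⟨ mul-sub (δ (base (suc i))) (δ origin) X zero ⟩
            mul (δ (base (suc i))) X zero ℤ.- mul (δ origin) X zero
              ≡⟨ ≡.cong₂ ℤ._-_ (sum-δˡ (base (suc i)) (χ (suc l))) (sum-δˡ origin (χ (suc l))) ⟩
            χ (suc l) (base (suc i)) ℤ.- χ (suc l) (base zero) ≡⟨ ≡.cong₂ ℤ._-_ (χ-base (suc l) (suc i)) (χ-base (suc l) zero) ⟩
            δ (suc l) (suc i) ℤ.- + 0              ≡⟨ ℤ.+-identityʳ _ ⟩
            δ (suc l) (suc i)                      ≡⟨ δ-injective suc suc-injective l i ⟩
            δ l i                                  ≡⟨ δ-sym l i ⟩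
            δ i l                                  ∎

  anti-index : ℤ.∣ det A ∣ ≡ 2 ℕ.^ k
  anti-index = AntiIndex.∣det∣ paths paths-boundary decompose A A-spec

-- An integral splitting of the undilated edge lattice

module SplitCoordinates {h n N : ℕ} where
  open ℤ-Det hiding (product)
  open ≡.≡-Reasoning

  module _ (M : Matrix h N) (s : Matrix n N) (t : Matrix (h ℕ.+ n) N) (B : Matrix n (h ℕ.+ n))
    (edgeᵘ : Fin (h ℕ.+ n) → Fin N) (coord : Matrix (h ℕ.+ n) h)
    (t-ε : ∀ a b → t a (edgeᵘ b) ≡ δ a b)
    (BC≡0 : ∀ v j → ∑ (λ a → B v a ℤ.* M j (edgeᵘ a)) ≡ + 0)
    (independent : ∀ x → (∀ b → mul x M (edgeᵘ b) ≡ + 0) → ∀ i → x i ≡ + 0)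
    (coord-spec : ∀ a ẽ → t a ẽ ℤ.- mul (λ v → B v a) s ẽ ≡ mul (coord a) M ẽ) where

    private
      Bᵀ : Matrix (h ℕ.+ n) n
      Bᵀ a v = B v a
      C : Matrix (h ℕ.+ n) h
      C a j = M j (edgeᵘ a)
      S : Matrix (h ℕ.+ n) n
      S a v = s v (edgeᵘ a)

    -- The coordinates in `M` of the unit chains, each projected to K′ along the section `s` of `B`.
    C* : Matrix h (h ℕ.+ n)
    C* j a = coord a j

    UV≡1 : ∀ b a → (C ⊗ C*) b a ℤ.+ (S ⊗ B) b a ≡ δ b a
    UV≡1 b a = begin
      (C ⊗ C*) b a ℤ.+ (S ⊗ B) b a                              ≡⟨ ≡.cong₂ ℤ._+_
          (ℤ-Sum.sum-cong-≗ λ j → ℤ.*-comm (C b j) (coord a j)) (ℤ-Sum.sum-cong-≗ λ v → ℤ.*-comm (S b v) (B v a)) ⟩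
      mul (coord a) M (edgeᵘ b) ℤ.+ (Bᵀ ⊗ s) a (edgeᵘ b) ≡⟨ ≡.cong (ℤ._+ (Bᵀ ⊗ s) a (edgeᵘ b)) (coord-spec a (edgeᵘ b)) ⟨
      (t a (edgeᵘ b) ℤ.- (Bᵀ ⊗ s) a (edgeᵘ b)) ℤ.+ (Bᵀ ⊗ s) a (edgeᵘ b) ≡⟨ cancel (t a (edgeᵘ b)) ((Bᵀ ⊗ s) a (edgeᵘ b)) ⟩
      t a (edgeᵘ b) ≡⟨ ≡.trans (t-ε a b) (δ-sym a b) ⟩
      δ b a                                                     ∎
      where
      cancel : ∀ x y → (x ℤ.- y) ℤ.+ y ≡ x
      cancel = ℤ-Solver.solve-∀

    -- The projection leaves `M j` unchanged, as B C = 0 annihilates the correction along `s`; its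
    -- coordinates are then determined by independence.
    C*C≡1 : C* ⊗ C ≋ δ
    C*C≡1 i j = ≡.trans (ℤ-Sum.sum-cong-≗ λ a → ℤ.*-comm (coord a i) (C a j)) (≡.trans (unique i) (δ-sym j i))
      where
      Cⱼ : Vector ℤ (h ℕ.+ n)
      Cⱼ a = C a j
      projected : ∀ b → mul (mul Cⱼ coord) M (edgeᵘ b) ≡ M j (edgeᵘ b)
      projected b = begin
        mul (mul Cⱼ coord) M (edgeᵘ b)                         ≡⟨ mul-assoc Cⱼ coord M (edgeᵘ b) ⟩
        mul Cⱼ (coord ⊗ M) (edgeᵘ b) ≡⟨ mul-congᴹ Cⱼ (coord ⊗ M) (λ a ẽ → t a ẽ ℤ.- (Bᵀ ⊗ s) a ẽ) (edgeᵘ b) (λ a → ≡.sym (coord-spec a (edgeᵘ b))) ⟩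
        mul Cⱼ (λ a ẽ → t a ẽ ℤ.- (Bᵀ ⊗ s) a ẽ) (edgeᵘ b)      ≡⟨ mul-subᴹ Cⱼ t (Bᵀ ⊗ s) (edgeᵘ b) ⟩
        mul Cⱼ t (edgeᵘ b) ℤ.- mul Cⱼ (Bᵀ ⊗ s) (edgeᵘ b)          ≡⟨ ≡.cong₂ ℤ._-_ first second ⟩
        M j (edgeᵘ b) ℤ.- + 0                                  ≡⟨ ℤ.+-identityʳ (M j (edgeᵘ b)) ⟩
        M j (edgeᵘ b)                                          ∎
        where
        first : mul Cⱼ t (edgeᵘ b) ≡ M j (edgeᵘ b)
        first = ≡.trans (ℤ-Sum.sum-cong-≗ λ a → ≡.cong (Cⱼ a ℤ.*_) (t-ε a b)) (sum-δʳ b Cⱼ)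
        second : mul Cⱼ (Bᵀ ⊗ s) (edgeᵘ b) ≡ + 0
        second = ≡.trans (≡.sym (mul-assoc Cⱼ Bᵀ s (edgeᵘ b))) (sum-zero λ v → ≡.trans
          (≡.cong (ℤ._* s v (edgeᵘ b)) (≡.trans (ℤ-Sum.sum-cong-≗ λ a → ℤ.*-comm (C a j) (B v a)) (BC≡0 v j)))
          (ℤ.*-zeroˡ (s v (edgeᵘ b))))
      unique : ∀ i → mul Cⱼ coord i ≡ δ j i
      unique i = ℤ.i-j≡0⇒i≡j (mul Cⱼ coord i) (δ j i) (independent (λ i → mul Cⱼ coord i ℤ.- δ j i) (λ b → begin
        mul (λ i → mul Cⱼ coord i ℤ.- δ j i) M (edgeᵘ b) ≡⟨ mul-sub (mul Cⱼ coord) (δ j) M (edgeᵘ b) ⟩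
        mul (mul Cⱼ coord) M (edgeᵘ b) ℤ.- mul (δ j) M (edgeᵘ b) ≡⟨ ≡.cong₂ ℤ._-_ (projected b) (sum-δˡ j (λ i → M i (edgeᵘ b))) ⟩
        M j (edgeᵘ b) ℤ.- M j (edgeᵘ b) ≡⟨ ℤ.+-inverseʳ (M j (edgeᵘ b)) ⟩
        + 0                                                      ∎) i)

    -- An integer matrix with an integral inverse has determinant ±1. The sign is not controlled, so
    -- only the square is recorded.
    unimodular : det (C* ++ B) ℤ.* det (C* ++ B) ≡ + 1
    unimodular = unit² (det (C* ++ B)) (det U) (≡.trans (ℤ.*-comm (det (C* ++ B)) (det U))
      (≡.trans (≡.sym (det-⊗ U (C* ++ B))) (≡.trans (det-cong (ℤ-Block.beside⊗above C S C* B UV≡1)) (det-δ {h ℕ.+ n}))))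
      where U = ℤ-Block.beside C S

module FoldingLabels {M N} (F : Folding M N) where
  open Folding F

  ν : Fin #free → Fin M
  ν i = lift (enumerate live i)

  proj-ν : ∀ i → proj (ν i) ≡ enumerate live i
  proj-ν i = proj-lift _

  ν-live : ∀ i → live (proj (ν i)) ≡ true
  ν-live i = ≡.trans (≡.cong live (proj-ν i)) (enumerate-true live i)

  ν-free : ∀ i → σ (ν i) ≢ ν i
  ν-free i = free (ν-live i)

  ν-injective : ∀ {i j} → ν i ≡ ν j → i ≡ j
  ν-injective {i} {j} eq = enumerate-injective live (≡.trans (≡.sym (proj-ν i)) (≡.trans (≡.cong proj eq) (proj-ν j)))

  σν≢ν : ∀ i j → σ (ν i) ≢ ν j
  σν≢ν i j eq with enumerate-injective live {i} {j} (≡.trans (≡.sym (≡.trans (proj-σ (ν i)) (proj-ν i))) (≡.trans (≡.cong proj eq) (proj-ν j)))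
  ... | ≡.refl = ν-free i eq

  position : ∀ x → σ x ≡ x ⊎ (∃ λ i → x ≡ ν i) ⊎ (∃ λ i → x ≡ σ (ν i))
  position x with fixed-or-free x
  ... | inj₁ (_ , fix)   = inj₁ fix
  ... | inj₂ (alive , _) with enumerate-surjective live alive | fibre (proj-lift (proj x))
  ...   | i , eq | inj₁ x≡ = inj₂ (inj₁ (i , ≡.trans x≡ (≡.cong lift (≡.sym eq))))
  ...   | i , eq | inj₂ x≡ = inj₂ (inj₂ (i , ≡.trans x≡ (≡.cong (σ ∘ lift) (≡.sym eq))))

  -- One coordinate for each undilated vertex, with opposite signs on its two lifts. The label `nil`
  -- of fixed vertices is what drops edge ends at dilated vertices.
  label : Fin M → Label #free
  label x with position x
  ... | inj₁ _              = nil
  ... | inj₂ (inj₁ (i , _)) = pos i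
  ... | inj₂ (inj₂ (i , _)) = neg i

  label-cases : ∀ x → σ x ≡ x × label x ≡ nil ⊎ (∃ λ i → x ≡ ν i × label x ≡ pos i) ⊎ (∃ λ i → x ≡ σ (ν i) × label x ≡ neg i)
  label-cases x with position x
  ... | inj₁ fix             = inj₁ (fix , ≡.refl)
  ... | inj₂ (inj₁ (i , eq)) = inj₂ (inj₁ (i , eq , ≡.refl))
  ... | inj₂ (inj₂ (i , eq)) = inj₂ (inj₂ (i , eq , ≡.refl))

  label-ν : ∀ i → label (ν i) ≡ pos i
  label-ν i with label-cases (ν i)
  ... | inj₁ (fix , _)             = contradiction fix (ν-free i)
  ... | inj₂ (inj₁ (j , p , eq)) = ≡.trans eq (≡.cong pos (ν-injective (≡.sym p)))
  ... | inj₂ (inj₂ (j , p , _))  = contradiction (≡.sym p) (σν≢ν j i)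

  label-σν : ∀ i → label (σ (ν i)) ≡ neg i
  label-σν i with label-cases (σ (ν i))
  ... | inj₁ (fix , _) = contradiction (≡.trans (≡.sym fix) (σ-involutive (ν i))) (ν-free i)
  ... | inj₂ (inj₁ (j , p , _))  = contradiction p (σν≢ν i j)
  ... | inj₂ (inj₂ (j , p , eq)) = ≡.trans eq (≡.cong neg (ν-injective
    (≡.trans (≡.sym (σ-involutive (ν j))) (≡.trans (≡.cong σ (≡.sym p)) (σ-involutive (ν i))))))

  label-odd : ∀ x → label (σ x) ≡ opposite (label x)
  label-odd x with label-cases x
  ... | inj₁ (fix , eq) = ≡.trans (≡.cong label fix) (≡.trans eq (≡.cong opposite (≡.sym eq)))
  ... | inj₂ (inj₁ (i , ≡.refl , eq)) = ≡.trans (label-σν i) (≡.cong opposite (≡.sym eq))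
  ... | inj₂ (inj₂ (i , ≡.refl , eq)) = ≡.trans (≡.cong label (σ-involutive (ν i))) (≡.trans (label-ν i) (≡.cong opposite (≡.sym eq)))

  label-nil : ∀ x → label x ≡ nil → σ x ≡ x
  label-nil x eq with label-cases x
  ... | inj₁ (fix , _)              = fix
  ... | inj₂ (inj₁ (i , _ , eq′)) = contradiction (≡.trans (≡.sym eq′) eq) λ ()
  ... | inj₂ (inj₂ (i , _ , eq′)) = contradiction (≡.trans (≡.sym eq′) eq) λ ()

  label-fixed : ∀ x → σ x ≡ x → label x ≡ nil
  label-fixed x fix with label-cases x
  ... | inj₁ (_ , eq)                    = eq
  ... | inj₂ (inj₁ (i , ≡.refl , _)) = contradiction fix (ν-free i)
  ... | inj₂ (inj₂ (i , ≡.refl , _)) = contradiction (≡.trans (≡.sym fix) (σ-involutive (ν i))) (ν-free i)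

  label-injective : ∀ x y → label x ≡ label y → label x ≢ nil → x ≡ y
  label-injective x y eq ≢nil with label-cases x | label-cases y
  ... | inj₁ (_ , nil≡) | _ = contradiction nil≡ ≢nil
  ... | inj₂ _ | inj₁ (_ , nil≡) = contradiction (≡.trans eq nil≡) ≢nil
  ... | inj₂ (inj₁ (i , ≡.refl , p)) | inj₂ (inj₁ (j , ≡.refl , q)) with ≡.trans (≡.sym p) (≡.trans eq q)
  ...   | ≡.refl = ≡.refl
  label-injective x y eq ≢nil | inj₂ (inj₂ (i , ≡.refl , p)) | inj₂ (inj₂ (j , ≡.refl , q)) with ≡.trans (≡.sym p) (≡.trans eq q)
  ...   | ≡.refl = ≡.refl
  label-injective x y eq ≢nil | inj₂ (inj₁ (i , _ , p)) | inj₂ (inj₂ (j , _ , q)) = contradiction (≡.trans (≡.sym p) (≡.trans eq q)) λ ()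
  label-injective x y eq ≢nil | inj₂ (inj₂ (i , _ , p)) | inj₂ (inj₁ (j , _ , q)) = contradiction (≡.trans (≡.sym p) (≡.trans eq q)) λ ()

  open ℤ-Det using (δ; δ-injective; δ-≢)

  ⟦label⟧ : ∀ x j → ⟦ label x ⟧ j ≡ δ x (ν j) ℤ.- δ (σ x) (ν j)
  ⟦label⟧ x j with label-cases x
  ... | inj₁ (fix , eq) rewrite eq = ≡.sym (≡.trans (≡.cong (λ y → δ x (ν j) ℤ.- δ y (ν j)) fix) (ℤ.+-inverseʳ (δ x (ν j))))
  ... | inj₂ (inj₁ (i , ≡.refl , eq)) rewrite eq = ≡.sym (≡.trans (≡.cong₂ ℤ._-_ (δ-injective ν ν-injective i j) (δ-≢ (σν≢ν i j))) (ℤ.+-identityʳ (δ i j)))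
  ... | inj₂ (inj₂ (i , ≡.refl , eq)) rewrite eq = ≡.sym (≡.trans (≡.cong₂ ℤ._-_ (δ-≢ (σν≢ν i j))
    (≡.trans (≡.cong (λ y → δ y (ν j)) (σ-involutive (ν i))) (δ-injective ν ν-injective i j))) (ℤ.+-identityˡ (ℤ.- δ i j)))

  module FreeSums {c ℓ} (R : CommutativeMonoid c ℓ) where
    open CommutativeMonoid R
      renaming (_∙_ to _+_; ε to 0#; ∙-cong to +-cong; identityˡ to +-identityˡ; identityʳ to +-identityʳ)
    open Algebra.Properties.CommutativeMonoid.Sum R
    open EnumeratedSums R
    open FibreSums R

    sum-free : ∀ (g : Vector Carrier M) → (∀ x → σ x ≡ x → g x ≈ 0#) → sum g ≈ sum (λ i → g (ν i) + g (σ (ν i)))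
    sum-free g vanish = trans (sum-fibres g) (trans (sym (∑-distrib-+ (g ∘ lift) (λ y → if live y then g (σ (lift y)) else 0#)))
      (trans (sum-cong-≋ drop) (sym (sum-enumerate live (λ y → g (lift y) + g (σ (lift y)))))))
      where
      drop : ∀ y → g (lift y) + (if live y then g (σ (lift y)) else 0#) ≈ (if live y then g (lift y) + g (σ (lift y)) else 0#)
      drop y with live y in eq
      ... | true  = refl
      ... | false = trans (+-identityʳ _) (vanish (lift y) (fixed (≡.trans (≡.cong live (proj-lift y)) eq)))

module PrymGram {c ℓ₁ ℓ₂} {𝔽 : OrderedField c ℓ₁ ℓ₂} {Γ̃ Γ : MetricGraph 𝔽}
         (π : DoubleCover Γ̃ Γ) (o : CompatibleOrientations π) where
  open DoubleCover π
  open CompatibleOrientations o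
  open CoverStructure π o
  open Chains π o
  open ℤ-Det hiding (product)
  open ≡.≡-Reasoning
  module LV = FoldingLabels foldingV
  module LE = FoldingLabels foldingE

  n : ℕ
  n = FV.#free

  ρ : T.V → Label n
  ρ = LV.label

  subst-sum : ∀ {c ℓ} (R : CommutativeMonoid c ℓ) {m m′} (eq : m ≡ m′) (g : Vector (CommutativeMonoid.Carrier R) m′) →
              Algebra.Properties.CommutativeMonoid.Sum.sum R (g ∘ ≡.subst Fin eq) ≡ Algebra.Properties.CommutativeMonoid.Sum.sum R g
  subst-sum R ≡.refl g = ≡.refl

  subst-injective : ∀ {m m′} (eq : m ≡ m′) {i j : Fin m} → ≡.subst Fin eq i ≡ ≡.subst Fin eq j → i ≡ j
  subst-injective ≡.refl eq = eq

  subst-surjective : ∀ {m m′} (eq : m ≡ m′) j → ∃ λ (i : Fin m) → ≡.subst Fin eq i ≡ j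
  subst-surjective ≡.refl j = j , ≡.refl

  -- An edge and its σ-image carry opposite coefficients and opposite labels, so one row of labels
  -- stands for both. The sign appears because `difference` is source minus sink while `D` is sink
  -- minus source.
  incidence-boundary : ∀ {f} → Antiinvariant f → ∀ v →
    ∑ (λ i → difference (ρ (source (LE.ν i))) (ρ (sink (LE.ν i))) v ℤ.* f (LE.ν i)) ≡ ℤ.- mul f D (LV.ν v)
  incidence-boundary {f} antiinv v = begin
    ∑ (λ i → difference (ρ (source (LE.ν i))) (ρ (sink (LE.ν i))) v ℤ.* f (LE.ν i))
      ≡⟨ ℤ-Sum.sum-cong-≗ pointwise ⟩
    ∑ (λ i → ℤ.- (g (LE.ν i) ℤ.+ g (σᴱ (LE.ν i))))
      ≡⟨ ℤ-Sum.sum-cong-≗ (λ i → ≡.sym (ℤ.-1*i≡-i (g (LE.ν i) ℤ.+ g (σᴱ (LE.ν i))))) ⟩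
    ∑ (λ i → ℤ.-1ℤ ℤ.* (g (LE.ν i) ℤ.+ g (σᴱ (LE.ν i))))
      ≡⟨ ℤ-Sum.*-distribˡ-sum ℤ.-1ℤ (λ i → g (LE.ν i) ℤ.+ g (σᴱ (LE.ν i))) ⟨
    ℤ.-1ℤ ℤ.* ∑ (λ i → g (LE.ν i) ℤ.+ g (σᴱ (LE.ν i)))
      ≡⟨ ≡.cong (ℤ.-1ℤ ℤ.*_) (sum-free g vanish) ⟨
    ℤ.-1ℤ ℤ.* ∑ g                                       ≡⟨ ℤ.-1*i≡-i (∑ g) ⟩
    ℤ.- mul f D y                                       ∎
    where
    open LE.FreeSums ℤ.+-0-commutativeMonoid
    y = LV.ν v
    g : T.E → ℤ
    g ẽ = f ẽ ℤ.* D ẽ y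
    vanish : ∀ ẽ → σᴱ ẽ ≡ ẽ → g ẽ ≡ + 0
    vanish ẽ fix = ≡.trans (≡.cong (ℤ._* D ẽ y) (self-negative (f ẽ) (≡.trans (≡.cong f (≡.sym fix)) (antiinv ẽ)))) (ℤ.*-zeroˡ (D ẽ y))
    regroup : ∀ a b c d f → ((a ℤ.- b) ℤ.- (c ℤ.- d)) ℤ.* f ≡ ℤ.- (f ℤ.* (c ℤ.- a) ℤ.+ (ℤ.- f) ℤ.* (d ℤ.- b))
    regroup = ℤ-Solver.solve-∀
    pointwise : ∀ i → difference (ρ (source (LE.ν i))) (ρ (sink (LE.ν i))) v ℤ.* f (LE.ν i) ≡ ℤ.- (g (LE.ν i) ℤ.+ g (σᴱ (LE.ν i)))
    pointwise i = begin
      difference (ρ (source ẽ)) (ρ (sink ẽ)) v ℤ.* f ẽ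
        ≡⟨ ≡.cong₂ (λ a b → (a ℤ.- b) ℤ.* f ẽ) (LV.⟦label⟧ (source ẽ) v) (LV.⟦label⟧ (sink ẽ) v) ⟩
      ((δ (source ẽ) y ℤ.- δ (FV.σ (source ẽ)) y) ℤ.- (δ (sink ẽ) y ℤ.- δ (FV.σ (sink ẽ)) y)) ℤ.* f ẽ
        ≡⟨ regroup (δ (source ẽ) y) (δ (FV.σ (source ẽ)) y) (δ (sink ẽ) y) (δ (FV.σ (sink ẽ)) y) (f ẽ) ⟩
      ℤ.- (g ẽ ℤ.+ (ℤ.- f ẽ) ℤ.* (δ (FV.σ (sink ẽ)) y ℤ.- δ (FV.σ (source ẽ)) y))
        ≡⟨ ≡.cong₂ (λ a b → ℤ.- (g ẽ ℤ.+ a ℤ.* b)) (antiinv ẽ)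
             (≡.cong₂ (λ a b → δ a y ℤ.- δ b y) (sink-σ ẽ) (source-σ ẽ)) ⟨
      ℤ.- (g ẽ ℤ.+ g (σᴱ ẽ)) ∎
      where ẽ = LE.ν i

  -- The boundary of an antiinvariant chain is odd under σ: it vanishes at fixed vertices and is
  -- determined by one lift of each other vertex.
  antiinvariant-cycle : ∀ {f} → Antiinvariant f → (∀ v → mul f D (LV.ν v) ≡ + 0) → ∀ x → mul f D x ≡ + 0
  antiinvariant-cycle {f} antiinv ∂ν x with LV.position x
  ... | inj₁ fix = self-negative (mul f D x) (≡.trans (≡.cong (mul f D) (≡.sym fix)) (odd x))
    where
    odd : ∀ x → mul f D (FV.σ x) ≡ ℤ.- mul f D x
    odd x = ≡.trans (≡.sym (∂-σ f x)) (≡.trans (mul-cong D x antiinv) (mul-neg f D x))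
  ... | inj₂ (inj₁ (i , ≡.refl)) = ∂ν i
  ... | inj₂ (inj₂ (i , ≡.refl)) = ≡.trans (≡.sym (∂-σ f (LV.ν i)))
    (≡.trans (mul-cong D (LV.ν i) antiinv) (≡.trans (mul-neg f D (LV.ν i)) (≡.cong ℤ.-_ (∂ν i))))

  antiinvariant-extensional : ∀ {f g} → Antiinvariant f → Antiinvariant g → (∀ i → f (LE.ν i) ≡ g (LE.ν i)) → ∀ ẽ → f ẽ ≡ g ẽ
  antiinvariant-extensional {f} {g} af ag eq ẽ with LE.position ẽ
  ... | inj₁ fix = ≡.trans (self-negative (f ẽ) (≡.trans (≡.cong f (≡.sym fix)) (af ẽ)))
                     (≡.sym (self-negative (g ẽ) (≡.trans (≡.cong g (≡.sym fix)) (ag ẽ))))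
  ... | inj₂ (inj₁ (i , ≡.refl)) = eq i
  ... | inj₂ (inj₂ (i , ≡.refl)) = ≡.trans (af (LE.ν i)) (≡.trans (≡.cong ℤ.-_ (eq i)) (≡.sym (ag (LE.ν i))))

  antiinvariant-mul : ∀ {k} (x : Vector ℤ k) (b : Matrix k T.#E) → (∀ i → Antiinvariant (b i)) → Antiinvariant (mul x b)
  antiinvariant-mul x b anti ẽ = ≡.trans (ℤ-Sum.sum-cong-≗ λ i → ≡.cong (x i ℤ.*_) (anti i ẽ)) (mul-negᴹ x b ẽ)

  module Splitting {h} (μ : BasisK′ π o h) (#edges : h ℕ.+ n ≡ FE.#free)
    (origin : T.V) (origin-fixed : FV.σ origin ≡ origin)
    (ζ : Matrix n T.#E) (∂ζ : ∀ v → EdgeChain origin (LV.ν v) (ζ v)) where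

    M : Matrix h T.#E
    M = BasisK′.basis μ

    edgeᵘ : Fin (h ℕ.+ n) → T.E
    edgeᵘ a = LE.ν (≡.subst Fin #edges a)

    ε-injective : ∀ {a b} → edgeᵘ a ≡ edgeᵘ b → a ≡ b
    ε-injective eq = subst-injective #edges (LE.ν-injective eq)

    M-member : ∀ j → K′ π o (M j)
    M-member = IsBasis.members (BasisK′.isBasis μ)

    M-antiinvariant : ∀ j → Antiinvariant (M j)
    M-antiinvariant j = push≡0⇒antiinvariant {M j} (proj₂ (M-member j))

    C : Matrix (h ℕ.+ n) h
    C a j = M j (edgeᵘ a)

    B : Matrix n (h ℕ.+ n)
    B v a = difference (ρ (source (edgeᵘ a))) (ρ (sink (edgeᵘ a))) v

    Bᵀ : Matrix (h ℕ.+ n) n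
    Bᵀ a v = B v a

    B-boundary : ∀ {f} → Antiinvariant f → ∀ v → ∑ (λ a → B v a ℤ.* f (edgeᵘ a)) ≡ ℤ.- mul f D (LV.ν v)
    B-boundary {f} antiinv v = ≡.trans
      (subst-sum ℤ.+-0-commutativeMonoid #edges (λ i → difference (ρ (source (LE.ν i))) (ρ (sink (LE.ν i))) v ℤ.* f (LE.ν i)))
      (incidence-boundary {f} antiinv v)

    -- An integral section of `B`. The part of the boundary at `origin` is fixed by σ and cancels;
    -- the minus sign makes up for the one in `incidence-boundary`.
    s : Matrix n T.#E
    s v ẽ = ℤ.- anti (ζ v) ẽ

    s-antiinvariant : ∀ v → Antiinvariant (s v)
    s-antiinvariant v ẽ = ≡.cong ℤ.-_ (anti-antiinvariant (ζ v) ẽ)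

    s-boundary : ∀ w v → mul (s w) D (LV.ν v) ≡ ℤ.- δ w v
    s-boundary w v = begin
      mul (s w) D y                                           ≡⟨ mul-neg (anti (ζ w)) D y ⟩
      ℤ.- mul (anti (ζ w)) D y                                ≡⟨ ≡.cong ℤ.-_ (∂-anti (ζ w) y) ⟩
      ℤ.- (mul (ζ w) D y ℤ.- mul (ζ w) D (FV.σ y)) ≡⟨ ≡.cong₂ (λ a b → ℤ.- (a ℤ.- b)) (∂ζ w y) (∂ζ w (FV.σ y)) ⟩
      ℤ.- ((δ (LV.ν w) y ℤ.- δ origin y) ℤ.- (δ (LV.ν w) (FV.σ y) ℤ.- δ origin (FV.σ y)))
        ≡⟨ ≡.cong₂ (λ a b → ℤ.- ((δ (LV.ν w) y ℤ.- δ origin y) ℤ.- (a ℤ.- b)))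
             (δ-≢ (λ eq → LV.σν≢ν v w (≡.sym eq)))
             (≡.trans (≡.sym (δ-σ origin y)) (≡.cong (λ u → δ u y) origin-fixed)) ⟩
      ℤ.- ((δ (LV.ν w) y ℤ.- δ origin y) ℤ.- (+ 0 ℤ.- δ origin y)) ≡⟨ regroup (δ (LV.ν w) y) (δ origin y) ⟩
      ℤ.- δ (LV.ν w) y ≡⟨ ≡.cong ℤ.-_ (δ-injective LV.ν LV.ν-injective w v) ⟩
      ℤ.- δ w v                                               ∎
      where
      y = LV.ν v
      regroup : ∀ a b → ℤ.- ((a ℤ.- b) ℤ.- (+ 0 ℤ.- b)) ≡ ℤ.- a
      regroup = ℤ-Solver.solve-∀

    S : Matrix (h ℕ.+ n) n
    S a v = s v (edgeᵘ a)

    BC≡0 : B ⊗ C ≋ λ _ _ → + 0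
    BC≡0 v j = ≡.trans (B-boundary {M j} (M-antiinvariant j) v) (≡.cong ℤ.-_ (cycle {M j} (proj₁ (M-member j)) (LV.ν v)))

    BS≡1 : B ⊗ S ≋ δ
    BS≡1 v w = ≡.trans (B-boundary {s w} (s-antiinvariant w) v) (≡.trans (≡.cong ℤ.-_ (s-boundary w v))
      (≡.trans (ℤ.neg-involutive (δ w v)) (δ-sym w v)))

    t : Matrix (h ℕ.+ n) T.#E
    t a = anti (δ (edgeᵘ a))

    t-ε : ∀ a b → t a (edgeᵘ b) ≡ δ a b
    t-ε a b = ≡.trans (≡.cong₂ ℤ._-_ (δ-injective edgeᵘ ε-injective a b) (δ-≢ (λ eq → LE.σν≢ν _ _ (≡.sym eq)))) (ℤ.+-identityʳ (δ a b))

    -- The projection of the a-th edge to ker B along the section S.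
    f : Matrix (h ℕ.+ n) T.#E
    f a ẽ = t a ẽ ℤ.- (Bᵀ ⊗ s) a ẽ

    f-antiinvariant : ∀ a → Antiinvariant (f a)
    f-antiinvariant a ẽ = ≡.trans
      (≡.cong₂ ℤ._-_ (anti-antiinvariant (δ (edgeᵘ a)) ẽ) (antiinvariant-mul (Bᵀ a) s s-antiinvariant ẽ))
      (regroup (t a ẽ) ((Bᵀ ⊗ s) a ẽ))
      where
      regroup : ∀ x y → (ℤ.- x) ℤ.- (ℤ.- y) ≡ ℤ.- (x ℤ.- y)
      regroup = ℤ-Solver.solve-∀

    f∈K′ : ∀ a → K′ π o (f a)
    f∈K′ a = K′-intro {f a} (antiinvariant-cycle {f a} (f-antiinvariant a) λ v → begin
      mul (f a) D (LV.ν v) ≡⟨ mul-sub (t a) ((Bᵀ ⊗ s) a) D (LV.ν v) ⟩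
      mul (t a) D (LV.ν v) ℤ.- mul (mul (Bᵀ a) s) D (LV.ν v)        ≡⟨ ≡.cong₂ ℤ._-_ (∂t v) (∂s v) ⟩
      ℤ.- B v a ℤ.- (ℤ.- B v a)                                     ≡⟨ ℤ.+-inverseʳ (ℤ.- B v a) ⟩
      + 0                                                           ∎) (f-antiinvariant a)
      where
      ∂t : ∀ v → mul (t a) D (LV.ν v) ≡ ℤ.- B v a
      ∂t v = begin
        mul (t a) D (LV.ν v)                       ≡⟨ ℤ.neg-involutive _ ⟨
        ℤ.- (ℤ.- mul (t a) D (LV.ν v)) ≡⟨ ≡.cong ℤ.-_ (B-boundary {t a} (anti-antiinvariant (δ (edgeᵘ a))) v) ⟨
        ℤ.- ∑ (λ b → B v b ℤ.* t a (edgeᵘ b)) ≡⟨ ≡.cong ℤ.-_ (ℤ-Sum.sum-cong-≗ λ b → ≡.cong (B v b ℤ.*_) (≡.trans (t-ε a b) (δ-sym a b))) ⟩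
        ℤ.- ∑ (λ b → B v b ℤ.* δ b a)              ≡⟨ ≡.cong ℤ.-_ (sum-δʳ a (B v)) ⟩
        ℤ.- B v a                                  ∎
      ∂s : ∀ v → mul (mul (Bᵀ a) s) D (LV.ν v) ≡ ℤ.- B v a
      ∂s v = begin
        mul (mul (Bᵀ a) s) D (LV.ν v)              ≡⟨ mul-assoc (Bᵀ a) s D (LV.ν v) ⟩
        mul (Bᵀ a) (s ⊗ D) (LV.ν v) ≡⟨ ℤ-Sum.sum-cong-≗ (λ w → ≡.cong (B w a ℤ.*_) (s-boundary w v)) ⟩
        mul (Bᵀ a) (λ w v → ℤ.- δ w v) v           ≡⟨ mul-negᴹ (Bᵀ a) δ v ⟩
        ℤ.- ∑ (λ w → B w a ℤ.* δ w v)              ≡⟨ ≡.cong ℤ.-_ (sum-δʳ v (Bᵀ a)) ⟩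
        ℤ.- B v a                                  ∎

    M-independent : ∀ x → (∀ b → mul x M (edgeᵘ b) ≡ + 0) → ∀ i → x i ≡ + 0
    M-independent x on-ε = IsBasis.independent (BasisK′.isBasis μ) x
      (antiinvariant-extensional {mul x M} {λ _ → + 0} (antiinvariant-mul x M M-antiinvariant) (λ _ → ≡.refl) on-ν)
      where
      on-ν : ∀ i → mul x M (LE.ν i) ≡ + 0
      on-ν i with subst-surjective #edges i
      ... | b , eq = ≡.subst (λ j → mul x M (LE.ν j) ≡ + 0) eq (on-ε b)

    f-span : ∀ a → ∃ λ x → ∀ ẽ → f a ẽ ≡ mul x M ẽ
    f-span a = IsBasis.spanning (BasisK′.isBasis μ) (f a) (f∈K′ a)

-- Ogods

contract-opposite : ∀ {k} i (t : Label k) a → contract i t (opposite a) ≡ opposite (contract i t a)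
contract-opposite i t nil     = ≡.refl
contract-opposite i t (pos a) with i ≟ a
... | yes _ = ≡.refl
... | no _  = ≡.refl
contract-opposite i t (neg a) with i ≟ a
... | yes _ = ≡.sym (opposite-involutive t)
... | no _  = ≡.refl

contract-pos-punchIn : ∀ {k} i (t : Label k) j → contract i t (pos (punchIn i j)) ≡ pos j
contract-pos-punchIn i t j with i ≟ punchIn i j
... | yes eq = contradiction (≡.sym eq) (punchInᵢ≢i i j)
... | no ≢   = ≡.cong pos (≡.trans (punchOut-cong i ≡.refl) (punchOut-punchIn i))

contract-nil : ∀ {k} i (t : Label k) a → ¬ At i a → contract i t a ≡ nil → a ≡ nil
contract-nil i t nil     ¬at eq = ≡.refl
contract-nil i t (pos a) ¬at eq with i ≟ a
... | yes ≡.refl = contradiction (inj₁ ≡.refl) ¬at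
contract-nil i t (pos a) ¬at () | no _
contract-nil i t (neg a) ¬at eq with i ≟ a
... | yes ≡.refl = contradiction (inj₂ ≡.refl) ¬at
contract-nil i t (neg a) ¬at () | no _

pos-injective : ∀ {k} {i j : Fin k} → pos i ≡ pos j → i ≡ j
pos-injective ≡.refl = ≡.refl

neg-injective : ∀ {k} {i j : Fin k} → neg i ≡ neg j → i ≡ j
neg-injective ≡.refl = ≡.refl

contract-¬at-injective : ∀ {k} i (t : Label k) a b → ¬ At i a → ¬ At i b → contract i t a ≡ contract i t b → a ≡ b
contract-¬at-injective i t nil     b ¬a ¬b eq = ≡.sym (contract-nil i t b ¬b (≡.sym eq))
contract-¬at-injective i t (pos a) nil     ¬a ¬b eq = contract-nil i t (pos a) ¬a eq
contract-¬at-injective i t (neg a) nil     ¬a ¬b eq = contract-nil i t (neg a) ¬a eq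
contract-¬at-injective i t (pos a) (pos b) ¬a ¬b eq with i ≟ a | i ≟ b
... | yes ≡.refl | _          = contradiction (inj₁ ≡.refl) ¬a
... | no _       | yes ≡.refl = contradiction (inj₁ ≡.refl) ¬b
... | no i≢a | no i≢b = ≡.cong pos (≡.trans (≡.sym (punchIn-punchOut i≢a)) (≡.trans (≡.cong (punchIn i) (pos-injective eq)) (punchIn-punchOut i≢b)))
contract-¬at-injective i t (neg a) (neg b) ¬a ¬b eq with i ≟ a | i ≟ b
... | yes ≡.refl | _          = contradiction (inj₂ ≡.refl) ¬a
... | no _       | yes ≡.refl = contradiction (inj₂ ≡.refl) ¬b
... | no i≢a | no i≢b = ≡.cong neg (≡.trans (≡.sym (punchIn-punchOut i≢a)) (≡.trans (≡.cong (punchIn i) (neg-injective eq)) (punchIn-punchOut i≢b)))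
contract-¬at-injective i t (pos a) (neg b) ¬a ¬b eq with i ≟ a | i ≟ b
... | yes ≡.refl | _          = contradiction (inj₁ ≡.refl) ¬a
... | no _       | yes ≡.refl = contradiction (inj₂ ≡.refl) ¬b
contract-¬at-injective i t (pos a) (neg b) ¬a ¬b () | no _ | no _
contract-¬at-injective i t (neg a) (pos b) ¬a ¬b eq with i ≟ a | i ≟ b
... | yes ≡.refl | _          = contradiction (inj₂ ≡.refl) ¬a
... | no _       | yes ≡.refl = contradiction (inj₁ ≡.refl) ¬b
contract-¬at-injective i t (neg a) (pos b) ¬a ¬b () | no _ | no _

self-opposite : ∀ {k} (a : Label k) → a ≡ opposite a → a ≡ nil
self-opposite nil _ = ≡.refl

at≢nil : ∀ {k} {i : Fin k} {a} → At i a → a ≢ nil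
at≢nil (inj₁ ≡.refl) ()
at≢nil (inj₂ ≡.refl) ()

at-opposite : ∀ {k} {i : Fin k} {a} → At i (opposite a) → At i a
at-opposite {a = pos _} (inj₂ ≡.refl) = inj₁ ≡.refl
at-opposite {a = neg _} (inj₁ ≡.refl) = inj₂ ≡.refl

pivot-source : ∀ {k} {a b : Label (suc k)} (p : Pivot a b) → At (pivot-at p) a
pivot-source (single _ at _) = at
pivot-source (double _ at _) = at

-- A double pivot sends its own coordinate to 0, so a surviving common label means that the pivot is
-- single.
pivot-sink : ∀ {k} {a b : Label (suc k)} (p : Pivot a b) → quotient p a ≢ nil → ¬ At (pivot-at p) b
pivot-sink (single _ _ ¬at)             _    at = ¬at at
pivot-sink (double i (inj₁ ≡.refl) opp) ≢nil _  = ≢nil (contract-pos i nil)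
pivot-sink (double i (inj₂ ≡.refl) opp) ≢nil _  = ≢nil (contract-neg i nil)

pivot-opposite : ∀ {k} {a b : Label (suc k)} (p : Pivot a b) → At (pivot-at p) b → b ≡ opposite a
pivot-opposite (single _ _ ¬at) at = contradiction at ¬at
pivot-opposite (double _ _ opp) at = opp

-- Connectivity along a growing set S of base edges, in the base (Lᴮ) and in
-- the cover (L).
record LinkSystem (E X V : Set) : Set₂ where
  field
    σ            : X → X
    σ-involutive : ∀ x → σ (σ x) ≡ x
    π            : X → V
    source sink  : E → X
    live         : E → Bool
    State        : Set₁
    add          : State → E → State
    L            : State → Rel X 0ℓ
    Lᴮ           : State → Rel V 0ℓ
    L-trans      : ∀ S {x y z} → L S x y → L S y z → L S x z
    L-sym        : ∀ S {x y} → L S x y → L S y x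
    L-σ          : ∀ S {x y} → L S x y → L S (σ x) (σ y)
    L-mono       : ∀ S e {x y} → L S x y → L (add S e) x y
    L-edge       : ∀ S e → L (add S e) (source e) (sink e)
    -- The universal property of adding both lifts of an edge: it replaces the inspection of walks
    -- through them.
    L-step       : ∀ S e {A : Set} (φ : X → A) → (∀ x y → L S x y → φ x ≡ φ y) →
                   φ (source e) ≡ φ (sink e) → φ (σ (source e)) ≡ φ (σ (sink e)) →
                   ∀ x y → L (add S e) x y → φ x ≡ φ y
    L-down       : ∀ S {x y} → L S x y → Lᴮ S (π x) (π y)
    L-up         : ∀ S {x y} → Lᴮ S (π x) (π y) → L S x y ⊎ L S (σ x) y
    π-σ          : ∀ x → π (σ x) ≡ π x
    Lᴮ-trans     : ∀ S {u v w} → Lᴮ S u v → Lᴮ S v w → Lᴮ S u w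
    Lᴮ-sym       : ∀ S {u v} → Lᴮ S u v → Lᴮ S v u
    Lᴮ-mono      : ∀ S e {u v} → Lᴮ S u v → Lᴮ (add S e) u v
    Lᴮ-step      : ∀ S e {A : Set} (φ : V → A) → (∀ u v → Lᴮ S u v → φ u ≡ φ v) →
                   φ (π (source e)) ≡ φ (π (sink e)) → ∀ u v → Lᴮ (add S e) u v → φ u ≡ φ v

module Dynamics {E X V : Set} (links : LinkSystem E X V) where
  open LinkSystem links
  open Contraction source sink live

  -- The labels record the components of the cover along S that are not
  -- preserved by σ, one pair of opposite labels for each such pair.
  record Compatible {k} (S : State) (ρ : X → Label k) : Set where
    field
      odd      : ∀ x → ρ (σ x) ≡ opposite (ρ x)
      onto     : ∀ i → ∃ λ x → ρ x ≡ pos i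
      joined   : ∀ x y → ρ x ≡ ρ y → ρ x ≢ nil → L S x y
      doubled  : ∀ x → ρ x ≡ nil → L S x (σ x)
      respects : ∀ x y → L S x y → ρ x ≡ ρ y

  open Compatible

  -- Stated for two ends `x` and `y` rather than for source and sink, since the pivot may sit at
  -- either of them.
  module PivotStep {k} {S : State} {e : E} {ρ : X → Label (suc k)} (c : Compatible S ρ)
    (x y : X) (x~y : L (add S e) x y)
    (step : ∀ {A : Set} (φ : X → A) → (∀ p q → L S p q → φ p ≡ φ q) →
            φ x ≡ φ y → φ (σ x) ≡ φ (σ y) → ∀ p q → L (add S e) p q → φ p ≡ φ q)
    (p : Pivot (ρ x) (ρ y)) where

    private
      S′ = add S e
      i = pivot-at p
      ρ′ = quotient p ∘ ρ
      mono : ∀ {x y} → L S x y → L S′ x y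
      mono = L-mono S e

      at-x : At i (ρ x)
      at-x = pivot-source p

      merged : ρ′ x ≡ ρ′ y
      merged = quotient-merges p

      odd′ : ∀ z → ρ′ (σ z) ≡ opposite (ρ′ z)
      odd′ z = ≡.trans (≡.cong (quotient p) (odd c z)) (contract-opposite i (target p) (ρ z))

      nonnil : ∀ z → ρ′ z ≢ nil → ρ z ≢ nil
      nonnil z ≢nil eq = ≢nil (≡.cong (quotient p) eq)

      σx~σy : L S′ (σ x) (σ y)
      σx~σy = L-σ S′ x~y

      from-x : ∀ z → At i (ρ z) → L S′ z x ⊎ L S′ z (σ x)
      from-x z at with at-both at at-x
      ... | inj₁ same = inj₁ (mono (joined c z x same (at≢nil at)))
      ... | inj₂ opp  = inj₂ (mono (joined c z (σ x) (≡.trans (≡.sym (opposite-involutive (ρ z)))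
                          (≡.trans (≡.cong opposite (≡.sym opp)) (≡.sym (odd c x)))) (at≢nil at)))

      respects′ : ∀ z w → L S′ z w → ρ′ z ≡ ρ′ w
      respects′ = step ρ′ (λ z w l → ≡.cong (quotient p) (respects c z w l)) merged
        (≡.trans (odd′ x) (≡.trans (≡.cong opposite merged) (≡.sym (odd′ y))))

      y-off : ρ′ x ≢ nil → ¬ At i (ρ y)
      y-off = pivot-sink p

      from-y : ∀ w → ¬ At i (ρ w) → ¬ At i (ρ y) → ρ′ y ≡ ρ′ w → ρ′ w ≢ nil → L S′ y w
      from-y w ¬at-w ¬at-y eq ≢nil = mono (joined c y w
        (contract-¬at-injective i (target p) (ρ y) (ρ w) ¬at-y ¬at-w eq) (nonnil y (≢nil ∘ ≡.trans (≡.sym eq))))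

      -- A vertex labelled by the pivot coordinate belongs to the class of `x` or of `σ x`; the new
      -- edge, or its σ-image, continues to `y` or `σ y`, whose label is not affected by the
      -- contraction beyond renumbering.
      mixed : ∀ z w → At i (ρ z) → ¬ At i (ρ w) → ρ′ z ≡ ρ′ w → ρ′ z ≢ nil → L S′ z w
      mixed z w at ¬at eq ≢nil with from-x z at
      ... | inj₁ z~x = L-trans S′ z~x (L-trans S′ x~y (from-y w ¬at (y-off (≢nil ∘ ≡.trans z≡x)) (≡.trans (≡.sym merged) (≡.trans (≡.sym z≡x) eq)) (≢nil ∘ ≡.trans eq)))
        where z≡x = respects′ z x z~x
      ... | inj₂ z~σx = L-trans S′ z~σx (L-trans S′ σx~σy (mono (joined c (σ y) w
              (contract-¬at-injective i (target p) (ρ (σ y)) (ρ w) (λ a → y-off x≢nil (at-opposite (≡.subst (At i) (odd c y) a))) ¬at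
                (≡.trans (≡.sym σ-merged) (≡.trans (≡.sym z≡σx) eq)))
              (nonnil (σ y) (λ σy≡nil → ≢nil (≡.trans z≡σx (≡.trans σ-merged σy≡nil)))))))
        where
        z≡σx = respects′ z (σ x) z~σx
        σ-merged = respects′ (σ x) (σ y) σx~σy
        x≢nil : ρ′ x ≢ nil
        x≢nil eq = ≢nil (≡.trans z≡σx (≡.trans (odd′ x) (≡.cong opposite eq)))

      joined′ : ∀ z w → ρ′ z ≡ ρ′ w → ρ′ z ≢ nil → L S′ z w
      joined′ z w eq ≢nil with at? i (ρ z) | at? i (ρ w)
      ... | inj₁ at-z  | inj₂ ¬at-w = mixed z w at-z ¬at-w eq ≢nil
      ... | inj₂ ¬at-z | inj₁ at-w  = L-sym S′ (mixed w z at-w ¬at-z (≡.sym eq) (≢nil ∘ ≡.trans eq))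
      ... | inj₂ ¬at-z | inj₂ ¬at-w = mono (joined c z w (contract-¬at-injective i (target p) (ρ z) (ρ w) ¬at-z ¬at-w eq) (nonnil z ≢nil))
      ... | inj₁ at-z  | inj₁ at-w with at-both at-z at-w
      ...   | inj₁ same = mono (joined c z w same (at≢nil at-z))
      ... | inj₂ opp  = contradiction (self-opposite (ρ′ z) (≡.trans eq (≡.trans (≡.cong (quotient p) opp) (contract-opposite i (target p) (ρ z))))) ≢nil

      -- Either the class of `y` was already preserved, which gives x ~ y ~ σ y ~ σ x, or the labels
      -- were opposite and `y` is linked to `σ x`.
      loop : ρ′ x ≡ nil → L S′ x (σ x)
      loop x≡nil = case at? i (ρ y) of λ
        { (inj₂ ¬at) → L-trans S′ x~y (L-trans S′ (mono (doubled c y (contract-nil i (target p) (ρ y) ¬at (≡.trans (≡.sym merged) x≡nil)))) (L-sym S′ σx~σy))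
        ; (inj₁ at)  → L-trans S′ x~y (mono (joined c y (σ x) (≡.trans (pivot-opposite p at) (≡.sym (odd c x))) (at≢nil at))) }

      doubled′ : ∀ z → ρ′ z ≡ nil → L S′ z (σ z)
      doubled′ z eq with at? i (ρ z)
      ... | inj₂ ¬at = mono (doubled c z (contract-nil i (target p) (ρ z) ¬at eq))
      ... | inj₁ at with from-x z at
      ... | inj₁ z~x  = L-trans S′ z~x (L-trans S′ (loop (≡.trans (≡.sym (respects′ z x z~x)) eq)) (L-sym S′ (L-σ S′ z~x)))
      ... | inj₂ z~σx = L-trans S′ z~σx (L-trans S′ (L-sym S′ (loop x≡nil)) (L-sym S′ (≡.subst (L S′ (σ z)) (σ-involutive x) (L-σ S′ z~σx))))
        where
        x≡nil : ρ′ x ≡ nil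
        x≡nil = ≡.trans (≡.sym (opposite-involutive (ρ′ x))) (≡.cong opposite (≡.trans (≡.sym (odd′ x)) (≡.trans (≡.sym (respects′ z (σ x) z~σx)) eq)))

    compatible : Compatible S′ ρ′
    compatible = record
      { odd      = odd′
      ; onto     = λ j → let z , eq = onto c (punchIn i j) in z , ≡.trans (≡.cong (quotient p) eq) (contract-pos-punchIn i (target p) j)
      ; joined   = joined′
      ; doubled  = doubled′
      ; respects = respects′
      }

  record Classes (S : State) (q : ℕ) : Set where
    field
      class         : V → Fin q
      rep           : Fin q → V
      class-rep     : ∀ i → class (rep i) ≡ i
      class-respects : ∀ u v → Lᴮ S u v → class u ≡ class v
      to-rep        : ∀ v → Lᴮ S (rep (class v)) v

  open Classes

  classes-keep : ∀ {S q} e → Lᴮ S (π (source e)) (π (sink e)) → Classes S q → Classes (add S e) q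
  classes-keep {S} e linked C = record
    { class = class C ; rep = rep C ; class-rep = class-rep C
    ; class-respects = Lᴮ-step S e (class C) (class-respects C) (class-respects C _ _ linked)
    ; to-rep = λ v → Lᴮ-mono S e (to-rep C v) }

  classes-merge : ∀ {S q} e → ¬ Lᴮ S (π (source e)) (π (sink e)) → Classes S (suc q) → Classes (add S e) q
  classes-merge {S} {q} e ¬linked C = record
    { class = class′ ; rep = rep C ∘ punchIn j
    ; class-rep = λ a → ≡.trans (≡.cong merge (class-rep C (punchIn j a))) (merge-punchIn a)
    ; class-respects = Lᴮ-step S e class′ (λ u v l → ≡.cong merge (class-respects C u v l)) merge-ends
    ; to-rep = to-rep′ }
    where
    x = π (source e)
    y = π (sink e)
    j = class C y
    S′ = add S e
    j≢i : j ≢ class C x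
    j≢i eq = ¬linked (Lᴮ-trans S (Lᴮ-sym S (to-rep C x)) (≡.subst (λ a → Lᴮ S (rep C a) y) eq (to-rep C y)))
    merge : Fin (suc q) → Fin q
    merge a with j ≟ a
    ... | yes _  = punchOut j≢i
    ... | no j≢a = punchOut j≢a
    merge-punchIn : ∀ a → merge (punchIn j a) ≡ a
    merge-punchIn a with j ≟ punchIn j a
    ... | yes eq = contradiction (≡.sym eq) (punchInᵢ≢i j a)
    ... | no ≢   = ≡.trans (punchOut-cong j ≡.refl) (punchOut-punchIn j)
    class′ = merge ∘ class C
    merge-ends : class′ x ≡ class′ y
    merge-ends with j ≟ class C x | j ≟ j
    ... | yes eq | _     = contradiction eq j≢i
    ... | no _   | yes _ = punchOut-cong j ≡.refl
    ... | no _   | no ≢  = contradiction ≡.refl ≢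
    to-rep′ : ∀ v → Lᴮ S′ (rep C (punchIn j (class′ v))) v
    to-rep′ v with j ≟ class C v
    ... | no j≢a = ≡.subst (λ a → Lᴮ S′ (rep C a) v) (≡.sym (punchIn-punchOut j≢a)) (Lᴮ-mono S e (to-rep C v))
    ... | yes eq = Lᴮ-trans S′
      (≡.subst (λ a → Lᴮ S′ (rep C a) x) (≡.sym (punchIn-punchOut j≢i)) (Lᴮ-mono S e (to-rep C x)))
      (Lᴮ-trans S′ (L-down S′ (L-edge S e)) (Lᴮ-mono S e (Lᴮ-trans S (Lᴮ-sym S (to-rep C y))
        (≡.subst (λ a → Lᴮ S (rep C a) v) (≡.sym eq) (to-rep C v)))))

  -- Were the ends linked in the base, `x` or `σ x` would be linked to `y` in the cover, and the
  -- label of `y` would be that of `x` up to sign. So a pivot ±1 merges two components.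
  single-unlinked : ∀ {k} {S} {ρ : X → Label (suc k)} → Compatible S ρ → ∀ {x y i} →
                    At i (ρ x) → ¬ At i (ρ y) → ¬ Lᴮ S (π x) (π y)
  single-unlinked {S = S} {ρ} c {x} {y} at ¬at l with L-up S l
  ... | inj₁ x~y  = ¬at (≡.subst (At _) (respects c _ _ x~y) at)
  ... | inj₂ σx~y = ¬at (at-opposite (≡.subst (At _) (≡.trans (≡.sym (opposite-involutive (ρ x)))
                      (≡.cong opposite (≡.trans (≡.sym (odd c x)) (respects c _ _ σx~y)))) at))

  -- Opposite labels mean that `y` is already linked to `σ x`, so a pivot ±2 merges no components of
  -- the base.
  double-linked : ∀ {k} {S} {ρ : X → Label (suc k)} → Compatible S ρ → ∀ {x y i} →
                  At i (ρ x) → ρ y ≡ opposite (ρ x) → Lᴮ S (π x) (π y)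
  double-linked {S = S} {ρ} c {x} {y} at opp = ≡.subst (λ v → Lᴮ S v (π y)) (π-σ x)
    (L-down S (L-sym S (joined c y (σ x) (≡.trans opp (≡.sym (odd c x)))
      (λ y≡nil → at≢nil at (≡.trans (≡.sym (opposite-involutive (ρ x))) (≡.cong opposite (≡.trans (≡.sym opp) y≡nil)))))))

  accumulate : ∀ {j} → State → Vector E j → Subset j → State
  accumulate S es Vec.[]              = S
  accumulate S es (inside Vec.∷ F)  = accumulate S (es ∘ suc) F
  accumulate S es (outside Vec.∷ F) = accumulate (if live (es zero) then add S (es zero) else S) (es ∘ suc) F

  contracted# : ∀ {j} → Vector E j → Subset j → ℕ
  contracted# es Vec.[]              = 0
  contracted# es (inside Vec.∷ F)  = contracted# (es ∘ suc) F
  contracted# es (outside Vec.∷ F) = if live (es zero) then suc (contracted# (es ∘ suc) F) else contracted# (es ∘ suc) F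

  Legal : ∀ {j} → Vector E j → Subset j → Set
  Legal es Vec.[]              = ⊤
  Legal es (inside Vec.∷ F)  = live (es zero) ≡ true × Legal (es ∘ suc) F
  Legal es (outside Vec.∷ F) = Legal (es ∘ suc) F

  Preserved : State → Set
  Preserved S = ∀ x → L S x (σ x)

  null-compatible : ∀ {k} {S} {ρ : X → Label k} e → Compatible S ρ → ρ (source e) ≡ ρ (sink e) → Compatible (add S e) ρ
  null-compatible {S = S} {ρ} e c eq = record
    { odd = odd c ; onto = onto c
    ; joined = λ x y p q → L-mono S e (joined c x y p q)
    ; doubled = λ x p → L-mono S e (doubled c x p)
    ; respects = L-step S e ρ (respects c) eq (≡.trans (odd c _) (≡.trans (≡.cong opposite eq) (≡.sym (odd c _)))) }

  forward : ∀ {k} {S} {ρ : X → Label (suc k)} e → Compatible S ρ → (p : Pivot (ρ (source e)) (ρ (sink e))) →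
            Compatible (add S e) (quotient p ∘ ρ)
  forward {S = S} e c p = PivotStep.compatible c (source e) (sink e) (L-edge S e) (L-step S e) p

  backward : ∀ {k} {S} {ρ : X → Label (suc k)} e → Compatible S ρ → (p : Pivot (ρ (sink e)) (ρ (source e))) →
             Compatible (add S e) (quotient p ∘ ρ)
  backward {S = S} e c p = PivotStep.compatible c (sink e) (source e) (L-sym (add S e) (L-edge S e))
    (λ φ inv eq σeq → L-step S e φ inv (≡.sym eq) (≡.sym σeq)) p

  -- In a preserved final state no coordinate is left, since `x` linked to `σ x` makes its label
  -- equal to the opposite one. Each contracted edge removes at most one coordinate.
  contraction-bound : ∀ {j} (es : Vector E j) F {k} {S} {ρ : X → Label k} → Compatible S ρ →
                      Preserved (accumulate S es F) → k ℕ.≤ contracted# es F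
  contraction-bound es F {zero} c pres = z≤n
  contraction-bound es Vec.[] {suc k} {S} {ρ} c pres with onto c zero
  ... | x , eq = contradiction (self-opposite (ρ x) (≡.trans (respects c x (σ x) (pres x)) (odd c x)))
    (λ nil≡ → at≢nil (inj₁ eq) nil≡)
  contraction-bound es (inside Vec.∷ F) {suc k} c pres = contraction-bound (es ∘ suc) F c pres
  contraction-bound es (outside Vec.∷ F) {suc k} {S} {ρ} c pres with live (es zero)
  ... | false = contraction-bound (es ∘ suc) F c pres
  ... | true with classify (ρ (source (es zero))) (ρ (sink (es zero)))
  ... | inj₁ eq = ℕ.m≤n⇒m≤1+n (contraction-bound (es ∘ suc) F (null-compatible (es zero) c eq) pres)
  ...   | inj₂ (inj₁ p) = s≤s (contraction-bound (es ∘ suc) F (forward (es zero) c p) pres)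
  ...   | inj₂ (inj₂ p) = s≤s (contraction-bound (es ∘ suc) F (backward (es zero) c p) pres)

  -- There are exactly as many contracted edges as coordinates, so none can be wasted: if the ends
  -- of an edge had equal labels, the remaining edges would violate `contraction-bound`.
  exponent-complete : ∀ {j} (es : Vector E j) F {k} {S} {ρ : X → Label k} → Compatible S ρ →
    Preserved (accumulate S es F) → Legal es F → contracted# es F ≡ k → ∃ λ s → exponent ρ es F ≡ just s
  exponent-complete es Vec.[] c pres legal ≡.refl = 0 , ≡.refl
  exponent-complete es (inside Vec.∷ F) c pres (alive , legal) eq rewrite alive =
    exponent-complete (es ∘ suc) F c pres legal eq
  exponent-complete es (outside Vec.∷ F) {S = S} {ρ} c pres legal eq with live (es zero)
  ... | false = exponent-complete (es ∘ suc) F c pres legal eq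
  exponent-complete es (outside Vec.∷ F) {suc k} {S} {ρ} c pres legal eq | true
    with classify (ρ (source (es zero))) (ρ (sink (es zero)))
  ... | inj₁ null = contradiction (contraction-bound (es ∘ suc) F (null-compatible (es zero) c null) pres)
                      (ℕ.<⇒≱ (ℕ.≤-reflexive eq))
  ... | inj₂ (inj₁ p) with exponent-complete (es ∘ suc) F (forward (es zero) c p) pres legal (ℕ.suc-injective eq)
  ...   | s , exp = multiplicity p ℕ.+ s , ≡.cong (Maybe.map (multiplicity p ℕ.+_)) exp
  exponent-complete es (outside Vec.∷ F) {suc k} {S} {ρ} c pres legal eq | true | inj₂ (inj₂ p)
    with exponent-complete (es ∘ suc) F (backward (es zero) c p) pres legal (ℕ.suc-injective eq)
  ...   | s , exp = multiplicity p ℕ.+ s , ≡.cong (Maybe.map (multiplicity p ℕ.+_)) exp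

  map-just : ∀ m (x : Maybe ℕ) {s} → Maybe.map (m ℕ.+_) x ≡ just s → ∃ λ s′ → x ≡ just s′ × s ≡ m ℕ.+ s′
  map-just m (just s′) ≡.refl = s′ , ≡.refl , ≡.refl

  -- The number of base components drops by one at a pivot ±1 and stays at a pivot ±2, whereas one
  -- coordinate disappears in both cases.
  pivot-classes : ∀ {k} {S} {ρ : X → Label (suc k)} → Compatible S ρ → ∀ e {x y}
    (p : Pivot (ρ x) (ρ y)) → (x ≡ source e × y ≡ sink e ⊎ x ≡ sink e × y ≡ source e) →
    ∀ q → Classes S q → ∃ λ q′ → Classes (add S e) q′ × suc q′ ≡ q ℕ.+ multiplicity p
  pivot-classes {S = S} c e (double i at opp) ends q C = q , classes-keep e (orient ends (double-linked c at opp)) C , ≡.sym (ℕ.+-comm q 1)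
    where
    orient : ∀ {x y} → (x ≡ source e × y ≡ sink e ⊎ x ≡ sink e × y ≡ source e) → Lᴮ S (π x) (π y) → Lᴮ S (π (source e)) (π (sink e))
    orient (inj₁ (≡.refl , ≡.refl)) l = l
    orient (inj₂ (≡.refl , ≡.refl)) l = Lᴮ-sym S l
  pivot-classes {S = S} c e {x} (single i at ¬at) ends zero    C with class C (π x)
  ... | ()
  pivot-classes {S = S} c e (single i at ¬at) ends (suc q) C = q , classes-merge e (λ l → single-unlinked c at ¬at (orient ends l)) C
    , ≡.cong suc (≡.sym (ℕ.+-identityʳ q))
    where
    orient : ∀ {x y} → (x ≡ source e × y ≡ sink e ⊎ x ≡ sink e × y ≡ source e) → Lᴮ S (π (source e)) (π (sink e)) → Lᴮ S (π x) (π y)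
    orient (inj₁ (≡.refl , ≡.refl)) l = l
    orient (inj₂ (≡.refl , ≡.refl)) l = Lᴮ-sym S l

  -- The last clause carries the rank: starting from k = n and q = d + n, it leaves d + s
  -- components.
  Sound : ∀ {j} → Vector E j → Subset j → ℕ → State → ℕ → Set
  Sound es F k S s = Preserved (accumulate S es F) × Legal es F × contracted# es F ≡ k ×
    (∀ q → Classes S q → ∃ λ q′ → Classes (accumulate S es F) q′ × q′ ℕ.+ k ≡ q ℕ.+ s)

  exponent-sound : ∀ {j} (es : Vector E j) F {k} {S} {ρ : X → Label k} → Compatible S ρ →
                   ∀ {s} → exponent ρ es F ≡ just s → Sound es F k S s
  exponent-sound es Vec.[] {zero} {S} {ρ} c ≡.refl =
    (λ x → doubled c x (empty (ρ x))) , tt , ≡.refl , λ q C → q , C , ≡.refl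
    where
    empty : (a : Label 0) → a ≡ nil
    empty nil = ≡.refl
  exponent-sound es (inside Vec.∷ F) {ρ = ρ} c exp with live (es zero)
  ... | true with exponent-sound (es ∘ suc) F c exp
  ...   | pres , legal , eq , cl = pres , (≡.refl , legal) , eq , cl
  exponent-sound es (outside Vec.∷ F) {S = S} {ρ} c exp with live (es zero)
  ... | false = exponent-sound (es ∘ suc) F c exp
  ... | true with classify (ρ (source (es zero))) (ρ (sink (es zero)))
  exponent-sound es (outside Vec.∷ F) {suc k} {S} {ρ} c exp | true | inj₂ (inj₁ p)
    with map-just (multiplicity p) (exponent (quotient p ∘ ρ) (es ∘ suc) F) exp
  ... | s′ , exp′ , ≡.refl with exponent-sound (es ∘ suc) F (forward (es zero) c p) exp′
  ...   | pres , legal , eq , cl = pres , legal , ≡.cong suc eq , λ q C →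
    let q₁ , C₁ , e₁ = pivot-classes c (es zero) p (inj₁ (≡.refl , ≡.refl)) q C
        q₂ , C₂ , e₂ = cl q₁ C₁
    in q₂ , C₂ , total q q₁ q₂ e₁ e₂
    where
    total : ∀ q q₁ q₂ → suc q₁ ≡ q ℕ.+ multiplicity p → q₂ ℕ.+ k ≡ q₁ ℕ.+ s′ → q₂ ℕ.+ suc k ≡ q ℕ.+ (multiplicity p ℕ.+ s′)
    total q q₁ q₂ e₁ e₂ = ≡.trans (ℕ.+-suc q₂ k) (≡.trans (≡.cong suc e₂) (≡.trans (≡.cong (ℕ._+ s′) e₁) (ℕ.+-assoc q _ s′)))
  exponent-sound es (outside Vec.∷ F) {suc k} {S} {ρ} c exp | true | inj₂ (inj₂ p)
    with map-just (multiplicity p) (exponent (quotient p ∘ ρ) (es ∘ suc) F) exp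
  ... | s′ , exp′ , ≡.refl with exponent-sound (es ∘ suc) F (backward (es zero) c p) exp′
  ...   | pres , legal , eq , cl = pres , legal , ≡.cong suc eq , λ q C →
    let q₁ , C₁ , e₁ = pivot-classes c (es zero) p (inj₂ (≡.refl , ≡.refl)) q C
        q₂ , C₂ , e₂ = cl q₁ C₁
    in q₂ , C₂ , total q q₁ q₂ e₁ e₂
    where
    total : ∀ q q₁ q₂ → suc q₁ ≡ q ℕ.+ multiplicity p → q₂ ℕ.+ k ≡ q₁ ℕ.+ s′ → q₂ ℕ.+ suc k ≡ q ℕ.+ (multiplicity p ℕ.+ s′)
    total q q₁ q₂ e₁ e₂ = ≡.trans (ℕ.+-suc q₂ k) (≡.trans (≡.cong suc e₂) (≡.trans (≡.cong (ℕ._+ s′) e₁) (ℕ.+-assoc q _ s′)))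

module _ {G : Graph} where
  open Graph G

  linked-mono : ∀ {S S′ : Subgraph G} → (∀ e → E∈ S e → E∈ S′ e) → ∀ {u v} → Linked S u v → Linked S′ u v
  linked-mono S⊆S′ = gmap id λ (h , e∈ , p) → h , S⊆S′ (edge h) e∈ , p

  #components-Components : ∀ (S : Subgraph G) → Components S (#components S)
  #components-Components S = record
    { rep      = List.lookup reps
    ; rep∈ = λ i → proj₂ (∈-filter⁻ (V∈? S) {xs = List.allFin #V} (∈-deduplicate⁻ (linked? S) _ (∈-lookup i)))
    ; index    = λ v v∈ → Any.index (represented v v∈)
    ; to-rep   = λ v v∈ → Any.lookup-index (represented v v∈)
    ; distinct = lookup-distinct reps (deduplicate-! linkedness _)
    }
    where
    linkedness : DecSetoid _ _
    linkedness = record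
      { Carrier = V ; _≈_ = Linked S
      ; isDecEquivalence = record
          { isEquivalence = record { refl = ε ; sym = linked-sym S ; trans = _◅◅_ } ; _≟_ = linked? S } }
    reps : List V
    reps = List.deduplicate (linked? S) (List.filter (V∈? S) (List.allFin #V))
    represented : ∀ v → V∈ S v → Any (λ u → Linked S u v) reps
    represented v v∈ = Any.deduplicate⁺ (linked? S) (λ l p → l ◅◅ p)
      (Any.map (λ { ≡.refl → ε }) (∈-filter⁺ (V∈? S) (∈-allFin v) v∈))
    lookup-distinct : ∀ xs → AllPairs (λ u v → ¬ Linked S u v) xs → ∀ i j → Linked S (List.lookup xs i) (List.lookup xs j) → i ≡ j
    lookup-distinct (x List.∷ xs) _               zero    zero    l = ≡.refl
    lookup-distinct (x List.∷ xs) (p AllPairs.∷ _) zero (suc j) l = contradiction l (All.lookup p (∈-lookup j))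
    lookup-distinct (x List.∷ xs) (p AllPairs.∷ _) (suc i) zero l = contradiction (linked-sym S l) (All.lookup p (∈-lookup i))
    lookup-distinct (x List.∷ xs) (_ AllPairs.∷ ps) (suc i) (suc j) l = ≡.cong suc (lookup-distinct xs ps i j l)

module Ogods {c ℓ₁ ℓ₂} {𝔽 : OrderedField c ℓ₁ ℓ₂} {Γ̃ Γ : MetricGraph 𝔽}
         (π : DoubleCover Γ̃ Γ) (o : CompatibleOrientations π) where
  open DoubleCover π
  open CompatibleOrientations o
  open CoverStructure π o
  open Chains π o
  open Orientation
  module LV = FoldingLabels foldingV

  private
    Γdil : Subgraph B.graph
    Γdil = dilationSubgraph π

  addEdge : Subgraph B.graph → B.E → Subgraph B.graph
  addEdge S e = record
    { V∈     = Unary.U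
    ; E∈     = λ x → E∈ S x ⊎ x ≡ e
    ; V∈?    = U?
    ; E∈?    = λ x → E∈? S x ⊎-dec (x ≟ e)
    ; closed = _
    }

  ends-agree : ∀ {A : Set} (φ : T.V → A) ẽ → φ (source ẽ) ≡ φ (sink ẽ) → ∀ h̃ → T.edge h̃ ≡ ẽ → φ (T.r h̃) ≡ φ (T.r (T.ι h̃))
  ends-agree φ ẽ eq h̃ ≡.refl with Equivalence.to (T.edge-orbit h̃ (out upper (T.edge h̃))) (≡.sym (edge-out upper (T.edge h̃)))
  ... | inj₁ p = ≡.trans (≡.cong (φ ∘ T.r) p) (≡.trans eq (≡.cong (φ ∘ T.r ∘ T.ι) (≡.sym p)))
  ... | inj₂ p = ≡.trans (≡.cong (φ ∘ T.r) p) (≡.trans (≡.sym eq) (≡.cong (φ ∘ T.r) (≡.trans (≡.sym (T.ι-involutive _)) (≡.cong T.ι (≡.sym p)))))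

  ends-agreeᴮ : ∀ {A : Set} (φ : B.V → A) ẽ → φ (πV (source ẽ)) ≡ φ (πV (sink ẽ)) → ∀ h → B.edge h ≡ πE ẽ → φ (B.r h) ≡ φ (B.r (B.ι h))
  ends-agreeᴮ φ ẽ eq h p with Equivalence.to (B.edge-orbit h h₀) (≡.trans p (≡.trans (≡.cong πE (≡.sym (edge-out upper ẽ))) (πE-edge _)))
    where h₀ = πH (out upper ẽ)
  ... | inj₁ ≡.refl = ≡.trans (≡.cong φ (πH-r _)) (≡.trans eq (≡.cong φ (≡.trans (≡.sym (πH-r _)) (≡.cong B.r (πH-ι _)))))
  ... | inj₂ ≡.refl = ≡.trans (≡.cong φ (≡.trans (≡.cong B.r (≡.sym (πH-ι _))) (πH-r _)))
    (≡.trans (≡.sym eq) (≡.cong φ (≡.trans (≡.sym (πH-r _)) (≡.cong B.r (≡.sym (B.ι-involutive _))))))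

  links : LinkSystem B.E T.V B.V
  links = record
    { σ            = FV.σ
    ; σ-involutive = FV.σ-involutive
    ; π            = πV
    ; source       = source ∘ FE.lift
    ; sink         = sink ∘ FE.lift
    ; live         = FE.live
    ; State        = Subgraph B.graph
    ; add          = addEdge
    ; L            = λ S → Linked (preimage π S)
    ; Lᴮ           = λ S → Linked S
    ; L-trans      = λ S → _◅◅_
    ; L-sym        = λ S → linked-sym (preimage π S)
    ; L-σ          = λ S → linked-σ S
    ; L-mono       = λ S e → linked-mono {S = preimage π S} {preimage π (addEdge S e)} (λ _ → inj₁)
    ; L-edge = λ S e → (out upper (FE.lift e) , inj₂ (≡.trans (≡.cong πE (edge-out upper _)) (FE.proj-lift e)) , ≡.refl , ≡.refl) ◅ ε
    ; L-step       = λ S e φ inv eq eqσ x y → step S e φ inv eq eqσ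
    ; L-down       = λ S → linked-down S
    ; L-up         = up
    ; π-σ          = FV.proj-σ
    ; Lᴮ-trans     = λ S → _◅◅_
    ; Lᴮ-sym       = λ S → linked-sym S
    ; Lᴮ-mono      = λ S e → linked-mono {S = S} {addEdge S e} (λ _ → inj₁)
    ; Lᴮ-step      = λ S e φ inv eq u v → stepᴮ S e φ inv eq
    }
    where
    up : ∀ S {x y} → Linked S (πV x) (πV y) → Linked (preimage π S) x y ⊎ Linked (preimage π S) (FV.σ x) y
    up S {x} l with linked-up S l ≡.refl
    ... | x′ , p , l′ with FV.fibre {x} {x′} (≡.sym p)
    ...   | inj₁ ≡.refl = inj₁ l′
    ...   | inj₂ ≡.refl = inj₂ l′
    step : ∀ S e {A : Set} (φ : T.V → A) → (∀ x y → Linked (preimage π S) x y → φ x ≡ φ y) →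
           φ (source (FE.lift e)) ≡ φ (sink (FE.lift e)) → φ (FV.σ (source (FE.lift e))) ≡ φ (FV.σ (sink (FE.lift e))) →
           ∀ {x y} → Linked (preimage π (addEdge S e)) x y → φ x ≡ φ y
    step S e φ inv eq eqσ ε = ≡.refl
    step S e φ inv eq eqσ ((h̃ , inj₁ e∈ , ≡.refl , ≡.refl) ◅ l) =
      ≡.trans (inv _ _ ((h̃ , e∈ , ≡.refl , ≡.refl) ◅ ε)) (step S e φ inv eq eqσ l)
    step S e φ inv eq eqσ ((h̃ , inj₂ πh̃ , ≡.refl , ≡.refl) ◅ l) = ≡.trans
      (case FE.fibre {FE.lift e} {T.edge h̃} (≡.trans (FE.proj-lift e) (≡.sym πh̃)) of λ
        { (inj₁ p) → ends-agree φ (FE.lift e) eq h̃ p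
        ; (inj₂ p) → ends-agree φ (σᴱ (FE.lift e)) (≡.trans (≡.cong φ (source-σ _)) (≡.trans eqσ (≡.cong φ (≡.sym (sink-σ _))))) h̃ p })
      (step S e φ inv eq eqσ l)
    stepᴮ : ∀ S e {A : Set} (φ : B.V → A) → (∀ u v → Linked S u v → φ u ≡ φ v) →
            φ (πV (source (FE.lift e))) ≡ φ (πV (sink (FE.lift e))) →
            ∀ {u v} → Linked (addEdge S e) u v → φ u ≡ φ v
    stepᴮ S e φ inv eq ε = ≡.refl
    stepᴮ S e φ inv eq ((h , inj₁ e∈ , ≡.refl , ≡.refl) ◅ l) =
      ≡.trans (inv _ _ ((h , e∈ , ≡.refl , ≡.refl) ◅ ε)) (stepᴮ S e φ inv eq l)
    stepᴮ S e φ inv eq ((h , inj₂ h≡e , ≡.refl , ≡.refl) ◅ l) =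
      ≡.trans (ends-agreeᴮ φ (FE.lift e) eq h (≡.trans h≡e (≡.sym (FE.proj-lift e)))) (stepᴮ S e φ inv eq l)

  module Dyn = Dynamics links
  open Dyn using (Compatible; Classes; accumulate; contracted#; Legal; Preserved)

  -- The initial state. Ogods contain no dilated edge, so these are present from the beginning;
  -- unlike the dilation subgraph, it keeps all vertices.
  dilatedEdges : Subgraph B.graph
  dilatedEdges = record { V∈ = Unary.U ; E∈ = DilatedE π ; V∈? = U? ; E∈? = dilatedE? π ; closed = _ }

  initial-compatible : Compatible dilatedEdges LV.label
  initial-compatible = record
    { odd      = LV.label-odd
    ; onto     = λ i → LV.ν i , LV.label-ν i
    ; joined = λ x y eq ≢nil → ≡.subst (Linked (preimage π dilatedEdges) x) (LV.label-injective x y eq ≢nil) ε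
    ; doubled  = λ x eq → ≡.subst (Linked (preimage π dilatedEdges) x) (≡.sym (LV.label-nil x eq)) ε
    ; respects = λ x y → respects
    }
    where
    nil-end : ∀ h̃ → DilatedE π (πE (T.edge h̃)) → LV.label (T.r h̃) ≡ nil
    nil-end h̃ dil = LV.label-fixed (T.r h̃) (dilatedV⇒fixed (≡.subst (DilatedV π) (πH-r h̃)
      (closed Γdil (πH h̃) (≡.subst (DilatedE π) (πE-edge h̃) dil))))
    respects : ∀ {x y} → Linked (preimage π dilatedEdges) x y → LV.label x ≡ LV.label y
    respects ε = ≡.refl
    respects ((h̃ , dil , ≡.refl , ≡.refl) ◅ l) = ≡.trans
      (≡.trans (nil-end h̃ dil) (≡.sym (nil-end (T.ι h̃) (≡.subst (DilatedE π ∘ πE) (≡.sym (T.edge-ι h̃)) dil)))) (respects l)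

  -- Dilated edges have dilated ends, so each undilated vertex forms a class of its own, next to the
  -- `d` dilated components.
  initial-classes : ∀ {d} → Components Γdil d → Classes dilatedEdges (d ℕ.+ FV.#free)
  initial-classes {d} K = record
    { class          = class
    ; rep            = rep′
    ; class-rep      = class-rep
    ; class-respects = λ u v → respects
    ; to-rep         = to-rep′
    }
    where
    open Components K
    n = FV.#free
    alive : ∀ {v} → ¬ DilatedV π v → FV.live v ≡ true
    alive {v} ¬dil with FV.live v in eq
    ... | true  = ≡.refl
    ... | false = contradiction (≡.subst (DilatedV π) (FV.proj-lift v) (fixed⇒dilatedV (FV.fixed (≡.trans (≡.cong FV.live (FV.proj-lift v)) eq)))) ¬dil
    dead : ∀ {v} → FV.live v ≡ true → ¬ DilatedV π v
    dead {v} live dil = FV.free (≡.trans (≡.cong FV.live (FV.proj-lift v)) live)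
      (dilatedV⇒fixed (≡.subst (DilatedV π) (≡.sym (FV.proj-lift v)) dil))
    place : ∀ v → Dec (DilatedV π v) → Fin (d ℕ.+ n)
    place v (yes dil) = index v dil ↑ˡ n
    place v (no ¬dil) = d ↑ʳ proj₁ (enumerate-surjective FV.live (alive ¬dil))
    class : B.V → Fin (d ℕ.+ n)
    class v = place v (dilatedV? π v)
    choose : Fin d ⊎ Fin n → B.V
    choose (inj₁ i) = rep i
    choose (inj₂ j) = enumerate FV.live j
    rep′ : Fin (d ℕ.+ n) → B.V
    rep′ a = choose (splitAt d a)
    rep-ˡ : ∀ i → rep′ (i ↑ˡ n) ≡ rep i
    rep-ˡ i = ≡.cong choose (splitAt-↑ˡ d i n)
    rep-ʳ : ∀ j → rep′ (d ↑ʳ j) ≡ enumerate FV.live j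
    rep-ʳ j = ≡.cong choose (splitAt-↑ʳ d n j)
    place-rep : ∀ i (d? : Dec (DilatedV π (rep i))) → place (rep i) d? ≡ i ↑ˡ n
    place-rep i (yes dil) = ≡.cong (_↑ˡ n) (distinct _ _ (to-rep (rep i) dil))
    place-rep i (no ¬dil) = contradiction (rep∈ i) ¬dil
    place-live : ∀ j (d? : Dec (DilatedV π (enumerate FV.live j))) → place (enumerate FV.live j) d? ≡ d ↑ʳ j
    place-live j (yes dil) = contradiction dil (dead (enumerate-true FV.live j))
    place-live j (no ¬dil) = ≡.cong (d ↑ʳ_) (enumerate-injective FV.live (proj₂ (enumerate-surjective FV.live (alive ¬dil))))
    class-rep : ∀ a → class (rep′ a) ≡ a
    class-rep a with splitAt d a in eq
    ... | inj₁ i = ≡.trans (place-rep i (dilatedV? π (rep i))) (splitAt⁻¹-↑ˡ eq)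
    ... | inj₂ j = ≡.trans (place-live j (dilatedV? π (enumerate FV.live j))) (splitAt⁻¹-↑ʳ eq)
    place-linked : ∀ {u v} → DilatedV π u → DilatedV π v → Linked Γdil u v →
                   (u? : Dec (DilatedV π u)) (v? : Dec (DilatedV π v)) → place u u? ≡ place v v?
    place-linked {u} {v} u∈ v∈ l (yes p) (yes q) = ≡.cong (_↑ˡ n) (distinct _ _ (to-rep u p ◅◅ (l ◅◅ linked-sym Γdil (to-rep v q))))
    place-linked u∈ v∈ l (no ¬p) _ = contradiction u∈ ¬p
    place-linked u∈ v∈ l _ (no ¬q) = contradiction v∈ ¬q
    respects : ∀ {u v} → Linked dilatedEdges u v → class u ≡ class v
    respects ε = ≡.refl
    respects ((h , dil , ≡.refl , ≡.refl) ◅ l) = ≡.trans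
      (place-linked (closed Γdil h dil) (closed Γdil (B.ι h) (≡.subst (DilatedE π) (≡.sym (B.edge-ι h)) dil))
        ((h , dil , ≡.refl , ≡.refl) ◅ ε) (dilatedV? π _) (dilatedV? π _)) (respects l)
    place-to-rep : ∀ v (v? : Dec (DilatedV π v)) → Linked dilatedEdges (rep′ (place v v?)) v
    place-to-rep v (yes p) = ≡.subst (λ u → Linked dilatedEdges u v) (≡.sym (rep-ˡ (index v p))) (linked-mono {S = Γdil} {dilatedEdges} (λ _ → id) (to-rep v p))
    place-to-rep v (no ¬p) = ≡.subst (λ u → Linked dilatedEdges u v)
      (≡.sym (≡.trans (rep-ʳ _) (proj₂ (enumerate-surjective FV.live (alive ¬p))))) ε
    to-rep′ : ∀ v → Linked dilatedEdges (rep′ (class v)) v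
    to-rep′ v = place-to-rep v (dilatedV? π v)

  classes-count : ∀ {S S′ : Subgraph B.graph} {q q′} → (∀ v → V∈ S′ v) → (∀ e → E∈ S e → E∈ S′ e) → (∀ e → E∈ S′ e → E∈ S e) →
                  Classes S q → Components S′ q′ → q ≡ q′
  classes-count {S} {S′} {q} {q′} full to from C K = ℕ.≤-antisym
    (injective⇒≤ {f = λ i → index (Classes.rep C i) (full _)} λ {i} {j} eq →
      ≡.trans (≡.sym (Classes.class-rep C i)) (≡.trans (Classes.class-respects C _ _
        (linked-mono {S = S′} {S} from (linked-sym S′ (to-rep _ (full _)) ◅◅ ≡.subst (λ a → Linked S′ (rep a) (Classes.rep C j)) (≡.sym eq) (to-rep _ (full _)))))
        (Classes.class-rep C j)))
    (injective⇒≤ {f = λ i → Classes.class C (rep i)} λ {i} {j} eq → distinct i j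
      (linked-mono {S = S} {S′} to (linked-sym S (Classes.to-rep C (rep i)) ◅◅ ≡.subst (λ a → Linked S (Classes.rep C a) (rep j)) (≡.sym eq) (Classes.to-rep C (rep j)))))
    where open Components K

  accumulate-to : ∀ {j} S (es : Vector B.E j) F x → E∈ (accumulate S es F) x →
                  E∈ S x ⊎ ∃ λ i → i ∉ F × es i ≡ x
  accumulate-to S es Vec.[] x x∈ = inj₁ x∈
  accumulate-to S es (inside Vec.∷ F) x x∈ = case accumulate-to S (es ∘ suc) F x x∈ of λ
    { (inj₁ x∈S) → inj₁ x∈S ; (inj₂ (i , i∉ , eq)) → inj₂ (suc i , i∉ ∘ drop-there , eq) }
  accumulate-to S es (outside Vec.∷ F) x x∈ with FE.live (es zero)
  ... | false = case accumulate-to S (es ∘ suc) F x x∈ of λ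
    { (inj₁ x∈S) → inj₁ x∈S ; (inj₂ (i , i∉ , eq)) → inj₂ (suc i , i∉ ∘ drop-there , eq) }
  ... | true = case accumulate-to (addEdge S (es zero)) (es ∘ suc) F x x∈ of λ
    { (inj₁ (inj₁ x∈S)) → inj₁ x∈S ; (inj₁ (inj₂ x≡)) → inj₂ (zero , (λ ()) , ≡.sym x≡)
    ; (inj₂ (i , i∉ , eq)) → inj₂ (suc i , i∉ ∘ drop-there , eq) }

  accumulate-⊇ : ∀ {j} S (es : Vector B.E j) F x → E∈ S x → E∈ (accumulate S es F) x
  accumulate-⊇ S es Vec.[] x x∈ = x∈
  accumulate-⊇ S es (inside Vec.∷ F) x x∈ = accumulate-⊇ S (es ∘ suc) F x x∈
  accumulate-⊇ S es (outside Vec.∷ F) x x∈ with FE.live (es zero)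
  ... | false = accumulate-⊇ S (es ∘ suc) F x x∈
  ... | true  = accumulate-⊇ (addEdge S (es zero)) (es ∘ suc) F x (inj₁ x∈)

  accumulate-from : ∀ {j} S (es : Vector B.E j) F i → i ∉ F → FE.live (es i) ≡ true → E∈ (accumulate S es F) (es i)
  accumulate-from S es (inside Vec.∷ F)  zero    i∉ alive = contradiction Vec.here i∉
  accumulate-from S es (outside Vec.∷ F) zero i∉ alive rewrite alive = accumulate-⊇ (addEdge S (es zero)) (es ∘ suc) F (es zero) (inj₂ ≡.refl)
  accumulate-from S es (inside Vec.∷ F)  (suc i) i∉ alive = accumulate-from S (es ∘ suc) F i (i∉ ∘ Vec.there) alive
  accumulate-from S es (outside Vec.∷ F) (suc i) i∉ alive = accumulate-from _ (es ∘ suc) F i (i∉ ∘ Vec.there) alive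

  legal-member : ∀ {j} (es : Vector B.E j) F → Legal es F → ∀ i → i ∈ F → FE.live (es i) ≡ true
  legal-member es (inside Vec.∷ F)  (alive , _) zero    i∈ = alive
  legal-member es (inside Vec.∷ F)  (_ , legal) (suc i) i∈ = legal-member (es ∘ suc) F legal i (drop-there i∈)
  legal-member es (outside Vec.∷ F) legal (suc i) i∈ = legal-member (es ∘ suc) F legal i (drop-there i∈)

  legal-intro : ∀ {j} (es : Vector B.E j) F → (∀ i → i ∈ F → FE.live (es i) ≡ true) → Legal es F
  legal-intro es Vec.[]              _ = tt
  legal-intro es (inside Vec.∷ F)  p = p zero Vec.here , legal-intro (es ∘ suc) F (λ i i∈ → p (suc i) (Vec.there i∈))
  legal-intro es (outside Vec.∷ F) p = legal-intro (es ∘ suc) F (λ i i∈ → p (suc i) (Vec.there i∈))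

  -- By `edge-count` there are h + n undilated edges, so a set without dilated edges has `h`
  -- elements exactly if n edges are contracted, one for each initial coordinate.
  count-edges : ∀ {j} (es : Vector B.E j) F → Legal es F → ∣ F ∣ ℕ.+ contracted# es F ≡ count (FE.live ∘ es)
  count-edges es Vec.[]              legal = ≡.refl
  count-edges es (inside Vec.∷ F)  (alive , legal) rewrite alive = ≡.cong suc (count-edges (es ∘ suc) F legal)
  count-edges es (outside Vec.∷ F) legal with FE.live (es zero)
  ... | true  = ≡.trans (ℕ.+-suc ∣ F ∣ _) (≡.cong suc (count-edges (es ∘ suc) F legal))
  ... | false = count-edges (es ∘ suc) F legal

  module _ (F : Subset B.#E) where

    private
      S′ = accumulate dilatedEdges id F

    accumulate⇔∖ : Legal id F → (∀ e → E∈ S′ e → e ∉ F) × (∀ e → e ∉ F → E∈ S′ e)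
    accumulate⇔∖ legal = (λ e e∈ e∈F → case accumulate-to dilatedEdges id F e e∈ of λ
        { (inj₁ dil) → contradiction (≡.trans (≡.sym (legal-member id F legal e e∈F)) (dilatedE⇒dead dil)) λ ()
        ; (inj₂ (i , i∉ , ≡.refl)) → i∉ e∈F })
      , λ e e∉ → from e e∉ (FE.live e) ≡.refl
      where
      from : ∀ e → e ∉ F → ∀ b → FE.live e ≡ b → E∈ S′ e
      from e e∉ true  eq = accumulate-from dilatedEdges id F e e∉ eq
      from e e∉ false eq = accumulate-⊇ dilatedEdges id F e (dead⇒dilatedE eq)

    private
      S″ = B.graph ∖ F

      restrict : ∀ v {x y} → Linked S″ v (πV x) → Linked (preimage π S″) x y → Linked (preimage π (component S″ v)) x y
      restrict v l ε = ε
      restrict v l (a@(h̃ , e∈ , ≡.refl , ≡.refl) ◅ p) =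
        (h̃ , (e∈ , πH h̃ , ≡.sym (πE-edge h̃) , ≡.subst (Linked S″ v) (≡.sym (πH-r h̃)) l) , ≡.refl , ≡.refl)
        ◅ restrict v (l ◅◅ (adjacent-down S″ a ◅ ε)) p

    connected⇒preserved : (∀ v → Connected (preimage π (component S″ v))) → Preserved S″
    connected⇒preserved conn x = linked-mono {S = preimage π (component S″ (πV x))} {preimage π S″} (λ _ → proj₁)
      (conn (πV x) x (FV.σ x) (tt , ε) (tt , ≡.subst (Linked S″ (πV x)) (≡.sym (FV.proj-σ x)) ε))

    -- A walk in the base lifts to one that ends at `y` and starts at `x` or at `σ x`, and these two
    -- are linked by assumption.
    preserved⇒connected : Preserved S″ → ∀ v → Connected (preimage π (component S″ v))
    preserved⇒connected pres v x y (_ , v~x) (_ , v~y) = restrict v v~x (join (linked-up S″ (linked-sym S″ v~x ◅◅ v~y) ≡.refl))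
      where
      join : (∃ λ x′ → πV x′ ≡ πV x × Linked (preimage π S″) x′ y) → Linked (preimage π S″) x y
      join (x′ , p , l) with FV.fibre {x} {x′} (≡.sym p)
      ... | inj₁ ≡.refl = l
      ... | inj₂ ≡.refl = pres x ◅◅ l

    module _ (h : ℕ) (h-spec : + h ≡ relGenus π) (#edges : h ℕ.+ FV.#free ≡ FE.#free) where

      open Contraction (source ∘ FE.lift) (sink ∘ FE.lift) FE.live using (exponent)

      ogod⇒exponent : Ogod π F → ∃ λ s → exponent LV.label id F ≡ just s
      ogod⇒exponent (size , undilated , conn) = Dyn.exponent-complete id F initial-compatible
        (λ x → linked-mono {S = preimage π S″} {preimage π S′} (λ e → proj₂ (accumulate⇔∖ legal) (πE e)) (connected⇒preserved conn x))
        legal (ℕ.+-cancelˡ-≡ h _ _ (≡.trans (≡.cong (ℕ._+ contracted# id F) (≡.sym ∣F∣≡h)) (≡.trans (count-edges id F legal) (≡.sym #edges))))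
        where
        alive : ∀ e → ¬ DilatedE π e → FE.live e ≡ true
        alive e ¬dil = bool (FE.live e) ≡.refl
          where
          bool : ∀ b → FE.live e ≡ b → FE.live e ≡ true
          bool true  eq = eq
          bool false eq = contradiction (dead⇒dilatedE eq) ¬dil
        legal : Legal id F
        legal = legal-intro id F λ e e∈ → alive e (undilated e e∈)
        ∣F∣≡h : ∣ F ∣ ≡ h
        ∣F∣≡h = ℤ.+-injective (≡.trans size (≡.sym h-spec))

      exponent⇒ogod : ∀ {s} → exponent LV.label id F ≡ just s →
                      Ogod π F × rank π F ≡ #components Γdil ℕ.+ s
      exponent⇒ogod {s} exp = (size , (λ e e∈ dil → contradiction (≡.trans (≡.sym (legal-member id F legal e e∈)) (dilatedE⇒dead dil)) λ ())
          , preserved⇒connected (λ x → linked-mono {S = preimage π S′} {preimage π S″} (λ e → proj₁ (accumulate⇔∖ legal) (πE e)) (pres x)))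
        , ≡.trans (≡.sym (classes-count {S′} {S″} _ (proj₁ (accumulate⇔∖ legal)) (proj₂ (accumulate⇔∖ legal)) (proj₁ (proj₂ final)) (#components-Components S″)))
            (cancel (proj₂ (proj₂ final)))
        where
        sound = Dyn.exponent-sound id F initial-compatible exp
        pres = proj₁ sound
        legal = proj₁ (proj₂ sound)
        final = proj₂ (proj₂ (proj₂ sound)) _ (initial-classes (#components-Components Γdil))
        size : + ∣ F ∣ ≡ relGenus π
        size = ≡.trans (≡.cong +_ (ℕ.+-cancelʳ-≡ FV.#free _ _ (≡.trans (≡.cong (∣ F ∣ ℕ.+_) (≡.sym (proj₁ (proj₂ (proj₂ sound)))))
          (≡.trans (count-edges id F legal) (≡.sym #edges))))) h-spec
        cancel : ∀ {q′} → q′ ℕ.+ FV.#free ≡ (#components Γdil ℕ.+ FV.#free) ℕ.+ s → q′ ≡ #components Γdil ℕ.+ s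
        cancel {q′} eq = ℕ.+-cancelʳ-≡ FV.#free q′ _ (≡.trans eq (≡.trans (ℕ.+-assoc (#components Γdil) FV.#free s)
          (≡.trans (≡.cong (#components Γdil ℕ.+_) (ℕ.+-comm FV.#free s)) (≡.sym (ℕ.+-assoc (#components Γdil) s FV.#free)))))

  edge-count : ∀ h → + h ≡ relGenus π → h ℕ.+ FV.#free ≡ FE.#free
  edge-count h h-spec = ℤ.+-injective (≡.trans (ℤ.pos-+ h FV.#free) (≡.trans (≡.cong (ℤ._+ + FV.#free) (≡.trans h-spec genus-difference)) (cancel (+ FE.#free) (+ FV.#free))))
    where
    cancel : ∀ m n → (m ℤ.- n) ℤ.+ n ≡ m
    cancel = ℤ-Solver.solve-∀
    regroup : ∀ e m v n → ((e ℤ.+ m) ℤ.- (v ℤ.+ n) ℤ.+ + 1) ℤ.- (e ℤ.- v ℤ.+ + 1) ≡ m ℤ.- n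
    regroup = ℤ-Solver.solve-∀
    genus-difference : relGenus π ≡ + FE.#free ℤ.- + FV.#free
    genus-difference = ≡.trans
      (≡.cong₂ (λ e v → (e ℤ.- v ℤ.+ + 1) ℤ.- (+ B.#E ℤ.- + B.#V ℤ.+ + 1))
        (≡.trans (≡.cong +_ FE.cardinality) (ℤ.pos-+ B.#E FE.#free)) (≡.trans (≡.cong +_ FV.cardinality) (ℤ.pos-+ B.#V FV.#free)))
      (regroup (+ B.#E) (+ FE.#free) (+ B.#V) (+ FV.#free))

-- The volume

module IntegralGram {c ℓ₁ ℓ₂} (𝔽 : OrderedField c ℓ₁ ℓ₂) where
  open OrderedField 𝔽 hiding (det)
  open OrderedFieldProperties 𝔽
  open CommutativeRing commutativeRing using (refl; sym; trans)
  open D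
  open Relation.Binary.Reasoning.Setoid setoid

  integral-complementary-gram : ∀ {h n} (C : ℤ-Det.Matrix (h ℕ.+ n) h) (S : ℤ-Det.Matrix (h ℕ.+ n) n)
    (C* : ℤ-Det.Matrix h (h ℕ.+ n)) (B : ℤ-Det.Matrix n (h ℕ.+ n)) (l l⁻¹ : Vector Carrier (h ℕ.+ n)) →
    (∀ a → l a * l⁻¹ a ≈ 1#) →
    (∀ a b → (C ℤ-Det.⊗ C*) a b ℤ.+ (S ℤ-Det.⊗ B) a b ≡ ℤ-Det.δ a b) →
    (∀ i j → (C* ℤ-Det.⊗ C) i j ≡ ℤ-Det.δ i j) →
    (∀ v j → (B ℤ-Det.⊗ C) v j ≡ + 0) →
    (∀ v w → (B ℤ-Det.⊗ S) v w ≡ ℤ-Det.δ v w) →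
    ℤ-Det.det (C* ++ B) ℤ.* ℤ-Det.det (C* ++ B) ≡ + 1 →
    det (λ i j → sum λ a → fromℤ (C a i) * (l a * fromℤ (C a j)))
      ≈ product l * det (λ v w → sum λ a → fromℤ (B v a) * l⁻¹ a * fromℤ (B w a))
  integral-complementary-gram {h} {n} C S C* B l l⁻¹ ll⁻¹≈1 UV C*C BC BS unimodular =
    BlockMatrices.complementary-gram commutativeRing (fromℤᴹ C) (fromℤᴹ S) (fromℤᴹ C*) (fromℤᴹ B) l l⁻¹ ll⁻¹≈1
      (λ a b → trans (+-cong (sym (fromℤ-⊗ C C* a b)) (sym (fromℤ-⊗ S B a b)))
        (trans (sym (fromℤ-+ ((C ℤ-Det.⊗ C*) a b) ((S ℤ-Det.⊗ B) a b))) (transfer (UV a b) (fromℤ-δ a b))))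
      (λ i j → trans (sym (fromℤ-⊗ C* C i j)) (transfer (C*C i j) (fromℤ-δ i j)))
      (λ v j → trans (sym (fromℤ-⊗ B C v j)) (transfer (BC v j) refl))
      (λ v w → trans (sym (fromℤ-⊗ B S v w)) (transfer (BS v w) (fromℤ-δ v w)))
      det²
    where
    transfer : ∀ {x y : ℤ} {z} → x ≡ y → fromℤ y ≈ z → fromℤ x ≈ z
    transfer ≡.refl eq = eq
    V = C* ++ B
    above : fromℤᴹ C* ++ fromℤᴹ B ≋ fromℤᴹ V
    above i j with splitAt h i
    ... | inj₁ _ = refl
    ... | inj₂ _ = refl
    det² : det (fromℤᴹ C* ++ fromℤᴹ B) * det (fromℤᴹ C* ++ fromℤᴹ B) ≈ 1#
    det² = begin
      det (fromℤᴹ C* ++ fromℤᴹ B) * det (fromℤᴹ C* ++ fromℤᴹ B) ≈⟨ *-cong (det-cong above) (det-cong above) ⟩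
      det (fromℤᴹ V) * det (fromℤᴹ V)                 ≈⟨ *-cong (fromℤ-det V) (fromℤ-det V) ⟨
      fromℤ (ℤ-Det.det V) * fromℤ (ℤ-Det.det V)       ≈⟨ fromℤ-* (ℤ-Det.det V) (ℤ-Det.det V) ⟨
      fromℤ (ℤ-Det.det V ℤ.* ℤ-Det.det V)             ≈⟨ transfer unimodular fromℤ-1 ⟩
      1#                                              ∎

module PrymVolume {c ℓ₁ ℓ₂} {𝔽 : OrderedField c ℓ₁ ℓ₂} {Γ̃ Γ : MetricGraph 𝔽}
         (π : DoubleCover Γ̃ Γ) (o : CompatibleOrientations π)
         {h : ℕ} (h-spec : + h ≡ relGenus π) (μ : BasisK′ π o h) where
  open DoubleCover π
  open CoverStructure π o
  open Chains π o
  open PrymGram π o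
  open OrderedField 𝔽 hiding (det)
  open OrderedFieldProperties 𝔽
  open CommutativeRing commutativeRing using (refl; sym; trans)
  open D hiding (δ-sym; δ-≢; δ-refl; δ-injective; sum-zero; sum-only; sum-pair)
  open IntegralGram 𝔽
  open Algebra.Properties.Semiring.Sum semiring using (sum-cong-≋)
  open Algebra.Properties.Ring ring using (-‿distribˡ-*)
  open Relation.Binary.Reasoning.Setoid setoid

  #edges : h ℕ.+ n ≡ FE.#free
  #edges = Ogods.edge-count π o h h-spec

  len⁻¹ : B.E → Carrier
  len⁻¹ e = B.len e ⁻¹

  len-inverse : ∀ e → B.len e * len⁻¹ e ≈ 1#
  len-inverse e = *-inverseʳ (>⇒≉ (B.len-positive e))

  open LabelledLaplacian 𝔽 (source ∘ FE.lift) (sink ∘ FE.lift) FE.live B.len len⁻¹ len-inverse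
  open Contraction (source ∘ FE.lift) (sink ∘ FE.lift) FE.live using (exponent)

  undilated : Fin (h ℕ.+ n) → B.E
  undilated a = enumerate FE.live (≡.subst Fin #edges a)

  sum-undilated : ∀ {a b} (R : CommutativeMonoid a b) (g : B.E → CommutativeMonoid.Carrier R) →
    let open CommutativeMonoid R renaming (_≈_ to _≈ᴿ_; ε to εᴿ)
        ∑ᴿ = λ {n} → Algebra.Properties.CommutativeMonoid.Sum.sum R {n}
    in ∑ᴿ (g ∘ undilated) ≈ᴿ ∑ᴿ (λ e → if FE.live e then g e else εᴿ)
  sum-undilated R g = R.trans (R.reflexive (subst-sum R #edges (g ∘ enumerate FE.live)))
    (EnumeratedSums.sum-enumerate R FE.live g)
    where module R = CommutativeMonoid R

  M : ℤ-Det.Matrix h T.#E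
  M = BasisK′.basis μ

  lift-undilated : Fin (h ℕ.+ n) → T.E
  lift-undilated a = FE.lift (undilated a)

  C : ℤ-Det.Matrix (h ℕ.+ n) h
  C a j = M j (lift-undilated a)

  length : Vector Carrier (h ℕ.+ n)
  length = B.len ∘ undilated

  -- The edge length form on K′ taken over one lift of each undilated edge; taken over both lifts it
  -- would be doubled.
  G : Matrix h h
  G i j = sum λ a → fromℤ (C a i) * (length a * fromℤ (C a j))

  select-* : ∀ b x y z → (if b then x * (y * z) else 0#) ≈ x * ((if b then y else 0#) * z)
  select-* true  x y z = refl
  select-* false x y z = sym (trans (*-congˡ (zeroˡ z)) (zeroʳ x))

  laplacian-undilated : ∀ {n′} (ρ : T.V → Label n′) (B : ℤ-Det.Matrix n′ (h ℕ.+ n)) →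
    (∀ v a → B v a ≡ difference (ρ (source (lift-undilated a))) (ρ (sink (lift-undilated a))) v) → ∀ v w →
    sum (λ a → fromℤ (B v a) * len⁻¹ (undilated a) * fromℤ (B w a)) ≈ laplacian ρ id v w
  laplacian-undilated ρ B B-spec v w = trans
    (sum-cong-≋ λ a → trans (*-assoc _ _ _) (*-cong (reflexive (≡.cong fromℤ (B-spec v a))) (*-congˡ (reflexive (≡.cong fromℤ (B-spec w a))))))
    (trans (sum-undilated +-commutativeMonoid (λ e → incidence ρ e v * (len⁻¹ e * incidence ρ e w)))
      (sum-cong-≋ λ e → select-* (FE.live e) (incidence ρ e v) (len⁻¹ e) (incidence ρ e w)))

  det-from-splitting : (S : ℤ-Det.Matrix (h ℕ.+ n) n) (C* : ℤ-Det.Matrix h (h ℕ.+ n)) (B : ℤ-Det.Matrix n (h ℕ.+ n)) →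
    (∀ v a → B v a ≡ difference (ρ (source (lift-undilated a))) (ρ (sink (lift-undilated a))) v) →
    (∀ a b → (C ℤ-Det.⊗ C*) a b ℤ.+ (S ℤ-Det.⊗ B) a b ≡ ℤ-Det.δ a b) →
    (∀ i j → (C* ℤ-Det.⊗ C) i j ≡ ℤ-Det.δ i j) →
    (∀ v j → (B ℤ-Det.⊗ C) v j ≡ + 0) →
    (∀ v w → (B ℤ-Det.⊗ S) v w ≡ ℤ-Det.δ v w) →
    ℤ-Det.det (C* ++ B) ℤ.* ℤ-Det.det (C* ++ B) ≡ + 1 →
    det G ≈ ∑ₗ (subsets B.#E) (term ρ id)
  det-from-splitting S C* B B-spec UV C*C BC BS unimodular = begin
    det G ≈⟨ integral-complementary-gram C S C* B length (len⁻¹ ∘ undilated) (len-inverse ∘ undilated) UV C*C BC BS unimodular ⟩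
    product length * det (λ v w → sum λ a → fromℤ (B v a) * len⁻¹ (undilated a) * fromℤ (B w a))
      ≈⟨ *-cong (sum-undilated *-commutativeMonoid B.len) (det-cong (laplacian-undilated ρ B B-spec)) ⟩
    product (λ e → volume e) * det (laplacian ρ id)  ≈⟨ laplacian-expansion B.#E ρ id ⟩
    ∑ₗ (subsets B.#E) (term ρ id)       ∎

  det-G : (origin : T.V) → FV.σ origin ≡ origin → (ζ : ℤ-Det.Matrix n T.#E) → (∀ v → EdgeChain origin (LV.ν v) (ζ v)) →
          det G ≈ ∑ₗ (subsets B.#E) (term ρ id)
  det-G origin fixed ζ ∂ζ = det-by (proj₁ ∘ f-span) (proj₂ ∘ f-span)
    where
    open Splitting μ #edges origin fixed ζ ∂ζ hiding (C; M)
    det-by : (coord : ℤ-Det.Matrix (h ℕ.+ n) h) → (∀ a ẽ → f a ẽ ≡ mul (coord a) M ẽ) → det G ≈ ∑ₗ (subsets B.#E) (term ρ id)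
    det-by coord spec = det-from-splitting S (SC.C* M s t B edgeᵘ coord t-ε BC≡0 M-independent spec) B (λ v a → ≡.refl)
      (SC.UV≡1 M s t B edgeᵘ coord t-ε BC≡0 M-independent spec) (SC.C*C≡1 M s t B edgeᵘ coord t-ε BC≡0 M-independent spec)
      BC≡0 BS≡1 (SC.unimodular M s t B edgeᵘ coord t-ε BC≡0 M-independent spec)
      where module SC = SplitCoordinates

  -- On the two lifts of an edge `b` has opposite coefficients, so `a` enters through a - σ a; on
  -- dilated edges `b` vanishes. This is how 1 - σ arises from the pairing.
  pairing-antiinvariant : ∀ a b → Antiinvariant b →
    pairing π a b ≈ sum λ i → fromℤ (anti a (lift-undilated i) ℤ.* b (lift-undilated i)) * length i
  pairing-antiinvariant a b antiinv = begin
    sum g ≈⟨ LE.FreeSums.sum-free +-commutativeMonoid g vanish ⟩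
    sum (λ i → g (LE.ν i) + g (σᴱ (LE.ν i)))         ≈⟨ sum-cong-≋ pointwise ⟩
    sum (λ i → fromℤ (anti a (LE.ν i) ℤ.* b (LE.ν i)) * B.len (enumerate FE.live i))
      ≡⟨ subst-sum +-commutativeMonoid #edges (λ i → fromℤ (anti a (LE.ν i) ℤ.* b (LE.ν i)) * B.len (enumerate FE.live i)) ⟨
    sum (λ i → fromℤ (anti a (lift-undilated i) ℤ.* b (lift-undilated i)) * length i) ∎
    where
    g : T.E → Carrier
    g ẽ = fromℤ (a ẽ ℤ.* b ẽ) * T.len ẽ
    vanish : ∀ ẽ → σᴱ ẽ ≡ ẽ → g ẽ ≈ 0#
    vanish ẽ fix = trans (*-congʳ (reflexive (≡.cong fromℤ (≡.trans
      (≡.cong (a ẽ ℤ.*_) (self-negative (b ẽ) (≡.trans (≡.cong b (≡.sym fix)) (antiinv ẽ)))) (ℤ.*-zeroʳ (a ẽ)))))) (zeroˡ _)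
    regroup : ∀ x y z → x ℤ.* z ℤ.+ y ℤ.* (ℤ.- z) ≡ (x ℤ.- y) ℤ.* z
    regroup = ℤ-Solver.solve-∀
    pointwise : ∀ i → g (LE.ν i) + g (σᴱ (LE.ν i)) ≈ fromℤ (anti a (LE.ν i) ℤ.* b (LE.ν i)) * B.len (enumerate FE.live i)
    pointwise i = begin
      fromℤ (a ẽ ℤ.* b ẽ) * T.len ẽ + fromℤ (a (σᴱ ẽ) ℤ.* b (σᴱ ẽ)) * T.len (σᴱ ẽ)
        ≈⟨ +-cong (*-congˡ (same-length ẽ (LE.ν-live i) (LE.proj-ν i)))
             (*-congˡ (same-length (σᴱ ẽ) (≡.trans (≡.cong FE.live (FE.proj-σ ẽ)) (LE.ν-live i)) (≡.trans (FE.proj-σ ẽ) (LE.proj-ν i)))) ⟩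
      fromℤ (a ẽ ℤ.* b ẽ) * l + fromℤ (a (σᴱ ẽ) ℤ.* b (σᴱ ẽ)) * l   ≈⟨ distribʳ l _ _ ⟨
      (fromℤ (a ẽ ℤ.* b ẽ) + fromℤ (a (σᴱ ẽ) ℤ.* b (σᴱ ẽ))) * l ≈⟨ *-congʳ (fromℤ-+ (a ẽ ℤ.* b ẽ) (a (σᴱ ẽ) ℤ.* b (σᴱ ẽ))) ⟨
      fromℤ (a ẽ ℤ.* b ẽ ℤ.+ a (σᴱ ẽ) ℤ.* b (σᴱ ẽ)) * l
        ≡⟨ ≡.cong (λ z → fromℤ z * l) (≡.trans (≡.cong (λ t → a ẽ ℤ.* b ẽ ℤ.+ a (σᴱ ẽ) ℤ.* t) (antiinv ẽ)) (regroup (a ẽ) (a (σᴱ ẽ)) (b ẽ))) ⟩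
      fromℤ (anti a ẽ ℤ.* b ẽ) * l                                  ∎
      where
      ẽ = LE.ν i
      l = B.len (enumerate FE.live i)
      same-length : ∀ x → FE.live (πE x) ≡ true → πE x ≡ enumerate FE.live i → T.len x ≈ l
      same-length x alive eq = trans (len-free x alive) (reflexive (≡.cong B.len eq))

  det-pairing : (K : ℤ-Det.Matrix h T.#E) (A : ℤ-Det.Matrix h h) → (∀ i ẽ → anti (K i) ẽ ≡ mul (A i) M ẽ) →
                det (λ i j → pairing π (K i) (M j)) ≈ fromℤ (ℤ-Det.det A) * det G
  det-pairing K A A-spec = begin
    det (λ i j → pairing π (K i) (M j))  ≈⟨ det-cong entry ⟩
    det (fromℤᴹ A ⊗ G)                   ≈⟨ det-⊗ (fromℤᴹ A) G ⟩
    det (fromℤᴹ A) * det G               ≈⟨ *-congʳ (fromℤ-det A) ⟨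
    fromℤ (ℤ-Det.det A) * det G          ∎
    where
    Cᵀ : ℤ-Det.Matrix h (h ℕ.+ n)
    Cᵀ i a = C a i
    LC : Matrix (h ℕ.+ n) h
    LC a j = length a * fromℤ (C a j)
    entry : ∀ i j → pairing π (K i) (M j) ≈ (fromℤᴹ A ⊗ G) i j
    entry i j = begin
      pairing π (K i) (M j)
        ≈⟨ pairing-antiinvariant (K i) (M j) (push≡0⇒antiinvariant {M j} (proj₂ (IsBasis.members (BasisK′.isBasis μ) j))) ⟩
      sum (λ a → fromℤ (anti (K i) (lift-undilated a) ℤ.* C a j) * length a)
        ≈⟨ sum-cong-≋ (λ a → trans (*-congʳ (trans (reflexive (≡.cong (λ z → fromℤ (z ℤ.* C a j)) (A-spec i (lift-undilated a))))
             (fromℤ-* ((A ℤ-Det.⊗ Cᵀ) i a) (C a j)))) (trans (*-assoc _ _ _) (*-cong (fromℤ-⊗ A Cᵀ i a) (*-comm _ _)))) ⟩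
      sum (λ a → (fromℤᴹ A ⊗ fromℤᴹ Cᵀ) i a * LC a j)   ≈⟨ ⊗-assoc (fromℤᴹ A) (fromℤᴹ Cᵀ) LC i j ⟩
      (fromℤᴹ A ⊗ G) i j                                ∎

  ∑ₗ-filter : ∀ {a p} {A : Set a} {P : Pred A p} (P? : Decidable P) (xs : List A) {f g : A → Carrier} →
              (∀ x → P x → f x ≈ g x) → (∀ x → ¬ P x → g x ≈ 0#) → ∑ₗ (List.filter P? xs) f ≈ ∑ₗ xs g
  ∑ₗ-filter P? List.[]       on off = refl
  ∑ₗ-filter P? (x List.∷ xs) on off with P? x
  ... | yes p = +-cong (on x p) (∑ₗ-filter P? xs on off)
  ... | no ¬p = trans (∑ₗ-filter P? xs on off) (trans (sym (+-identityˡ _)) (+-congʳ (sym (off x ¬p))))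

  -- Sets that are not ogods have weight 0, so the sum over all subsets restricts to ogods, where
  -- the exponent is r(F) - d.
  ogod-sum : ∀ k → suc k ≡ #components (dilationSubgraph π) →
    2ꟳ ^ k * ∑ₗ (subsets B.#E) (term ρ id)
      ≈ 2ꟳ ^ℤ (+ 1 ℤ.- + suc k) * ∑ₗ (ogods π) (λ F → 4ꟳ ^ℤ (+ rank π F ℤ.- + 1) * ∏ (λ e → e ∈? F) B.len)
  ogod-sum k components = begin
    2ꟳ ^ k * ∑ₗ (subsets B.#E) (term ρ id) ≈⟨ *-distribˡ-∑ₗ (2ꟳ ^ k) (subsets B.#E) (term ρ id) ⟩
    ∑ₗ (subsets B.#E) (λ F → 2ꟳ ^ k * term ρ id F) ≈⟨ ∑ₗ-filter (ogod? π) (subsets B.#E) on-ogod off-ogod ⟨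
    ∑ₗ (ogods π) (λ F → u * summand F)                     ≈⟨ *-distribˡ-∑ₗ u (ogods π) summand ⟨
    u * ∑ₗ (ogods π) summand                               ∎
    where
    u = 2ꟳ ^ℤ (+ 1 ℤ.- + suc k)
    summand : Subset B.#E → Carrier
    summand F = 4ꟳ ^ℤ (+ rank π F ℤ.- + 1) * ∏ (λ e → e ∈? F) B.len
    on-ogod : ∀ F → Ogod π F → u * summand F ≈ 2ꟳ ^ k * term ρ id F
    on-ogod F ogod = on (Ogods.ogod⇒exponent π o F h h-spec #edges ogod)
      where
      on : (∃ λ s → exponent ρ id F ≡ just s) → u * summand F ≈ 2ꟳ ^ k * term ρ id F
      on (s , exp) = begin
        u * summand F ≡⟨ ≡.cong (λ r → u * (4ꟳ ^ℤ (+ r ℤ.- + 1) * lengths id F)) rank≡ ⟩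
        u * (4ꟳ ^ℤ (+ (suc k ℕ.+ s) ℤ.- + 1) * lengths id F) ≈⟨ rescale k s (lengths id F) ⟩
        2ꟳ ^ k * (4ꟳ ^ s * lengths id F) ≡⟨ ≡.cong (λ e → 2ꟳ ^ k * (weight e * lengths id F)) exp ⟨
        2ꟳ ^ k * term ρ id F                                                     ∎
        where
        rank≡ : rank π F ≡ suc k ℕ.+ s
        rank≡ = ≡.trans (proj₂ (Ogods.exponent⇒ogod π o F h h-spec #edges exp)) (≡.cong (ℕ._+ s) (≡.sym components))
    off-ogod : ∀ F → ¬ Ogod π F → 2ꟳ ^ k * term ρ id F ≈ 0#
    off-ogod F ¬ogod = off (exponent ρ id F) ≡.refl
      where
      off : ∀ e → exponent ρ id F ≡ e → 2ꟳ ^ k * term ρ id F ≈ 0#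
      off (just s) exp = contradiction (proj₁ (Ogods.exponent⇒ogod π o F h h-spec #edges exp)) ¬ogod
      off nothing  exp = trans (*-congˡ (trans (*-congʳ (reflexive (≡.cong weight exp))) (zeroˡ _))) (zeroʳ _)

  weight-nonnegative : ∀ e → Nonnegative (weight e)
  weight-nonnegative nothing  = inj₂ refl
  weight-nonnegative (just s) = inj₁ (^-positive s (+-positiveˡ 0<1 (ℕ-nonnegative 3)))

  volume-formula : ∀ {k} → suc k ≡ #components (dilationSubgraph π) → (κ : BasisK π o h) →
    (origin : T.V) → FV.σ origin ≡ origin → (∀ x → ∃ λ γ → EdgeChain origin x γ) →
    (A : ℤ-Det.Matrix h h) → (∀ i ẽ → anti (BasisK.basis κ i) ẽ ≡ mul (A i) M ẽ) → ℤ.∣ ℤ-Det.det A ∣ ≡ 2 ℕ.^ k →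
    Vol² π κ μ ≈ 2ꟳ ^ℤ (+ 1 ℤ.- + suc k) * ∑ₗ (ogods π) (λ F → 4ꟳ ^ℤ (+ rank π F ℤ.- + 1) * ∏ (λ e → e ∈? F) B.len)
  volume-formula {k} components κ origin fixed reach A A-spec ∣det∣ = trans (abs-± nonnegative ±value) (ogod-sum k components)
    where
    total = ∑ₗ (subsets B.#E) (term ρ id)
    nonnegative : Nonnegative (2ꟳ ^ k * total)
    nonnegative = *-nonnegative (inj₁ (^-positive k (+-positiveˡ 0<1 (ℕ-nonnegative 1))))
      (∑ₗ-nonnegative (subsets B.#E) λ F → *-nonnegative (weight-nonnegative (exponent ρ id F)) (∏-nonnegative (λ e → e ∈? F) B.len-positive))
    value : OrderedField.det 𝔽 (λ i j → pairing π (BasisK.basis κ i) (M j)) ≈ fromℤ (ℤ-Det.det A) * total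
    value = trans (det-agrees (λ i j → pairing π (BasisK.basis κ i) (M j))) (trans (det-pairing (BasisK.basis κ) A A-spec)
      (*-congˡ (det-G origin fixed (λ v → proj₁ (reach (LV.ν v))) (λ v → proj₂ (reach (LV.ν v))))))
    magnitude : ℤ.∣ ℤ-Det.det A ∣ · 1# ≈ 2ꟳ ^ k
    magnitude = trans (reflexive (≡.cong (λ m → m · 1#) ∣det∣)) (fromℤ-^ 2 k)
    ±value : _ ≈ 2ꟳ ^ k * total ⊎ _ ≈ - (2ꟳ ^ k * total)
    ±value = case fromℤ-± (ℤ-Det.det A) of λ
      { (inj₁ p) → inj₁ (trans value (*-congʳ (trans p magnitude)))
      ; (inj₂ q) → inj₂ (trans value (trans (*-congʳ (trans q (-‿cong magnitude))) (sym (-‿distribˡ-* _ _)))) }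

module _ {c ℓ₁ ℓ₂} (𝔽 : OrderedField c ℓ₁ ℓ₂) (Γ̃ Γ : MetricGraph 𝔽) (π : DoubleCover Γ̃ Γ)
  (connected : Connected (whole (MetricGraph.graph Γ)))
  (h : ℕ) (h-spec : + h ≡ relGenus π) (o : CompatibleOrientations π) (κ : BasisK π o h) (μ : BasisK′ π o h) where
  open OrderedField 𝔽

  -- A dilated vertex excludes d = 0, and `k` = d - 1 becomes available as the exponent of the
  -- lattice index.
  volume-by-components : ∀ d → Components (dilationSubgraph π) d → Dilated π → d ≡ #components (dilationSubgraph π) →
    Vol² π κ μ ≈ fromℤ (+ 2) ^ℤ (+ 1 ℤ.- + d)
      * ∑ₗ (ogods π) (λ F → fromℤ (+ 4) ^ℤ (+ rank π F ℤ.- + 1) * ∏ (λ e → e ∈? F) (MetricGraph.len Γ))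
  volume-by-components zero    K (v , dil) eq with Components.index K v dil
  ... | ()
  volume-by-components (suc k) K _ eq = PrymVolume.volume-formula π o h-spec μ eq κ
    P.origin (P.base-fixed zero) P.reach P.A P.A-spec P.anti-index
    where module P = PrymLattice π o connected K κ μ

theorem1p1 : ∀ {c ℓ₁ ℓ₂ : Level} (𝔽 : OrderedField c ℓ₁ ℓ₂)
    (Γ̃ Γ : MetricGraph 𝔽) (π : DoubleCover Γ̃ Γ) →
    Connected (whole (MetricGraph.graph Γ)) →
    Dilated π →
    (h : ℕ) → + h ≡ relGenus π →
    (o : CompatibleOrientations π) (κ : BasisK π o h) (μ : BasisK′ π o h) →
    let open OrderedField 𝔽
        d = #components (dilationSubgraph π)
    in Vol² π κ μ
         ≈ fromℤ (+ 2) ^ℤ (+ 1 ℤ.- + d)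
           * ∑ₗ (ogods π) (λ F →
               fromℤ (+ 4) ^ℤ (+ rank π F ℤ.- + 1)
               * ∏ (λ e → e ∈? F) (MetricGraph.len Γ))
theorem1p1 𝔽 Γ̃ Γ π connected dilated h h-spec o κ μ =
  volume-by-components 𝔽 Γ̃ Γ π connected h h-spec o κ μ _ (#components-Components (dilationSubgraph π)) dilated ≡.refl
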